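{- Let $p>3$ be a prime. Then $$\sum_{n=0}^{(p-1)/2}\frac{6n+1}{256^n}\binom{2n}n^3\equiv p(-1)^{(p-1)/2}+(-1)^{(p-1)/2}\frac{7}{24}p^4B_{p-3}\pmod{p^5}.$$
   Context: $B_0,B_1,\ldots$ are the Bernoulli numbers, defined by $\frac{x}{e^x-1}=\sum_{n\ge0}B_n\frac{x^n}{n!}$. For rational numbers $a,b$ whose denominators are coprime to $p$, $a\equiv b\pmod{p^m}$ means that $(a-b)/p^m$ is a rational number with denominator coprime to $p$. -}

module Defs where

open import Data.Nat as ℕ using (ℕ; zero; suc)
open import Data.Nat.Properties using (m^n≢0)
open import Data.Nat.Coprimality using (Coprime)
open import Data.Nat.Combinatorics using (_C_)
open import Data.Integer as ℤ using (ℤ; +_)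
open import Data.Rational using (ℚ; _/_; _+_; _*_; _-_; -_; 0ℚ; 1ℚ; ↧ₙ_)
open import Data.Fin using (Fin; toℕ; fromℕ)
open import Data.Vec using (Vec; []; _∷ʳ_; lookup; last)

ℕtoℚ : ℕ → ℚ
ℕtoℚ n = + n / 1

infixr 8 _^ℚ_
_^ℚ_ : ℚ → ℕ → ℚ
q ^ℚ zero = 1ℚ
q ^ℚ suc n = q * (q ^ℚ n)

Σ< : ℕ → (ℕ → ℚ) → ℚ
Σ< zero f = 0ℚ
Σ< (suc n) f = Σ< n f + f n

ΣFin : (n : ℕ) → (Fin n → ℚ) → ℚ
ΣFin zero f = 0ℚ
ΣFin (suc n) f = ΣFin n (λ i → f (Data.Fin.inject₁ i)) + f (fromℕ n)

-- Bernoulli numbers with x/(e^x-1) = Σ B_n x^n/n!, i.e. B_1 = -1/2.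
-- Comparing coefficients of x^{n+1} in x = (e^x - 1) Σ B_k x^k/k! gives
--   B_0 = 1,  Σ_{k=0}^{n} C(n+1,k) B_k = 0  (n ≥ 1),
-- i.e. B_n = -1/(n+1) Σ_{k<n} C(n+1,k) B_k.
-- bernoulliVec n = (B_0, …, B_{n-1})
bernoulliVec : (n : ℕ) → Vec ℚ n
bernoulliVec zero = []
bernoulliVec (suc zero) = [] ∷ʳ 1ℚ
bernoulliVec (suc (suc n)) =
  let v = bernoulliVec (suc n) in
  v ∷ʳ (- ((+ 1 / suc (suc n)) *
           ΣFin (suc n) (λ k → ℕtoℚ (suc (suc n) C toℕ k) * lookup v k)))

bernoulli : ℕ → ℚ
bernoulli n = last (bernoulliVec (suc n))

-- 1 / p^m (for p = 0 irrelevant; defined as 0)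
invPow : ℕ → ℕ → ℚ
invPow zero m = 0ℚ
invPow (suc k) m = (+ 1 / (suc k ℕ.^ m)) {{m^n≢0 (suc k) m}}

_≡_[mod_^_] : ℚ → ℚ → ℕ → ℕ → Set
a ≡ b [mod p ^ m ] = Coprime p (↧ₙ ((a - b) * invPow p m))

{-# OPTIONS --safe #-}
module Submission where

open import Defs
open import Data.Nat as ℕ using (ℕ; zero; suc; z≤n; s≤s; _<_; _∸_; _^_)
import Data.Nat.Properties as ℕ
import Data.Nat.DivMod as ℕ
open import Data.Nat.Combinatorics using (_C_; nCk+nC[k+1]≡[n+1]C[k+1]; nCk≡nC[n∸k]; nCn≡1; nC1≡n; k>n⇒nCk≡0)
open import Data.Nat.Coprimality using (Coprime)
import Data.Nat.Coprimality as Coprime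
open import Data.Nat.Divisibility using (_∣_; divides; ∣-trans; ∣⇒≤; _∣0; ∣1⇒≡1)
open import Data.Nat.Primality using (Prime; euclidsLemma; prime⇒irreducible; ¬prime[0]; ¬prime[1])
open import Data.Integer as ℤ using (ℤ; +_; -[1+_])
import Data.Integer.Divisibility.Signed as ℤ∣
import Data.Integer.Properties as ℤ
open import Data.Rational using (ℚ; mkℚ; 0ℚ; 1ℚ; ½; _+_; _*_; _-_; -_; _/_; 1/_; ≢-nonZero; ↥_; ↧ₙ_)
import Data.Rational as ℚ
import Data.Rational.Properties as ℚ
open import Data.Fin using (Fin; toℕ; fromℕ; inject₁)
open import Data.Fin.Properties using (toℕ-fromℕ; toℕ-inject₁)
open import Data.Vec using (Vec; []; _∷_; _∷ʳ_; lookup)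
open import Data.Vec.Properties using (last-∷ʳ)
open import Data.Product using (Σ; _×_; _,_; proj₁; proj₂)
open import Data.Sum using (_⊎_; inj₁; inj₂)
open import Data.Empty using (⊥; ⊥-elim)
open import Function using (_∘_)
open import Relation.Nullary using (¬_; yes; no)
open import Relation.Nullary.Decidable using (dec⇒maybe)
open import Relation.Binary.PropositionalEquality using (_≡_; _≢_; refl; sym; trans; cong; cong₂; subst; module ≡-Reasoning)
open import Tactic.RingSolver using (solve-∀)
open import Tactic.RingSolver.Core.AlmostCommutativeRing using (AlmostCommutativeRing; fromCommutativeRing)

-- Write p = 2N + 1 and deform the sum by a parameter x:
--   Σ_{k≤N} (6k+1) ((1+x)/2)_k ((1-x)/2)_k (1/2)_k / ((1+x/4)_k (1-x/4)_k k! 4^k).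
-- A WZ argument in steps x ↦ x + 4 gives the value (-1)^M (2M+1) at x = 2M+1, M ≤ N.
-- Multiplied by Q(x) = Π_{k≤N} (1 - x²/(16k²)) the deformed sum is a polynomial in x² of
-- degree N, so Lagrange interpolation at the nodes x = p - 2i (equivalently, vanishing of
-- a p-th difference) evaluates it at x = 0, where it is the sum S of the theorem:
--   S · Σ_i (-1)^i C(p,i) p/(p-2i) = (-1)^N p · Σ_i C(p,i) Q(p-2i),   0 ≤ i ≤ p.
-- Both sums over i are computed modulo p⁴ through the harmonic sums
--   h₂ = Σ 1/k², h₃ = Σ 1/k³ (k ≤ N),  A = Σ_{k<p} H_{k-1}/k²,
--   E = Σ_{r≤N} H_{2r-1}/r²,  Y = Σ_{r≤N} H_{r-1}/r².
-- Splitting sums at p/2 and by parity, and Σ_k (-1)^{k-1} C(p,k)/k = H_p, express all of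
-- these by h₃, so that (-1)^N S ≡ p - (7/48) p⁴ h₃ modulo p⁵.  Finally h₃ ≡ -2 B_{p-3}
-- modulo p, because the power sums Σ_{k<p} k^j satisfy modulo p² the recurrence of p B_j.

open ≡-Reasoning

-- The truncation at `N` is what makes the sum hard: as it stands, no term vanishes and no closed
-- form is available. With the parameter, all terms k > M vanish at x = 2M+1, so for M ≤ N cutting
-- off at `N` loses nothing there. This gives N+1 values of x², exactly as many as a polynomial of
-- degree N in x² needs. Listing the nodes with both signs makes them equally spaced, so the
-- interpolation weights become signed binomials C(p,i). The power of p comes from the two end nodes
-- p and -p. Relative to these two terms, all inner terms carry a factor p² on both sides of the
-- interpolation identity, because p divides the inner binomials and, at an end, the node itself. So
-- inner terms have to be expanded only modulo p² to reach p⁴, and double harmonic sums only modulo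
-- p. The constant 7/48 is 14/96: the sum of Q contributes 10/96, the sum of weights 4/96.

ringℚ : AlmostCommutativeRing _ _
ringℚ = fromCommutativeRing ℚ.+-*-commutativeRing λ x → dec⇒maybe (0ℚ ℚ.≟ x)

-- Integers inside the rationals, inverses, signs

#_ : ℕ → ℚ
# n = ℕtoℚ n
infix 11 #_

ι : ℤ → ℚ
ι z = z / 1

-- Division normalises by a gcd, so `z / 1` does not compute for a variable z. The literal fraction
-- does, and the homomorphism laws below rest on it.
ι-mkℚ : ∀ z → ι z ≡ mkℚ z 0 (Coprime.sym (Coprime.1-coprimeTo _))
ι-mkℚ z = ℚ.↥p/↧p≡p (mkℚ z 0 (Coprime.sym (Coprime.1-coprimeTo _)))

ι-+ : ∀ z w → ι (z ℤ.+ w) ≡ ι z + ι w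
ι-+ z w = sym (trans (cong₂ _+_ (ι-mkℚ z) (ι-mkℚ w)) (cong ι (cong₂ ℤ._+_ (ℤ.*-identityʳ z) (ℤ.*-identityʳ w))))

ι-* : ∀ z w → ι (z ℤ.* w) ≡ ι z * ι w
ι-* z w = sym (cong₂ _*_ (ι-mkℚ z) (ι-mkℚ w))

ι-injective : ∀ {z w} → ι z ≡ ι w → z ≡ w
ι-injective {z} {w} eq = cong ↥_ (trans (sym (ι-mkℚ z)) (trans eq (ι-mkℚ w)))

#-+ : ∀ m n → # (m ℕ.+ n) ≡ # m + # n
#-+ m n = ι-+ (+ m) (+ n)

#-* : ∀ m n → # (m ℕ.* n) ≡ # m * # n
#-* m n = trans (cong ι (ℤ.pos-* m n)) (ι-* (+ m) (+ n))

#-suc : ∀ n → # (suc n) ≡ 1ℚ + # n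
#-suc n = #-+ 1 n

#-double : ∀ n → # (n ℕ.+ n) ≡ # 2 * # n
#-double n = trans (#-+ n n) (lem (# n))
  where
  lem : ∀ x → x + x ≡ # 2 * x
  lem = solve-∀ ringℚ

#-injective : ∀ {m n} → # m ≡ # n → m ≡ n
#-injective eq = ℤ.+-injective (ι-injective eq)

#suc≢0 : ∀ n → # (suc n) ≢ 0ℚ
#suc≢0 n eq with #-injective {suc n} {0} eq
... | ()

-- Made total by the value 0 at 0, so that sums of inverses carry no nonzero proofs; these enter
-- only through `⁻¹-inverse`.
_⁻¹ : ℚ → ℚ
q ⁻¹ with q ℚ.≟ 0ℚ
... | yes _ = 0ℚ
... | no q≢0 = 1/_ q {{≢-nonZero q≢0}}
infix 10 _⁻¹

⁻¹-inverse : ∀ {q} → q ≢ 0ℚ → q * q ⁻¹ ≡ 1ℚ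
⁻¹-inverse {q} q≢0 with q ℚ.≟ 0ℚ
... | yes q≡0 = ⊥-elim (q≢0 q≡0)
... | no q≢0′ = ℚ.*-inverseʳ q {{≢-nonZero q≢0′}}

x-y≡0⇒x≡y : ∀ {x y} → x - y ≡ 0ℚ → x ≡ y
x-y≡0⇒x≡y {x} {y} eq = trans (lem x y) (trans (cong (_+ y) eq) (ℚ.+-identityˡ y))
  where
  lem : ∀ x y → x ≡ x - y + y
  lem = solve-∀ ringℚ

x≡y⇒x-y≡0 : ∀ {x y} → x ≡ y → x - y ≡ 0ℚ
x≡y⇒x-y≡0 {x} refl = ℚ.+-inverseʳ x

inverse-unique : ∀ {u x y} → u * x ≡ 1ℚ → u * y ≡ 1ℚ → x ≡ y
inverse-unique {u} {x} {y} ux uy = begin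
  x             ≡⟨ sym (ℚ.*-identityʳ x) ⟩
  x * 1ℚ        ≡⟨ cong (x *_) (sym uy) ⟩
  x * (u * y)   ≡⟨ lem u x y ⟩
  (u * x) * y   ≡⟨ cong (_* y) ux ⟩
  1ℚ * y        ≡⟨ ℚ.*-identityˡ y ⟩
  y ∎
  where
  lem : ∀ u x y → x * (u * y) ≡ (u * x) * y
  lem = solve-∀ ringℚ

*-cancelˡ : ∀ {z x y} → z ≢ 0ℚ → z * x ≡ z * y → x ≡ y
*-cancelˡ {z} {x} {y} z≢0 eq = begin
  x                ≡⟨ lem₁ x ⟩
  1ℚ * x           ≡⟨ cong (_* x) (sym (⁻¹-inverse z≢0)) ⟩
  (z * z ⁻¹) * x   ≡⟨ lem₂ z (z ⁻¹) x ⟩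
  z ⁻¹ * (z * x)   ≡⟨ cong (z ⁻¹ *_) eq ⟩
  z ⁻¹ * (z * y)   ≡⟨ sym (lem₂ z (z ⁻¹) y) ⟩
  (z * z ⁻¹) * y   ≡⟨ cong (_* y) (⁻¹-inverse z≢0) ⟩
  1ℚ * y           ≡⟨ sym (lem₁ y) ⟩
  y ∎
  where
  lem₁ : ∀ x → x ≡ 1ℚ * x
  lem₁ = solve-∀ ringℚ
  lem₂ : ∀ z w x → (z * w) * x ≡ w * (z * x)
  lem₂ = solve-∀ ringℚ

*-nonzero : ∀ {x y} → x ≢ 0ℚ → y ≢ 0ℚ → x * y ≢ 0ℚ
*-nonzero {x} {y} x≢0 y≢0 eq = y≢0 (*-cancelˡ x≢0 (trans eq (sym (ℚ.*-zeroʳ x))))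

-- Equations derived from hypotheses aᵢ ≡ bᵢ are proved by exhibiting the
-- difference of the two sides as a linear combination of the aᵢ - bᵢ.
linear₁ : ∀ {x y} c {a b} → a ≡ b → x - y ≡ c * (a - b) → x ≡ y
linear₁ c {a} refl eq = x-y≡0⇒x≡y (trans eq (lem c a))
  where
  lem : ∀ c a → c * (a - a) ≡ 0ℚ
  lem = solve-∀ ringℚ

linear₂ : ∀ {x y} c {a b} → a ≡ b → ∀ d {e f} → e ≡ f →
          x - y ≡ c * (a - b) + d * (e - f) → x ≡ y
linear₂ c {a} refl d {e} refl eq = x-y≡0⇒x≡y (trans eq (lem c a d e))
  where
  lem : ∀ c a d e → c * (a - a) + d * (e - e) ≡ 0ℚ
  lem = solve-∀ ringℚ

linear₃ : ∀ {x y} c {a b} → a ≡ b → ∀ d {e f} → e ≡ f → ∀ g {h k} → h ≡ k →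
          x - y ≡ c * (a - b) + d * (e - f) + g * (h - k) → x ≡ y
linear₃ c {a} refl d {e} refl g {h} refl eq = x-y≡0⇒x≡y (trans eq (lem c a d e g h))
  where
  lem : ∀ c a d e g h → c * (a - a) + d * (e - e) + g * (h - h) ≡ 0ℚ
  lem = solve-∀ ringℚ

sgn : ℕ → ℚ
sgn zero    = 1ℚ
sgn (suc n) = - sgn n

sgn-+ : ∀ m n → sgn (m ℕ.+ n) ≡ sgn m * sgn n
sgn-+ zero    n = sym (ℚ.*-identityˡ (sgn n))
sgn-+ (suc m) n = trans (cong -_ (sgn-+ m n)) (lem (sgn m) (sgn n))
  where
  lem : ∀ x y → - (x * y) ≡ - x * y
  lem = solve-∀ ringℚ

sgn² : ∀ n → sgn n * sgn n ≡ 1ℚ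
sgn² zero    = refl
sgn² (suc n) = trans (lem (sgn n)) (sgn² n)
  where
  lem : ∀ x → - x * - x ≡ x * x
  lem = solve-∀ ringℚ

sgn-double : ∀ n → sgn (n ℕ.+ n) ≡ 1ℚ
sgn-double n = trans (sgn-+ n n) (sgn² n)

-- Finite sums

Σ-cong : ∀ n {f g : ℕ → ℚ} → (∀ k → k ℕ.< n → f k ≡ g k) → Σ< n f ≡ Σ< n g
Σ-cong zero    eq = refl
Σ-cong (suc n) eq = cong₂ _+_ (Σ-cong n (λ k k<n → eq k (ℕ.m<n⇒m<1+n k<n))) (eq n (ℕ.n<1+n n))

Σ-ext : ∀ n {f g : ℕ → ℚ} → (∀ k → f k ≡ g k) → Σ< n f ≡ Σ< n g
Σ-ext n eq = Σ-cong n (λ k _ → eq k)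

Σ-+ : ∀ n (f g : ℕ → ℚ) → Σ< n (λ k → f k + g k) ≡ Σ< n f + Σ< n g
Σ-+ zero    f g = refl
Σ-+ (suc n) f g = trans (cong (_+ (f n + g n)) (Σ-+ n f g)) (lem (Σ< n f) (Σ< n g) (f n) (g n))
  where
  lem : ∀ a b c d → a + b + (c + d) ≡ a + c + (b + d)
  lem = solve-∀ ringℚ

Σ-* : ∀ n c (f : ℕ → ℚ) → Σ< n (λ k → c * f k) ≡ c * Σ< n f
Σ-* zero    c f = sym (ℚ.*-zeroʳ c)
Σ-* (suc n) c f = trans (cong (_+ c * f n) (Σ-* n c f)) (sym (ℚ.*-distribˡ-+ c (Σ< n f) (f n)))

Σ-linear : ∀ n c d (f g : ℕ → ℚ) → Σ< n (λ k → c * f k + d * g k) ≡ c * Σ< n f + d * Σ< n g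
Σ-linear n c d f g = trans (Σ-+ n (λ k → c * f k) (λ k → d * g k)) (cong₂ _+_ (Σ-* n c f) (Σ-* n d g))

Σ-0 : ∀ n → Σ< n (λ _ → 0ℚ) ≡ 0ℚ
Σ-0 zero    = refl
Σ-0 (suc n) = cong (_+ 0ℚ) (Σ-0 n)

Σ-shift : ∀ n (f : ℕ → ℚ) → Σ< (suc n) f ≡ f 0 + Σ< n (f ∘ suc)
Σ-shift zero    f = ℚ.+-comm 0ℚ (f 0)
Σ-shift (suc n) f = trans (cong (_+ f (suc n)) (Σ-shift n f)) (ℚ.+-assoc (f 0) (Σ< n (f ∘ suc)) (f (suc n)))

Σ-split : ∀ m n (f : ℕ → ℚ) → Σ< (m ℕ.+ n) f ≡ Σ< m f + Σ< n (λ k → f (m ℕ.+ k))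
Σ-split m zero    f = trans (cong (λ k → Σ< k f) (ℕ.+-identityʳ m)) (sym (ℚ.+-identityʳ _))
Σ-split m (suc n) f = begin
  Σ< (m ℕ.+ suc n) f                                   ≡⟨ cong (λ k → Σ< k f) (ℕ.+-suc m n) ⟩
  Σ< (m ℕ.+ n) f + f (m ℕ.+ n)                          ≡⟨ cong (_+ f (m ℕ.+ n)) (Σ-split m n f) ⟩
  Σ< m f + Σ< n (λ k → f (m ℕ.+ k)) + f (m ℕ.+ n)        ≡⟨ ℚ.+-assoc (Σ< m f) _ _ ⟩
  Σ< m f + (Σ< n (λ k → f (m ℕ.+ k)) + f (m ℕ.+ n)) ∎

Σ-reverse : ∀ n (f : ℕ → ℚ) → Σ< n f ≡ Σ< n (λ k → f (n ∸ suc k))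
Σ-reverse zero    f = refl
Σ-reverse (suc n) f = begin
  Σ< n f + f n                                  ≡⟨ ℚ.+-comm (Σ< n f) (f n) ⟩
  f n + Σ< n f                                  ≡⟨ cong (λ s → f n + s) (Σ-reverse n f) ⟩
  f n + Σ< n (λ k → f (n ∸ suc k))               ≡⟨ sym (Σ-shift n (λ k → f (n ∸ k))) ⟩
  Σ< (suc n) (λ k → f (n ∸ k)) ∎

Σ-parity : ∀ n (f : ℕ → ℚ) →
           Σ< (n ℕ.+ n) f ≡ Σ< n (λ r → f (r ℕ.+ r)) + Σ< n (λ r → f (suc (r ℕ.+ r)))
Σ-parity zero    f = refl
Σ-parity (suc n) f = begin
  Σ< (n ℕ.+ suc n) f + f (n ℕ.+ suc n)
    ≡⟨ cong₂ _+_ (cong (λ k → Σ< k f) (ℕ.+-suc n n)) (cong f (ℕ.+-suc n n)) ⟩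
  Σ< (n ℕ.+ n) f + f (n ℕ.+ n) + f (suc (n ℕ.+ n))
    ≡⟨ cong (λ s → s + f (n ℕ.+ n) + f (suc (n ℕ.+ n))) (Σ-parity n f) ⟩
  e + o + f (n ℕ.+ n) + f (suc (n ℕ.+ n))
    ≡⟨ lem e o (f (n ℕ.+ n)) (f (suc (n ℕ.+ n))) ⟩
  (e + f (n ℕ.+ n)) + (o + f (suc (n ℕ.+ n))) ∎
  where
  e = Σ< n (λ r → f (r ℕ.+ r))
  o = Σ< n (λ r → f (suc (r ℕ.+ r)))
  lem : ∀ a b c d → a + b + c + d ≡ (a + c) + (b + d)
  lem = solve-∀ ringℚ

-- Binomial coefficients

choose : ℕ → ℕ → ℚ
choose n k = # (n C k)

choose-0 : ∀ n → choose n 0 ≡ 1ℚ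
choose-0 n = cong #_ (trans (nCk≡nC[n∸k] {n = n} z≤n) (nCn≡1 n))

choose-n : ∀ n → choose n n ≡ 1ℚ
choose-n n = cong #_ (nCn≡1 n)

choose->n : ∀ {n k} → n ℕ.< k → choose n k ≡ 0ℚ
choose->n n<k = cong #_ (k>n⇒nCk≡0 n<k)

choose-suc : ∀ n k → choose (suc n) (suc k) ≡ choose n k + choose n (suc k)
choose-suc n k = trans (cong #_ (sym (nCk+nC[k+1]≡[n+1]C[k+1] n k))) (#-+ (n C k) (n C suc k))

choose-step : ∀ n k → (1ℚ + # k) * choose n (suc k) ≡ (# n - # k) * choose n k
choose-step zero zero = refl
choose-step zero (suc k) = begin
  (1ℚ + # (suc k)) * 0ℚ      ≡⟨ ℚ.*-zeroʳ (1ℚ + # (suc k)) ⟩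
  0ℚ                         ≡⟨ sym (ℚ.*-zeroʳ (# 0 - # (suc k))) ⟩
  (# 0 - # (suc k)) * 0ℚ ∎
choose-step (suc n) zero = begin
  (1ℚ + # 0) * choose (suc n) 1               ≡⟨ cong ((1ℚ + # 0) *_) (choose-suc n 0) ⟩
  (1ℚ + # 0) * (choose n 0 + choose n 1)      ≡⟨ linear₂ 1ℚ (choose-step n 0) (1ℚ + # n) (choose-0 n) (lem (choose n 0) (choose n 1) (# n)) ⟩
  (1ℚ + # n - # 0) * 1ℚ                       ≡⟨ cong₂ (λ u v → (u - # 0) * v) (sym (#-suc n)) (sym (choose-0 (suc n))) ⟩
  (# (suc n) - # 0) * choose (suc n) 0 ∎
  where
  lem : ∀ a b v → (1ℚ + # 0) * (a + b) - (1ℚ + v - # 0) * 1ℚ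
                ≡ 1ℚ * ((1ℚ + # 0) * b - (v - # 0) * a) + (1ℚ + v) * (a - 1ℚ)
  lem = solve-∀ ringℚ
choose-step (suc n) (suc k) = begin
  (1ℚ + # (suc k)) * choose (suc n) (suc (suc k))
    ≡⟨ cong ((1ℚ + # (suc k)) *_) (choose-suc n (suc k)) ⟩
  (1ℚ + # (suc k)) * (b + c)
    ≡⟨ linear₃ 1ℚ (choose-step n (suc k)) 1ℚ (choose-step n k) (a + b) (#-suc k) (lem a b c (# n) (# k) (# (suc k))) ⟩
  (1ℚ + # n - # (suc k)) * (a + b)
    ≡⟨ cong₂ (λ u v → (u - # (suc k)) * v) (sym (#-suc n)) (sym (choose-suc n k)) ⟩
  (# (suc n) - # (suc k)) * choose (suc n) (suc k) ∎
  where
  a = choose n k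
  b = choose n (suc k)
  c = choose n (suc (suc k))
  lem : ∀ a b c v w u → (1ℚ + u) * (b + c) - (1ℚ + v - u) * (a + b)
      ≡ 1ℚ * ((1ℚ + u) * c - (v - u) * b) + 1ℚ * ((1ℚ + w) * b - (v - w) * a) + (a + b) * (u - (1ℚ + w))
  lem = solve-∀ ringℚ

-- Polynomial functions and finite differences

-- Degree at most d, in Horner form.
Poly : ℕ → (ℚ → ℚ) → Set
Poly zero    f = Σ ℚ λ c → ∀ x → f x ≡ c
Poly (suc d) f = Σ ℚ λ c → Σ (ℚ → ℚ) λ g → Poly d g × (∀ x → f x ≡ c + x * g x)

Poly-ext : ∀ d {f g} → (∀ x → f x ≡ g x) → Poly d g → Poly d f
Poly-ext zero    eq (c , h)         = c , λ x → trans (eq x) (h x)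
Poly-ext (suc d) eq (c , g , pg , h) = c , g , pg , λ x → trans (eq x) (h x)

Poly-+ : ∀ d {f g} → Poly d f → Poly d g → Poly d (λ x → f x + g x)
Poly-+ zero (c , hf) (c′ , hg) = c + c′ , λ x → cong₂ _+_ (hf x) (hg x)
Poly-+ (suc d) (c , f′ , pf , hf) (c′ , g′ , pg , hg) =
  c + c′ , _ , Poly-+ d pf pg , λ x → trans (cong₂ _+_ (hf x) (hg x)) (lem c c′ x (f′ x) (g′ x))
  where
  lem : ∀ c c′ x f g → c + x * f + (c′ + x * g) ≡ c + c′ + x * (f + g)
  lem = solve-∀ ringℚ

Poly-scale : ∀ d k {f} → Poly d f → Poly d (λ x → k * f x)
Poly-scale zero k (c , h) = k * c , λ x → cong (k *_) (h x)
Poly-scale (suc d) k (c , g , pg , h) =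
  k * c , _ , Poly-scale d k pg , λ x → trans (cong (k *_) (h x)) (lem k c x (g x))
  where
  lem : ∀ k c x g → k * (c + x * g) ≡ k * c + x * (k * g)
  lem = solve-∀ ringℚ

Poly-x* : ∀ d {f} → Poly d f → Poly (suc d) (λ x → x * f x)
Poly-x* d {f} pf = 0ℚ , f , pf , λ x → sym (ℚ.+-identityˡ (x * f x))

Poly-suc : ∀ d {f} → Poly d f → Poly (suc d) f
Poly-suc zero (c , h) = c , (λ _ → 0ℚ) , (0ℚ , λ _ → refl) , λ x → trans (h x) (lem c x)
  where
  lem : ∀ c x → c ≡ c + x * 0ℚ
  lem = solve-∀ ringℚ
Poly-suc (suc d) (c , g , pg , h) = c , g , Poly-suc d pg , h

Poly-linear* : ∀ d u v {f} → Poly d f → Poly (suc d) (λ x → (u + v * x) * f x)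
Poly-linear* d u v {f} pf =
  Poly-ext (suc d) (λ x → lem u v x (f x))
    (Poly-+ (suc d) (Poly-suc d (Poly-scale d u pf)) (Poly-scale (suc d) v (Poly-x* d pf)))
  where
  lem : ∀ u v x f → (u + v * x) * f ≡ u * f + v * (x * f)
  lem = solve-∀ ringℚ

Poly-affine : ∀ d u v {f} → Poly d f → Poly d (λ x → f (u + v * x))
Poly-affine zero u v (c , h) = c , λ x → h (u + v * x)
Poly-affine (suc d) u v {f} (c , g , pg , h) =
  Poly-ext (suc d) (λ x → h (u + v * x))
    (Poly-+ (suc d) (Poly-const (suc d)) (Poly-linear* d u v (Poly-affine d u v pg)))
  where
  Poly-const : ∀ e → Poly e (λ _ → c)
  Poly-const zero = c , λ _ → refl
  Poly-const (suc e) = Poly-suc e (Poly-const e)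

Poly-square : ∀ d {f} → Poly d f → Poly (d ℕ.+ d) (λ x → f (x * x))
Poly-square zero (c , h) = c , λ x → h (x * x)
Poly-square (suc d) {f} (c , g , pg , h) =
  subst (λ e → Poly (suc e) (λ x → f (x * x))) (sym (ℕ.+-suc d d))
    (c , (λ x → x * g (x * x)) , Poly-x* (d ℕ.+ d) (Poly-square d pg) ,
     λ x → trans (h (x * x)) (lem c x (g (x * x))))
  where
  lem : ∀ c x g → c + x * x * g ≡ c + x * (x * g)
  lem = solve-∀ ringℚ

-- The Horner constant is the value at 0. This isolates the wanted value of `deformed` in the
-- interpolation.
Poly-at-0 : ∀ d {f} → Poly (suc d) f → Σ (ℚ → ℚ) λ g → Poly d g × (∀ x → f x ≡ f 0ℚ + x * g x)
Poly-at-0 d {f} (c , g , pg , h) =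
  g , pg , λ x → trans (h x) (cong (_+ x * g x) (trans (lem c (g 0ℚ)) (sym (h 0ℚ))))
  where
  lem : ∀ c y → c ≡ c + 0ℚ * y
  lem = solve-∀ ringℚ

-- With Δ the forward difference, Δ(x g) = x Δg + g(1 + x), and Δg has lower degree than g by
-- induction.
Poly-difference : ∀ d {f} → Poly (suc d) f → Poly d (λ x → f (1ℚ + x) - f x)
Poly-difference zero {f} (c , g , (c′ , hg) , h) = c′ , λ x → begin
  f (1ℚ + x) - f x                                       ≡⟨ cong₂ _-_ (h (1ℚ + x)) (h x) ⟩
  c + (1ℚ + x) * g (1ℚ + x) - (c + x * g x)              ≡⟨ cong₂ (λ u v → c + (1ℚ + x) * u - (c + x * v)) (hg (1ℚ + x)) (hg x) ⟩
  c + (1ℚ + x) * c′ - (c + x * c′)                       ≡⟨ lem c x c′ ⟩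
  c′ ∎
  where
  lem : ∀ c x c′ → c + (1ℚ + x) * c′ - (c + x * c′) ≡ c′
  lem = solve-∀ ringℚ
Poly-difference (suc d) {f} (c , g , pg , h) =
  Poly-ext (suc d) (λ x → trans (cong₂ _-_ (h (1ℚ + x)) (h x)) (lem c x (g (1ℚ + x)) (g x)))
    (Poly-+ (suc d) (Poly-x* d (Poly-difference d pg))
      (Poly-ext (suc d) (λ x → cong (λ u → g (1ℚ + u)) (sym (ℚ.*-identityˡ x))) (Poly-affine (suc d) 1ℚ 1ℚ pg)))
  where
  lem : ∀ c x u v → c + (1ℚ + x) * u - (c + x * v) ≡ x * (u - v) + u
  lem = solve-∀ ringℚ

-- Up to the sign (-1)^n, the n-th forward difference of `f` at 0.
alternating : ℕ → (ℚ → ℚ) → ℚ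
alternating n f = Σ< (suc n) (λ i → sgn i * choose n i * f (# i))

-- Pascal's rule: the operator is (1 - E)^n, with E the shift by 1, followed by evaluation at 0.
alternating-suc : ∀ n f → alternating (suc n) f ≡ alternating n f - alternating n (λ x → f (1ℚ + x))
alternating-suc n f = begin
  Σ< (suc (suc n)) (t (suc n))
    ≡⟨ Σ-shift (suc n) (t (suc n)) ⟩
  t (suc n) 0 + Σ< (suc n) (t (suc n) ∘ suc)
    ≡⟨ cong₂ _+_ (cong (λ c → 1ℚ * c * f (# 0)) (trans (choose-0 (suc n)) (sym (choose-0 n)))) (Σ-ext (suc n) pascal) ⟩
  t n 0 + Σ< (suc n) (λ i → t n (suc i) + - 1ℚ * t′ i)
    ≡⟨ cong (λ s → t n 0 + s) (trans (Σ-+ (suc n) (t n ∘ suc) (λ i → - 1ℚ * t′ i)) (cong (λ s → Σ< (suc n) (t n ∘ suc) + s) (Σ-* (suc n) (- 1ℚ) t′))) ⟩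
  t n 0 + (Σ< (suc n) (t n ∘ suc) + - 1ℚ * Σ< (suc n) t′)
    ≡⟨ lem (t n 0) (Σ< n (t n ∘ suc)) (t n (suc n)) (Σ< (suc n) t′) ⟩
  t n 0 + Σ< n (t n ∘ suc) + t n (suc n) - Σ< (suc n) t′
    ≡⟨ cong₂ (λ u v → u + v - Σ< (suc n) t′) (sym (Σ-shift n (t n))) last-zero ⟩
  Σ< (suc n) (t n) + 0ℚ - Σ< (suc n) t′
    ≡⟨ cong (_- Σ< (suc n) t′) (ℚ.+-identityʳ (Σ< (suc n) (t n))) ⟩
  Σ< (suc n) (t n) - Σ< (suc n) t′ ∎
  where
  t : ℕ → ℕ → ℚ
  t m i = sgn i * choose m i * f (# i)
  t′ : ℕ → ℚ
  t′ i = sgn i * choose n i * f (1ℚ + # i)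
  lem : ∀ a b c d → a + (b + c + - 1ℚ * d) ≡ a + b + c - d
  lem = solve-∀ ringℚ
  last-zero : t n (suc n) ≡ 0ℚ
  last-zero = trans (cong (λ c → sgn (suc n) * c * f (# (suc n))) (choose->n (ℕ.n<1+n n))) (lem₀ (sgn (suc n)) (f (# (suc n))))
    where
    lem₀ : ∀ a b → a * 0ℚ * b ≡ 0ℚ
    lem₀ = solve-∀ ringℚ
  pascal : ∀ i → t (suc n) (suc i) ≡ t n (suc i) + - 1ℚ * t′ i
  pascal i = begin
    - sgn i * choose (suc n) (suc i) * f (# (suc i))
      ≡⟨ cong (λ c → - sgn i * c * f (# (suc i))) (choose-suc n i) ⟩
    - sgn i * (choose n i + choose n (suc i)) * f (# (suc i))
      ≡⟨ lem₁ (sgn i) (choose n i) (choose n (suc i)) (f (# (suc i))) ⟩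
    t n (suc i) + - 1ℚ * (sgn i * choose n i * f (# (suc i)))
      ≡⟨ cong (λ u → t n (suc i) + - 1ℚ * (sgn i * choose n i * f u)) (#-suc i) ⟩
    t n (suc i) + - 1ℚ * t′ i ∎
    where
    lem₁ : ∀ s a b y → - s * (a + b) * y ≡ - s * b * y + - 1ℚ * (s * a * y)
    lem₁ = solve-∀ ringℚ

alternating-difference : ∀ n f → alternating (suc n) f ≡ - 1ℚ * alternating n (λ x → f (1ℚ + x) - f x)
alternating-difference n f = begin
  alternating (suc n) f
    ≡⟨ alternating-suc n f ⟩
  alternating n f - alternating n (λ x → f (1ℚ + x))
    ≡⟨ lem₁ (alternating n f) (alternating n (λ x → f (1ℚ + x))) ⟩
  - 1ℚ * (alternating n (λ x → f (1ℚ + x)) + - 1ℚ * alternating n f)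
    ≡⟨ cong (λ s → - 1ℚ * (alternating n (λ x → f (1ℚ + x)) + s)) (sym (Σ-* (suc n) (- 1ℚ) _)) ⟩
  - 1ℚ * (alternating n (λ x → f (1ℚ + x)) + Σ< (suc n) (λ i → - 1ℚ * (sgn i * choose n i * f (# i))))
    ≡⟨ cong (- 1ℚ *_) (sym (Σ-+ (suc n) _ _)) ⟩
  - 1ℚ * Σ< (suc n) (λ i → sgn i * choose n i * f (1ℚ + # i) + - 1ℚ * (sgn i * choose n i * f (# i)))
    ≡⟨ cong (- 1ℚ *_) (Σ-ext (suc n) (λ i → lem₂ (sgn i * choose n i) (f (1ℚ + # i)) (f (# i)))) ⟩
  - 1ℚ * alternating n (λ x → f (1ℚ + x) - f x) ∎
  where
  lem₁ : ∀ a b → a - b ≡ - 1ℚ * (b + - 1ℚ * a)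
  lem₁ = solve-∀ ringℚ
  lem₂ : ∀ c a b → c * a + - 1ℚ * (c * b) ≡ c * (a - b)
  lem₂ = solve-∀ ringℚ

alternating-vanishes : ∀ n d {f} → d ℕ.< n → Poly d f → alternating n f ≡ 0ℚ
alternating-vanishes (suc n) zero {f} _ (c , h) = begin
  alternating (suc n) f
    ≡⟨ alternating-suc n f ⟩
  alternating n f - alternating n (λ x → f (1ℚ + x))
    ≡⟨ x≡y⇒x-y≡0 (Σ-ext (suc n) (λ i → cong (sgn i * choose n i *_) (trans (h (# i)) (sym (h (1ℚ + # i)))))) ⟩
  0ℚ ∎
alternating-vanishes (suc n) (suc d) {f} (s≤s d<n) pf = begin
  alternating (suc n) f
    ≡⟨ alternating-difference n f ⟩
  - 1ℚ * alternating n (λ x → f (1ℚ + x) - f x)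
    ≡⟨ cong (- 1ℚ *_) (alternating-vanishes n d d<n (Poly-difference d pf)) ⟩
  0ℚ ∎

-- The deformed sum

-- For k = n + 1 and X = x² this is 2k(16k² - X): what k!, 4^k and (1+x/4)_k (1-x/4)_k gain at step
-- k, after the powers of 2 are cleared against the numerator.
factor : ℕ → ℚ → ℚ
factor n X = # 2 * (1ℚ + # n) * (# 16 * ((1ℚ + # n) * (1ℚ + # n)) - X)

numerator : ℕ → ℚ → ℚ
numerator zero    X = 1ℚ
numerator (suc n) X = (# 2 * # n + 1ℚ) * ((# 2 * # n + 1ℚ) * (# 2 * # n + 1ℚ) - X) * numerator n X

denominator : ℕ → ℚ → ℚ
denominator zero    X = 1ℚ
denominator (suc n) X = factor n X * denominator n X

-- deformed n X / denominator n X = Σ_{k ≤ n} (6k+1) numerator k X / denominator k X;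
-- X = 0 gives the sum of the theorem.
deformed : ℕ → ℚ → ℚ
deformed zero    X = 1ℚ
deformed (suc n) X = factor n X * deformed n X + (# 6 * # n + # 7) * numerator (suc n) X

Poly-numerator : ∀ n → Poly n (numerator n)
Poly-numerator zero    = 1ℚ , λ _ → refl
Poly-numerator (suc n) =
  Poly-ext (suc n) (λ X → lem (# n) X (numerator n X))
    (Poly-linear* n ((# 2 * # n + 1ℚ) * ((# 2 * # n + 1ℚ) * (# 2 * # n + 1ℚ))) (- (# 2 * # n + 1ℚ)) (Poly-numerator n))
  where
  lem : ∀ v X y → (# 2 * v + 1ℚ) * ((# 2 * v + 1ℚ) * (# 2 * v + 1ℚ) - X) * y
                ≡ ((# 2 * v + 1ℚ) * ((# 2 * v + 1ℚ) * (# 2 * v + 1ℚ)) + - (# 2 * v + 1ℚ) * X) * y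
  lem = solve-∀ ringℚ

Poly-deformed : ∀ n → Poly n (deformed n)
Poly-deformed zero    = 1ℚ , λ _ → refl
Poly-deformed (suc n) =
  Poly-+ (suc n)
    (Poly-ext (suc n) (λ X → lem (# n) X (deformed n X))
      (Poly-linear* n (# 32 * ((1ℚ + # n) * (1ℚ + # n) * (1ℚ + # n))) (- (# 2 * (1ℚ + # n))) (Poly-deformed n)))
    (Poly-scale (suc n) (# 6 * # n + # 7) (Poly-numerator (suc n)))
  where
  lem : ∀ v X y → # 2 * (1ℚ + v) * (# 16 * ((1ℚ + v) * (1ℚ + v)) - X) * y
                ≡ (# 32 * ((1ℚ + v) * (1ℚ + v) * (1ℚ + v)) + - (# 2 * (1ℚ + v)) * X) * y
  lem = solve-∀ ringℚ

-- The common part of numerator (suc n) at x² and at (x + 4)².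
shared : ℕ → ℚ → ℚ
shared zero    x = - 1ℚ
shared (suc n) x = (# 2 * # n + # 3) * (# 2 * # n - 1ℚ - x) * (# 2 * # n + # 3 + x) * shared n x

sq+4 : ℚ → ℚ
sq+4 x = (x + # 4) * (x + # 4)

-- Replacing x by x + 4 moves the factors 2j+1-x down two places and the factors 2j+1+x up two
-- places. At the low end (1+x)(3+x) is exchanged for (-1-x)(-3-x), which is the same product, so
-- only two factors at the top differ.
numerator-shared : ∀ n x → numerator (suc n) (x * x) ≡ shared n x * ((# 2 * # n - 1ℚ - x) * (# 2 * # n + 1ℚ - x))
numerator-shared zero x = lem x
  where
  lem : ∀ x → (# 2 * # 0 + 1ℚ) * ((# 2 * # 0 + 1ℚ) * (# 2 * # 0 + 1ℚ) - x * x) * 1ℚ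
            ≡ - 1ℚ * ((# 2 * # 0 - 1ℚ - x) * (# 2 * # 0 + 1ℚ - x))
  lem = solve-∀ ringℚ
numerator-shared (suc n) x = begin
  f (# (suc n)) * numerator (suc n) (x * x)
    ≡⟨ cong (f (# (suc n)) *_) (numerator-shared n x) ⟩
  f (# (suc n)) * (shared n x * ((# 2 * # n - 1ℚ - x) * (# 2 * # n + 1ℚ - x)))
    ≡⟨ cong (λ u → f u * (shared n x * ((# 2 * # n - 1ℚ - x) * (# 2 * # n + 1ℚ - x)))) (#-suc n) ⟩
  f (1ℚ + # n) * (shared n x * ((# 2 * # n - 1ℚ - x) * (# 2 * # n + 1ℚ - x)))
    ≡⟨ lem (# n) x (shared n x) ⟩
  shared (suc n) x * ((# 2 * (1ℚ + # n) - 1ℚ - x) * (# 2 * (1ℚ + # n) + 1ℚ - x))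
    ≡⟨ cong (λ u → shared (suc n) x * ((# 2 * u - 1ℚ - x) * (# 2 * u + 1ℚ - x))) (sym (#-suc n)) ⟩
  shared (suc n) x * ((# 2 * # (suc n) - 1ℚ - x) * (# 2 * # (suc n) + 1ℚ - x)) ∎
  where
  f : ℚ → ℚ
  f u = (# 2 * u + 1ℚ) * ((# 2 * u + 1ℚ) * (# 2 * u + 1ℚ) - x * x)
  lem : ∀ v x o → (# 2 * (1ℚ + v) + 1ℚ) * ((# 2 * (1ℚ + v) + 1ℚ) * (# 2 * (1ℚ + v) + 1ℚ) - x * x) * (o * ((# 2 * v - 1ℚ - x) * (# 2 * v + 1ℚ - x)))
    ≡ (# 2 * v + # 3) * (# 2 * v - 1ℚ - x) * (# 2 * v + # 3 + x) * o * ((# 2 * (1ℚ + v) - 1ℚ - x) * (# 2 * (1ℚ + v) + 1ℚ - x))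
  lem = solve-∀ ringℚ

numerator-shared+4 : ∀ n x → numerator (suc n) (sq+4 x) ≡ shared n x * ((# 2 * # n + # 3 + x) * (# 2 * # n + # 5 + x))
numerator-shared+4 zero x = lem x
  where
  lem : ∀ x → (# 2 * # 0 + 1ℚ) * ((# 2 * # 0 + 1ℚ) * (# 2 * # 0 + 1ℚ) - (x + # 4) * (x + # 4)) * 1ℚ
            ≡ - 1ℚ * ((# 2 * # 0 + # 3 + x) * (# 2 * # 0 + # 5 + x))
  lem = solve-∀ ringℚ
numerator-shared+4 (suc n) x = begin
  f (# (suc n)) * numerator (suc n) (sq+4 x)
    ≡⟨ cong (f (# (suc n)) *_) (numerator-shared+4 n x) ⟩
  f (# (suc n)) * (shared n x * ((# 2 * # n + # 3 + x) * (# 2 * # n + # 5 + x)))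
    ≡⟨ cong (λ u → f u * (shared n x * ((# 2 * # n + # 3 + x) * (# 2 * # n + # 5 + x)))) (#-suc n) ⟩
  f (1ℚ + # n) * (shared n x * ((# 2 * # n + # 3 + x) * (# 2 * # n + # 5 + x)))
    ≡⟨ lem (# n) x (shared n x) ⟩
  shared (suc n) x * ((# 2 * (1ℚ + # n) + # 3 + x) * (# 2 * (1ℚ + # n) + # 5 + x))
    ≡⟨ cong (λ u → shared (suc n) x * ((# 2 * u + # 3 + x) * (# 2 * u + # 5 + x))) (sym (#-suc n)) ⟩
  shared (suc n) x * ((# 2 * # (suc n) + # 3 + x) * (# 2 * # (suc n) + # 5 + x)) ∎
  where
  f : ℚ → ℚ
  f u = (# 2 * u + 1ℚ) * ((# 2 * u + 1ℚ) * (# 2 * u + 1ℚ) - sq+4 x)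
  lem : ∀ v x o → (# 2 * (1ℚ + v) + 1ℚ) * ((# 2 * (1ℚ + v) + 1ℚ) * (# 2 * (1ℚ + v) + 1ℚ) - (x + # 4) * (x + # 4)) * (o * ((# 2 * v + # 3 + x) * (# 2 * v + # 5 + x)))
    ≡ (# 2 * v + # 3) * (# 2 * v - 1ℚ - x) * (# 2 * v + # 3 + x) * o * ((# 2 * (1ℚ + v) + # 3 + x) * (# 2 * (1ℚ + v) + # 5 + x))
  lem = solve-∀ ringℚ

-- The WZ certificate for the shift of the parameter by 4.
deformed-step : ∀ n x → (# 4 * # n - x) * deformed n (sq+4 x) + (# 4 * # n + # 4 + x) * deformed n (x * x)
                      ≡ - (# 8 * # n + # 4) * shared n x
deformed-step zero x = lem x
  where
  lem : ∀ x → (# 4 * # 0 - x) * 1ℚ + (# 4 * # 0 + # 4 + x) * 1ℚ ≡ - (# 8 * # 0 + # 4) * - 1ℚ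
  lem = solve-∀ ringℚ
deformed-step (suc n) x = subst goal (sym (#-suc n))
  -- The multiplier is what completes both products with `factor`: 16(n+1)² - x² = (4n+4-x)(4n+4+x)
  -- and 16(n+1)² - (x+4)² = (4n-x)(4n+8+x).
  (linear₃ (# 2 * (1ℚ + # n) * (# 4 * # n + # 4 - x) * (# 4 * # n + # 8 + x)) (deformed-step n x)
           ((# 4 * # n + # 4 - x) * (# 6 * # n + # 7)) (numerator-shared+4 n x)
           ((# 4 * # n + # 8 + x) * (# 6 * # n + # 7)) (numerator-shared n x)
    (lem (# n) x (deformed n (sq+4 x)) (deformed n (x * x)) (numerator (suc n) (sq+4 x)) (numerator (suc n) (x * x)) (shared n x)))
  where
  goal : ℚ → Set
  goal u = (# 4 * u - x) * deformed (suc n) (sq+4 x) + (# 4 * u + # 4 + x) * deformed (suc n) (x * x)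
         ≡ - (# 8 * u + # 4) * shared (suc n) x
  lem : ∀ v x P₄ P a₄ a o →
      ((# 4 * (1ℚ + v) - x) * (# 2 * (1ℚ + v) * (# 16 * ((1ℚ + v) * (1ℚ + v)) - (x + # 4) * (x + # 4)) * P₄ + (# 6 * v + # 7) * a₄)
       + (# 4 * (1ℚ + v) + # 4 + x) * (# 2 * (1ℚ + v) * (# 16 * ((1ℚ + v) * (1ℚ + v)) - x * x) * P + (# 6 * v + # 7) * a))
      - - (# 8 * (1ℚ + v) + # 4) * ((# 2 * v + # 3) * (# 2 * v - 1ℚ - x) * (# 2 * v + # 3 + x) * o)
    ≡ # 2 * (1ℚ + v) * (# 4 * v + # 4 - x) * (# 4 * v + # 8 + x) * ((# 4 * v - x) * P₄ + (# 4 * v + # 4 + x) * P - - (# 8 * v + # 4) * o)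
      + (# 4 * v + # 4 - x) * (# 6 * v + # 7) * (a₄ - o * ((# 2 * v + # 3 + x) * (# 2 * v + # 5 + x)))
      + (# 4 * v + # 8 + x) * (# 6 * v + # 7) * (a - o * ((# 2 * v - 1ℚ - x) * (# 2 * v + 1ℚ - x)))
  lem = solve-∀ ringℚ

-- Says that x times `denominator` solves the homogeneous form of `deformed-step`. Hence wherever
-- `shared` vanishes, the ratio of `deformed` to x times `denominator` survives the shift by 4
-- unchanged.
denominator-step : ∀ n x → (# 4 * # n - x) * ((x + # 4) * denominator n (sq+4 x))
                         ≡ - (# 4 * # n + # 4 + x) * (x * denominator n (x * x))
denominator-step zero x = lem x
  where
  lem : ∀ x → (# 4 * # 0 - x) * ((x + # 4) * 1ℚ) ≡ - (# 4 * # 0 + # 4 + x) * (x * 1ℚ)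
  lem = solve-∀ ringℚ
denominator-step (suc n) x = subst goal (sym (#-suc n))
  (linear₁ (# 2 * (1ℚ + # n) * (# 4 * # n + # 4 - x) * (# 4 * # n + # 8 + x)) (denominator-step n x)
    (lem (# n) x (denominator n (sq+4 x)) (denominator n (x * x))))
  where
  goal : ℚ → Set
  goal u = (# 4 * u - x) * ((x + # 4) * denominator (suc n) (sq+4 x))
         ≡ - (# 4 * u + # 4 + x) * (x * denominator (suc n) (x * x))
  lem : ∀ v x D₄ D →
      (# 4 * (1ℚ + v) - x) * ((x + # 4) * (# 2 * (1ℚ + v) * (# 16 * ((1ℚ + v) * (1ℚ + v)) - (x + # 4) * (x + # 4)) * D₄))
      - - (# 4 * (1ℚ + v) + # 4 + x) * (x * (# 2 * (1ℚ + v) * (# 16 * ((1ℚ + v) * (1ℚ + v)) - x * x) * D))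
    ≡ # 2 * (1ℚ + v) * (# 4 * v + # 4 - x) * (# 4 * v + # 8 + x)
      * ((# 4 * v - x) * ((x + # 4) * D₄) - - (# 4 * v + # 4 + x) * (x * D))
  lem = solve-∀ ringℚ

odd : ℕ → ℚ
odd M = # 2 * # M + 1ℚ

odd-+2 : ∀ M → odd (suc (suc M)) ≡ odd M + # 4
odd-+2 M = linear₂ (# 2) (#-suc (suc M)) (# 2) (#-suc M) (lem (# M) (# (suc M)) (# (suc (suc M))))
  where
  lem : ∀ a b c → # 2 * c + 1ℚ - (# 2 * a + 1ℚ + # 4) ≡ # 2 * (c - (1ℚ + b)) + # 2 * (b - (1ℚ + a))
  lem = solve-∀ ringℚ

even≢odd : ∀ m n → # 2 * # m - odd n ≢ 0ℚ
even≢odd m n eq = ℕ.even≢odd m n (#-injective (begin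
  # (2 ℕ.* m)            ≡⟨ #-* 2 m ⟩
  # 2 * # m              ≡⟨ x-y≡0⇒x≡y eq ⟩
  # 2 * # n + 1ℚ         ≡⟨ cong (_+ 1ℚ) (sym (#-* 2 n)) ⟩
  # (2 ℕ.* n) + 1ℚ       ≡⟨ ℚ.+-comm (# (2 ℕ.* n)) 1ℚ ⟩
  1ℚ + # (2 ℕ.* n)       ≡⟨ sym (#-suc (2 ℕ.* n)) ⟩
  # (suc (2 ℕ.* n)) ∎))

numerator-1 : ∀ n → numerator (suc n) 1ℚ ≡ 0ℚ
numerator-1 zero    = refl
numerator-1 (suc n) = trans (cong (f *_) (numerator-1 n)) (ℚ.*-zeroʳ f)
  where
  f = (# 2 * # (suc n) + 1ℚ) * ((# 2 * # (suc n) + 1ℚ) * (# 2 * # (suc n) + 1ℚ) - 1ℚ)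

-- Every term after the first carries the factor 1 - X, so only the term k = 0 remains.
deformed-1 : ∀ n → deformed n 1ℚ ≡ denominator n 1ℚ
deformed-1 zero    = refl
deformed-1 (suc n) =
  linear₂ (factor n 1ℚ) (deformed-1 n) (# 6 * # n + # 7) (numerator-1 n)
    (lem (factor n 1ℚ) (deformed n 1ℚ) (denominator n 1ℚ) (# 6 * # n + # 7) (numerator (suc n) 1ℚ))
  where
  lem : ∀ f x y c a → f * x + c * a - f * y ≡ f * (x - y) + c * (a - 0ℚ)
  lem = solve-∀ ringℚ

-- The factor 2j - 1 - x vanishes at j = M + 1, and it is present from `shared (suc (suc M))` on.
shared-odd : ∀ M k → shared (k ℕ.+ suc (suc M)) (odd M) ≡ 0ℚ
shared-odd M zero = linear₁ c (#-suc M) (lem (# M) (# (suc M)) (shared (suc M) (odd M)))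
  where
  c = # 2 * ((# 2 * # (suc M) + # 3) * (# 2 * # (suc M) + # 3 + odd M) * shared (suc M) (odd M))
  lem : ∀ a b o → (# 2 * b + # 3) * (# 2 * b - 1ℚ - (# 2 * a + 1ℚ)) * (# 2 * b + # 3 + (# 2 * a + 1ℚ)) * o - 0ℚ
                ≡ # 2 * ((# 2 * b + # 3) * (# 2 * b + # 3 + (# 2 * a + 1ℚ)) * o) * (b - (1ℚ + a))
  lem = solve-∀ ringℚ
shared-odd M (suc k) = trans (cong (f *_) (shared-odd M k)) (ℚ.*-zeroʳ f)
  where
  v = # (k ℕ.+ suc (suc M))
  f = (# 2 * v + # 3) * (# 2 * v - 1ℚ - odd M) * (# 2 * v + # 3 + odd M)

shared-minus-1 : ∀ n → shared (suc n) (- 1ℚ) ≡ 0ℚ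
shared-minus-1 zero    = refl
shared-minus-1 (suc n) = trans (cong (f *_) (shared-minus-1 n)) (ℚ.*-zeroʳ f)
  where
  v = # (suc n)
  f = (# 2 * v + # 3) * (# 2 * v - 1ℚ - - 1ℚ) * (# 2 * v + # 3 + - 1ℚ)

deformed-+4 : ∀ n x s → # 4 * # n - x ≢ 0ℚ → shared n x ≡ 0ℚ →
              deformed n (x * x) ≡ s * (x * denominator n (x * x)) →
              deformed n (sq+4 x) ≡ s * ((x + # 4) * denominator n (sq+4 x))
deformed-+4 n x s nz shared≡0 eq = *-cancelˡ nz
  (linear₃ 1ℚ vanishing (- (# 4 * # n + # 4 + x)) eq (- s) (denominator-step n x)
    (lem₂ (# n) x s (deformed n (sq+4 x)) (deformed n (x * x)) (denominator n (sq+4 x)) (denominator n (x * x))))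
  where
  lem₁ : ∀ v → v * 0ℚ ≡ 0ℚ
  lem₁ = solve-∀ ringℚ
  vanishing : (# 4 * # n - x) * deformed n (sq+4 x) + (# 4 * # n + # 4 + x) * deformed n (x * x) ≡ 0ℚ
  vanishing = trans (deformed-step n x)
    (trans (cong (- (# 8 * # n + # 4) *_) shared≡0) (lem₁ (- (# 8 * # n + # 4))))
  lem₂ : ∀ v x s P₄ P D₄ D →
      (# 4 * v - x) * P₄ - (# 4 * v - x) * (s * ((x + # 4) * D₄))
    ≡ 1ℚ * ((# 4 * v - x) * P₄ + (# 4 * v + # 4 + x) * P - 0ℚ)
      + - (# 4 * v + # 4 + x) * (P - s * (x * D))
      + - s * ((# 4 * v - x) * ((x + # 4) * D₄) - - (# 4 * v + # 4 + x) * (x * D))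
  lem₂ = solve-∀ ringℚ

-- Two chains of shifts by 4: 1, 5, 9, ... starts at x = 1 and 3, 7, 11, ... at x = -1. Both start
-- from X = 1; writing that value as s x `denominator` forces s = -1 on the second chain, and s is
-- constant along a chain. This is the sign (-1)^M.
deformed-odd : ∀ M n → M ℕ.≤ n →
               deformed n (odd M * odd M) ≡ sgn M * (odd M * denominator n (odd M * odd M))
deformed-odd zero n _ = trans (deformed-1 n) (lem (denominator n 1ℚ))
  where
  lem : ∀ d → d ≡ 1ℚ * (1ℚ * d)
  lem = solve-∀ ringℚ
deformed-odd (suc zero) (suc n) _ =
  deformed-+4 (suc n) (- 1ℚ) (- 1ℚ) nz (shared-minus-1 n) (trans (deformed-1 (suc n)) (lem (denominator (suc n) 1ℚ)))
  where
  lem : ∀ d → d ≡ - 1ℚ * (- 1ℚ * d)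
  lem = solve-∀ ringℚ
  lem′ : ∀ v → # 4 * v - - 1ℚ ≡ 1ℚ + # 4 * v
  lem′ = solve-∀ ringℚ
  nz : # 4 * # (suc n) - - 1ℚ ≢ 0ℚ
  nz eq = #suc≢0 (4 ℕ.* suc n) (begin
    # (suc (4 ℕ.* suc n))      ≡⟨ #-suc (4 ℕ.* suc n) ⟩
    1ℚ + # (4 ℕ.* suc n)       ≡⟨ cong (λ u → 1ℚ + u) (#-* 4 (suc n)) ⟩
    1ℚ + # 4 * # (suc n)       ≡⟨ sym (lem′ (# (suc n))) ⟩
    # 4 * # (suc n) - - 1ℚ     ≡⟨ eq ⟩
    0ℚ ∎)
deformed-odd (suc (suc M)) n M+2≤n =
  subst (λ x → deformed n (x * x) ≡ sgn (suc (suc M)) * (x * denominator n (x * x))) (sym (odd-+2 M))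
    (trans (deformed-+4 n (odd M) (sgn M) nz zero-shared (deformed-odd M n (ℕ.≤-trans (ℕ.m≤n+m M 2) M+2≤n)))
      (lem (sgn M) ((odd M + # 4) * denominator n (sq+4 (odd M)))))
  where
  lem : ∀ s y → s * y ≡ - - s * y
  lem = solve-∀ ringℚ
  lem′ : ∀ v → # 2 * (# 2 * v) ≡ # 4 * v
  lem′ = solve-∀ ringℚ
  nz : # 4 * # n - odd M ≢ 0ℚ
  nz eq = even≢odd (2 ℕ.* n) M (trans (cong (_- odd M) (trans (cong (# 2 *_) (#-* 2 n)) (lem′ (# n)))) eq)
  zero-shared : shared n (odd M) ≡ 0ℚ
  zero-shared = subst (λ m → shared m (odd M) ≡ 0ℚ) (ℕ.m∸n+n≡m M+2≤n) (shared-odd M (n ∸ suc (suc M)))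

-- Interpolation at the odd integers

module _ (N : ℕ) where
  private
    p = suc (N ℕ.+ N)

  node : ℕ → ℚ
  node i = # p - # 2 * # i

  #p : # p ≡ odd N
  #p = trans (#-suc (N ℕ.+ N)) (trans (cong (λ u → 1ℚ + u) (#-double N)) (ℚ.+-comm 1ℚ (# 2 * # N)))

  node≢0 : ∀ i → node i ≢ 0ℚ
  node≢0 i eq = even≢odd i N (begin
    # 2 * # i - odd N        ≡⟨ cong (λ u → # 2 * # i - u) (sym #p) ⟩
    # 2 * # i - # p          ≡⟨ lem (# i) (# p) ⟩
    - 1ℚ * (# p - # 2 * # i) ≡⟨ cong (- 1ℚ *_) eq ⟩
    0ℚ ∎)
    where
    lem : ∀ a b → # 2 * a - b ≡ - 1ℚ * (b - # 2 * a)
    lem = solve-∀ ringℚ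

  -- The nodes beyond the middle are the negatives of the earlier ones. Passing from x to -x changes
  -- the sign of the closed form, and (-1)^i absorbs it since i and p - i have opposite parity.
  deformed-node : ∀ i → i ℕ.≤ p →
                  deformed N (node i * node i) ≡ sgn N * sgn i * (node i * denominator N (node i * node i))
  deformed-node i i≤p with i ℕ.≤? N
  ... | yes i≤N = subst (λ x → deformed N (x * x) ≡ sgn N * sgn i * (x * denominator N (x * x))) (sym node≡)
                    (trans (deformed-odd M N (ℕ.m∸n≤m N i)) (cong (_* (odd M * denominator N (odd M * odd M))) sgnM))
    where
    M = N ∸ i
    M+i : M ℕ.+ i ≡ N
    M+i = ℕ.m∸n+n≡m i≤N
    #N : # N ≡ # M + # i
    #N = trans (cong #_ (sym M+i)) (#-+ M i)
    lem : ∀ π n m i → π - # 2 * i - (# 2 * m + 1ℚ) ≡ 1ℚ * (π - (# 2 * n + 1ℚ)) + # 2 * (n - (m + i))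
    lem = solve-∀ ringℚ
    node≡ : node i ≡ odd M
    node≡ = linear₂ 1ℚ #p (# 2) #N (lem (# p) (# N) (# M) (# i))
    sgnM : sgn M ≡ sgn N * sgn i
    sgnM = sym (begin
      sgn N * sgn i                ≡⟨ cong (λ m → sgn m * sgn i) (sym M+i) ⟩
      sgn (M ℕ.+ i) * sgn i        ≡⟨ cong (_* sgn i) (sgn-+ M i) ⟩
      sgn M * sgn i * sgn i        ≡⟨ ℚ.*-assoc (sgn M) (sgn i) (sgn i) ⟩
      sgn M * (sgn i * sgn i)      ≡⟨ cong (sgn M *_) (sgn² i) ⟩
      sgn M * 1ℚ                   ≡⟨ ℚ.*-identityʳ (sgn M) ⟩
      sgn M ∎)
  ... | no i≰N = subst (λ x → deformed N (x * x) ≡ sgn N * sgn i * (x * denominator N (x * x))) (sym node≡)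
                   (subst (λ X → deformed N X ≡ sgn N * sgn i * (- odd M * denominator N X)) (lem₁ (odd M))
                     (trans (deformed-odd M N M≤N)
                       (linear₁ (- (odd M * denominator N (odd M * odd M))) sgnM
                         (lem₂ (sgn N * sgn i) (sgn M) (odd M) (denominator N (odd M * odd M))))))
    where
    M = i ∸ suc N
    M+ : suc N ℕ.+ M ≡ i
    M+ = ℕ.m+[n∸m]≡n (ℕ.≰⇒> i≰N)
    M≤N : M ℕ.≤ N
    M≤N = ℕ.≤-trans (ℕ.∸-monoˡ-≤ (suc N) i≤p) (ℕ.≤-reflexive (ℕ.m+n∸m≡n N N))
    lem₁ : ∀ x → x * x ≡ - x * - x
    lem₁ = solve-∀ ringℚ
    lem₂ : ∀ s t x d → t * (x * d) - s * (- x * d) ≡ - (x * d) * (- t - s)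
    lem₂ = solve-∀ ringℚ
    #i : # i ≡ 1ℚ + # N + # M
    #i = trans (cong #_ (sym M+)) (trans (#-+ (suc N) M) (cong (_+ # M) (#-suc N)))
    lem : ∀ π n m i → π - # 2 * i - - (# 2 * m + 1ℚ) ≡ 1ℚ * (π - (# 2 * n + 1ℚ)) + - # 2 * (i - (1ℚ + n + m))
    lem = solve-∀ ringℚ
    node≡ : node i ≡ - odd M
    node≡ = linear₂ 1ℚ #p (- # 2) #i (lem (# p) (# N) (# M) (# i))
    lem₃ : ∀ s t → s * (- (s * t)) ≡ - t * (s * s)
    lem₃ = solve-∀ ringℚ
    sgnM : - sgn M ≡ sgn N * sgn i
    sgnM = sym (begin
      sgn N * sgn i                  ≡⟨ cong (λ m → sgn N * sgn m) (sym M+) ⟩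
      sgn N * - sgn (N ℕ.+ M)        ≡⟨ cong (λ s → sgn N * - s) (sgn-+ N M) ⟩
      sgn N * - (sgn N * sgn M)      ≡⟨ lem₃ (sgn N) (sgn M) ⟩
      - sgn M * (sgn N * sgn N)      ≡⟨ cong (- sgn M *_) (sgn² N) ⟩
      - sgn M * 1ℚ                   ≡⟨ ℚ.*-identityʳ (- sgn M) ⟩
      - sgn M ∎)

  nodeWeight : ℚ
  nodeWeight = Σ< (suc p) (λ i → sgn i * choose p i * node i ⁻¹)

  nodeSum : ℚ
  nodeSum = Σ< (suc p) (λ i → choose p i * denominator N (node i * node i))

-- Writing deformed N X = deformed N 0 + X g(X), the p-th difference of
-- x g(x²) vanishes because its degree is p - 2.
interpolation : ∀ n → let N = suc n in deformed N 0ℚ * nodeWeight N ≡ sgn N * nodeSum N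
interpolation n = begin
  deformed N 0ℚ * nodeWeight N
    ≡⟨ sym (Σ-* (suc p) (deformed N 0ℚ) _) ⟩
  Σ< (suc p) (λ i → deformed N 0ℚ * (sgn i * choose p i * node N i ⁻¹))
    -- Adding the vanishing difference completes each quotient of `deformed N 0ℚ` by the node x to
    -- the quotient of `deformed N (x * x)` by x, where the closed form applies.
    ≡⟨ sym (trans (cong (λ s → W + s) vanishing) (ℚ.+-identityʳ W)) ⟩
  Σ< (suc p) (λ i → deformed N 0ℚ * (sgn i * choose p i * node N i ⁻¹)) + alternating p h
    ≡⟨ sym (Σ-+ (suc p) _ _) ⟩
  Σ< (suc p) (λ i → deformed N 0ℚ * (sgn i * choose p i * node N i ⁻¹) + sgn i * choose p i * h (# i))
    ≡⟨ Σ-cong (suc p) (λ i i<1+p → term i (ℕ.≤-pred i<1+p)) ⟩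
  Σ< (suc p) (λ i → sgn N * (choose p i * denominator N (node N i * node N i)))
    ≡⟨ Σ-* (suc p) (sgn N) _ ⟩
  sgn N * nodeSum N ∎
  where
  N = suc n
  p = suc (N ℕ.+ N)
  W = Σ< (suc p) (λ i → deformed N 0ℚ * (sgn i * choose p i * node N i ⁻¹))
  decomposition = Poly-at-0 n (Poly-deformed N)
  g = proj₁ decomposition
  h : ℚ → ℚ
  h t = (# p + - # 2 * t) * g ((# p + - # 2 * t) * (# p + - # 2 * t))
  vanishing : alternating p h ≡ 0ℚ
  vanishing = alternating-vanishes p (suc (n ℕ.+ n))
    (s≤s (s≤s (ℕ.+-monoʳ-≤ n (ℕ.n≤1+n n))))
    (Poly-affine (suc (n ℕ.+ n)) (# p) (- # 2) (Poly-x* (n ℕ.+ n) (Poly-square n (proj₁ (proj₂ decomposition)))))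
  term : ∀ i → i ℕ.≤ p → deformed N 0ℚ * (sgn i * choose p i * node N i ⁻¹) + sgn i * choose p i * h (# i)
       ≡ sgn N * (choose p i * denominator N (node N i * node N i))
  term i i≤p = begin
    P₀ * (s * c * y) + s * c * h (# i)
      ≡⟨ cong (λ x′ → P₀ * (s * c * y) + s * c * (x′ * g (x′ * x′))) (lem₁ (# p) (# i)) ⟩
    P₀ * (s * c * y) + s * c * (x * g (x * x))
      ≡⟨ linear₂ (- (s * c * (x * g (x * x)))) xy (- (s * c * y)) (proj₂ (proj₂ decomposition) (x * x))
           (lem₂ P₀ s c y x (g (x * x)) (deformed N (x * x))) ⟩
    s * c * y * deformed N (x * x)
      ≡⟨ cong (s * c * y *_) (deformed-node N i i≤p) ⟩
    s * c * y * (sgn N * s * (x * D))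
      ≡⟨ linear₂ (sgn N * c * D * (s * s)) xy (sgn N * c * D) (sgn² i) (lem₃ s c y (sgn N) x D) ⟩
    sgn N * (c * D) ∎
    where
    P₀ = deformed N 0ℚ
    s = sgn i
    c = choose p i
    x = node N i
    y = x ⁻¹
    D = denominator N (x * x)
    xy : x * y ≡ 1ℚ
    xy = ⁻¹-inverse (node≢0 N i)
    lem₁ : ∀ a b → a + - # 2 * b ≡ a - # 2 * b
    lem₁ = solve-∀ ringℚ
    lem₂ : ∀ P₀ s c y x G P → P₀ * (s * c * y) + s * c * (x * G) - s * c * y * P
         ≡ - (s * c * (x * G)) * (x * y - 1ℚ) + - (s * c * y) * (P - (P₀ + x * x * G))
    lem₂ = solve-∀ ringℚ
    lem₃ : ∀ s c y t x D → s * c * y * (t * s * (x * D)) - t * (c * D)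
         ≡ t * c * D * (s * s) * (x * y - 1ℚ) + t * c * D * (s * s - 1ℚ)
    lem₃ = solve-∀ ringℚ

-- The value at 0

#-reciprocal : ∀ d .{{_ : ℕ.NonZero d}} → # d * (+ 1 / d) ≡ 1ℚ
#-reciprocal (suc k) = trans (cong₂ _*_ (ι-mkℚ (+ suc k)) (ℚ.normalize-coprime (Coprime.1-coprimeTo (suc k))))
  (ℚ.*-inverseʳ (mkℚ (+ suc k) 0 (Coprime.sym (Coprime.1-coprimeTo (suc k)))))

invPow-inverse : ∀ k m → # (suc k ℕ.^ m) * invPow (suc k) m ≡ 1ℚ
invPow-inverse k m = #-reciprocal (suc k ℕ.^ m) {{ℕ.m^n≢0 (suc k) m}}

central : ℕ → ℚ
central n = choose (2 ℕ.* n) n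

central-suc : ∀ n → (1ℚ + # n) * central (suc n) ≡ # 2 * (# 2 * # n + 1ℚ) * central n
central-suc n = begin
  (1ℚ + # n) * central (suc n)
    ≡⟨ cong (λ m → (1ℚ + # n) * choose m (suc n)) (ℕ.*-suc 2 n) ⟩
  (1ℚ + # n) * d
    ≡⟨ linear₃ (1ℚ + # n) (choose-suc (suc (2 ℕ.* n)) n) (- 1ℚ) (choose-step (suc (2 ℕ.* n)) n)
               (- a) (trans (#-suc (2 ℕ.* n)) (cong (λ u → 1ℚ + u) (#-* 2 n)))
         (lem₁ (# n) a b d (# (suc (2 ℕ.* n)))) ⟩
  # 2 * (1ℚ + # n) * b
    ≡⟨ linear₃ (# 2 * (1ℚ + # n)) (choose-suc (2 ℕ.* n) n) (# 2) (choose-step (2 ℕ.* n) n)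
               (# 2 * central n) (#-* 2 n)
         (lem₂ (# n) b (central n) (choose (2 ℕ.* n) (suc n)) (# (2 ℕ.* n))) ⟩
  # 2 * (# 2 * # n + 1ℚ) * central n ∎
  where
  a = choose (suc (2 ℕ.* n)) n
  b = choose (suc (2 ℕ.* n)) (suc n)
  d = choose (suc (suc (2 ℕ.* n))) (suc n)
  lem₁ : ∀ v a b d w → (1ℚ + v) * d - # 2 * (1ℚ + v) * b
       ≡ (1ℚ + v) * (d - (a + b)) + - 1ℚ * ((1ℚ + v) * b - (w - v) * a) + - a * (w - (1ℚ + # 2 * v))
  lem₁ = solve-∀ ringℚ
  lem₂ : ∀ v b c f u → # 2 * (1ℚ + v) * b - # 2 * (# 2 * v + 1ℚ) * c
       ≡ # 2 * (1ℚ + v) * (b - (c + f)) + # 2 * ((1ℚ + v) * f - (u - v) * c) + # 2 * c * (u - # 2 * v)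
  lem₂ = solve-∀ ringℚ

central³ : ℕ → ℚ
central³ n = ℕtoℚ (((2 ℕ.* n) C n) ℕ.^ 3) * invPow 256 n

central³-suc : ∀ n → let u = 1ℚ + # n ; w = # 2 * # n + 1ℚ in
               # 32 * (u * u * u) * central³ (suc n) ≡ w * w * w * central³ n
central³-suc n = begin
  # 32 * (u * u * u) * (# (c′ ℕ.^ 3) * e′)
    ≡⟨ cong (λ x → # 32 * (u * u * u) * (x * e′)) (#-cube c′) ⟩
  # 32 * (u * u * u) * (# c′ * # c′ * # c′ * e′)
    ≡⟨ lem₁ u (# c′) e′ ⟩
  # 32 * ((u * # c′) * (u * # c′) * (u * # c′)) * e′
    ≡⟨ cong (λ x → # 32 * (x * x * x) * e′) (central-suc n) ⟩
  # 32 * ((# 2 * w * # c) * (# 2 * w * # c) * (# 2 * w * # c)) * e′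
    ≡⟨ lem₂ w (# c) e′ ⟩
  w * w * w * (# c * # c * # c * (# 256 * e′))
    ≡⟨ cong₂ (λ x y → w * w * w * (x * y)) (sym (#-cube c)) e′-e ⟩
  w * w * w * (# (c ℕ.^ 3) * e) ∎
  where
  u = 1ℚ + # n
  w = # 2 * # n + 1ℚ
  c = (2 ℕ.* n) C n
  c′ = (2 ℕ.* suc n) C suc n
  e = invPow 256 n
  e′ = invPow 256 (suc n)
  #-cube : ∀ m → # (m ℕ.^ 3) ≡ # m * # m * # m
  #-cube m = begin
    # (m ℕ.* (m ℕ.* (m ℕ.* 1)))      ≡⟨ cong (λ k → # (m ℕ.* (m ℕ.* k))) (ℕ.*-identityʳ m) ⟩
    # (m ℕ.* (m ℕ.* m))              ≡⟨ #-* m (m ℕ.* m) ⟩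
    # m * # (m ℕ.* m)                ≡⟨ cong (# m *_) (#-* m m) ⟩
    # m * (# m * # m)                ≡⟨ sym (ℚ.*-assoc (# m) (# m) (# m)) ⟩
    # m * # m * # m ∎
  e′-e : # 256 * e′ ≡ e
  e′-e = inverse-unique {u = # (256 ℕ.^ n)}
    (trans (lem₃ (# (256 ℕ.^ n)) e′)
      (trans (cong (_* e′) (sym (#-* 256 (256 ℕ.^ n)))) (invPow-inverse 255 (suc n))))
    (invPow-inverse 255 n)
    where
    lem₃ : ∀ q e → q * (# 256 * e) ≡ # 256 * q * e
    lem₃ = solve-∀ ringℚ
  lem₁ : ∀ u c e → # 32 * (u * u * u) * (c * c * c * e) ≡ # 32 * ((u * c) * (u * c) * (u * c)) * e
  lem₁ = solve-∀ ringℚ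
  lem₂ : ∀ w c e → # 32 * ((# 2 * w * c) * (# 2 * w * c) * (# 2 * w * c)) * e ≡ w * w * w * (c * c * c * (# 256 * e))
  lem₂ = solve-∀ ringℚ

numerator-0 : ∀ n → numerator n 0ℚ ≡ denominator n 0ℚ * central³ n
numerator-0 zero    = refl
numerator-0 (suc n) = linear₂ (w * w * w) (numerator-0 n) (- denominator n 0ℚ) (central³-suc n)
  (lem (# n) (numerator n 0ℚ) (denominator n 0ℚ) (central³ n) (central³ (suc n)))
  where
  w = # 2 * # n + 1ℚ
  lem : ∀ v a d t t′ →
      (# 2 * v + 1ℚ) * ((# 2 * v + 1ℚ) * (# 2 * v + 1ℚ) - 0ℚ) * a
      - # 2 * (1ℚ + v) * (# 16 * ((1ℚ + v) * (1ℚ + v)) - 0ℚ) * d * t′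
    ≡ (# 2 * v + 1ℚ) * (# 2 * v + 1ℚ) * (# 2 * v + 1ℚ) * (a - d * t)
      + - d * (# 32 * ((1ℚ + v) * (1ℚ + v) * (1ℚ + v)) * t′ - (# 2 * v + 1ℚ) * (# 2 * v + 1ℚ) * (# 2 * v + 1ℚ) * t)
  lem = solve-∀ ringℚ

summand : ℕ → ℚ
summand n = (ℕtoℚ (6 ℕ.* n ℕ.+ 1) * ℕtoℚ (((2 ℕ.* n) C n) ℕ.^ 3)) * (invPow 256 n)

deformed-0 : ∀ n → deformed n 0ℚ ≡ denominator n 0ℚ * Σ< (suc n) summand
deformed-0 zero    = refl
deformed-0 (suc n) = begin
  factor n 0ℚ * deformed n 0ℚ + (# 6 * # n + # 7) * numerator (suc n) 0ℚ
    ≡⟨ cong₂ (λ x y → factor n 0ℚ * x + (# 6 * # n + # 7) * y) (deformed-0 n) (numerator-0 (suc n)) ⟩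
  factor n 0ℚ * (denominator n 0ℚ * S) + (# 6 * # n + # 7) * (D′ * central³ (suc n))
    ≡⟨ lem₁ (factor n 0ℚ) (denominator n 0ℚ) S (# 6 * # n + # 7) (central³ (suc n)) ⟩
  D′ * (S + (# 6 * # n + # 7) * central³ (suc n))
    ≡⟨ cong (λ x → D′ * (S + x)) (trans (cong (_* central³ (suc n)) (sym coefficient)) (sym (ℚ.*-assoc (# (6 ℕ.* suc n ℕ.+ 1)) (# (((2 ℕ.* suc n) C suc n) ℕ.^ 3)) (invPow 256 (suc n))))) ⟩
  D′ * (S + summand (suc n)) ∎
  where
  S = Σ< (suc n) summand
  D′ = denominator (suc n) 0ℚ
  lem₁ : ∀ f d s k t → f * (d * s) + k * (f * d * t) ≡ f * d * (s + k * t)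
  lem₁ = solve-∀ ringℚ
  lem₂ : ∀ v → # 6 * (1ℚ + v) + # 1 ≡ # 6 * v + # 7
  lem₂ = solve-∀ ringℚ
  coefficient : # (6 ℕ.* suc n ℕ.+ 1) ≡ # 6 * # n + # 7
  coefficient = trans (#-+ (6 ℕ.* suc n) 1)
    (trans (cong (_+ # 1) (trans (#-* 6 (suc n)) (cong (# 6 *_) (#-suc n)))) (lem₂ (# n)))

/-as-* : ∀ i d .{{_ : ℕ.NonZero d}} → i / d ≡ ι i * (+ 1 / d)
/-as-* i (suc k) = sym (trans
  (cong₂ _*_ (ι-mkℚ i) (ℚ.normalize-coprime (Coprime.1-coprimeTo (suc k))))
  (ℚ./-cong (ℤ.*-identityʳ i) (ℕ.*-identityˡ (suc k))))

*-↧ₙ : ∀ c → c * # (↧ₙ c) ≡ ι (↥ c)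
*-↧ₙ c = begin
  c * # D                          ≡⟨ cong (_* # D) (trans (sym (ℚ.↥p/↧p≡p c)) (/-as-* (↥ c) D)) ⟩
  ι (↥ c) * (+ 1 / D) * # D        ≡⟨ lem (ι (↥ c)) (+ 1 / D) (# D) ⟩
  ι (↥ c) * (# D * (+ 1 / D))      ≡⟨ cong (ι (↥ c) *_) (#-reciprocal D) ⟩
  ι (↥ c) * 1ℚ                     ≡⟨ ℚ.*-identityʳ (ι (↥ c)) ⟩
  ι (↥ c) ∎
  where
  D = ↧ₙ c
  lem : ∀ a b d → a * b * d ≡ a * (d * b)
  lem = solve-∀ ringℚ

-- Rational numbers integral at p

module Localisation (p : ℕ) (p-prime : Prime p) where

  record Integral (c : ℚ) : Set where
    constructor fraction
    field
      bottom   : ℕ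
      top      : ℤ
      p∤bottom : ¬ (p ∣ bottom)
      eq       : c * # bottom ≡ ι top

  record Unit (c : ℚ) : Set where
    constructor fraction
    field
      bottom   : ℕ
      top      : ℤ
      p∤bottom : ¬ (p ∣ bottom)
      p∤top    : ¬ (p ∣ ℤ.∣ top ∣)
      eq       : c * # bottom ≡ ι top

  p∤1 : ¬ (p ∣ 1)
  p∤1 p∣1 = ¬prime[1] (subst Prime (∣1⇒≡1 p∣1) p-prime)

  p∤* : ∀ {m n} → ¬ (p ∣ m) → ¬ (p ∣ n) → ¬ (p ∣ m ℕ.* n)
  p∤* {m} {n} p∤m p∤n p∣mn with euclidsLemma m n p-prime p∣mn
  ... | inj₁ p∣m = p∤m p∣m
  ... | inj₂ p∣n = p∤n p∣n

  Integral-ι : ∀ z → Integral (ι z)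
  Integral-ι z = fraction 1 z p∤1 (ℚ.*-identityʳ (ι z))

  Integral-# : ∀ n → Integral (# n)
  Integral-# n = Integral-ι (+ n)

  Integral-+ : ∀ {a b} → Integral a → Integral b → Integral (a + b)
  Integral-+ {a} {b} (fraction d z p∤d eq) (fraction d′ z′ p∤d′ eq′) =
    fraction (d ℕ.* d′) (z ℤ.* + d′ ℤ.+ z′ ℤ.* + d) (p∤* p∤d p∤d′) (begin
      (a + b) * # (d ℕ.* d′)                  ≡⟨ cong ((a + b) *_) (#-* d d′) ⟩
      (a + b) * (# d * # d′)                  ≡⟨ lem a b (# d) (# d′) ⟩
      (a * # d) * # d′ + (b * # d′) * # d     ≡⟨ cong₂ (λ x y → x * # d′ + y * # d) eq eq′ ⟩
      ι z * # d′ + ι z′ * # d                 ≡⟨ sym (cong₂ _+_ (ι-* z (+ d′)) (ι-* z′ (+ d))) ⟩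
      ι (z ℤ.* + d′) + ι (z′ ℤ.* + d)         ≡⟨ sym (ι-+ (z ℤ.* + d′) (z′ ℤ.* + d)) ⟩
      ι (z ℤ.* + d′ ℤ.+ z′ ℤ.* + d) ∎)
    where
    lem : ∀ a b d e → (a + b) * (d * e) ≡ (a * d) * e + (b * e) * d
    lem = solve-∀ ringℚ

  private
    product-eq : ∀ {a b d d′ z z′} → a * # d ≡ ι z → b * # d′ ≡ ι z′ → (a * b) * # (d ℕ.* d′) ≡ ι (z ℤ.* z′)
    product-eq {a} {b} {d} {d′} {z} {z′} eq eq′ = begin
      (a * b) * # (d ℕ.* d′)      ≡⟨ cong ((a * b) *_) (#-* d d′) ⟩
      (a * b) * (# d * # d′)      ≡⟨ lem a b (# d) (# d′) ⟩
      (a * # d) * (b * # d′)      ≡⟨ cong₂ _*_ eq eq′ ⟩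
      ι z * ι z′                  ≡⟨ sym (ι-* z z′) ⟩
      ι (z ℤ.* z′) ∎
      where
      lem : ∀ a b d e → (a * b) * (d * e) ≡ (a * d) * (b * e)
      lem = solve-∀ ringℚ

  Integral-* : ∀ {a b} → Integral a → Integral b → Integral (a * b)
  Integral-* {a} {b} (fraction d z p∤d eq) (fraction d′ z′ p∤d′ eq′) =
    fraction (d ℕ.* d′) (z ℤ.* z′) (p∤* p∤d p∤d′) (product-eq {a} {b} {d} {d′} {z} {z′} eq eq′)

  Integral-neg : ∀ {a} → Integral a → Integral (- a)
  Integral-neg {a} Ia = subst Integral (lem a) (Integral-* (Integral-ι (-[1+ 0 ])) Ia)
    where
    lem : ∀ a → - 1ℚ * a ≡ - a
    lem = solve-∀ ringℚ

  Integral-minus : ∀ {a b} → Integral a → Integral b → Integral (a - b)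
  Integral-minus Ia Ib = Integral-+ Ia (Integral-neg Ib)

  Integral-sgn : ∀ n → Integral (sgn n)
  Integral-sgn zero    = Integral-# 1
  Integral-sgn (suc n) = Integral-neg (Integral-sgn n)

  Integral-Σ : ∀ n {f} → (∀ k → k ℕ.< n → Integral (f k)) → Integral (Σ< n f)
  Integral-Σ zero    I = Integral-# 0
  Integral-Σ (suc n) I = Integral-+ (Integral-Σ n (λ k k<n → I k (ℕ.m<n⇒m<1+n k<n))) (I n (ℕ.n<1+n n))

  Integral-^ : ∀ {x} → Integral x → ∀ n → Integral (x ^ℚ n)
  Integral-^ I zero    = Integral-# 1
  Integral-^ I (suc n) = Integral-* I (Integral-^ I n)

  -- By cross multiplication, and since the reduced numerator and denominator are coprime, the
  -- reduced denominator divides every admissible bottom.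
  Integral⇒Coprime-↧ₙ : ∀ {c} → Integral c → Coprime p (↧ₙ c)
  Integral⇒Coprime-↧ₙ {c} (fraction d z p∤d eq) {i} (i∣p , i∣D) with prime⇒irreducible p-prime i∣p
  ... | inj₁ i≡1 = i≡1
  ... | inj₂ refl = ⊥-elim (p∤d (∣-trans i∣D D∣d))
    where
    D = ↧ₙ c
    cross : ↥ c ℤ.* + d ≡ z ℤ.* + D
    cross = ι-injective (begin
      ι (↥ c ℤ.* + d)      ≡⟨ ι-* (↥ c) (+ d) ⟩
      ι (↥ c) * # d        ≡⟨ cong (_* # d) (sym (*-↧ₙ c)) ⟩
      c * # D * # d        ≡⟨ lem c (# D) (# d) ⟩
      c * # d * # D        ≡⟨ cong (_* # D) eq ⟩
      ι z * # D            ≡⟨ sym (ι-* z (+ D)) ⟩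
      ι (z ℤ.* + D) ∎)
      where
      lem : ∀ a b d → a * b * d ≡ a * d * b
      lem = solve-∀ ringℚ
    D∣d : D ∣ d
    D∣d = Coprime.coprime-divisor {n = ℤ.∣ ↥ c ∣} (Coprime.sym (coprime c))
      (divides ℤ.∣ z ∣ (trans (sym (ℤ.abs-* (↥ c) (+ d))) (trans (cong ℤ.∣_∣ cross) (ℤ.abs-* z (+ D)))))
      where
      coprime : ∀ c → Coprime ℤ.∣ ↥ c ∣ (↧ₙ c)
      coprime (mkℚ n d-1 cop) = Coprime.recompute cop

  Unit-# : ∀ {k} → ¬ (p ∣ k) → Unit (# k)
  Unit-# {k} p∤k = fraction 1 (+ k) p∤1 p∤k (ℚ.*-identityʳ (# k))

  Unit⇒≢0 : ∀ {c} → Unit c → c ≢ 0ℚ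
  Unit⇒≢0 {c} (fraction d z _ p∤z eq) refl = p∤z (subst (λ w → p ∣ ℤ.∣ w ∣) 0≡z (p ∣0))
    where
    0≡z : + 0 ≡ z
    0≡z = ι-injective (trans (sym (ℚ.*-zeroˡ (# d))) eq)

  Unit-inverse : ∀ {c} → Unit c → c * c ⁻¹ ≡ 1ℚ
  Unit-inverse U = ⁻¹-inverse (Unit⇒≢0 U)

  Integral-⁻¹ : ∀ {c} → Unit c → Integral (c ⁻¹)
  Integral-⁻¹ {c} U@(fraction d z p∤d p∤z eq) = go z p∤z eq
    where
    flip : ∀ w → c * # d ≡ w → c ⁻¹ * w ≡ # d
    flip w eq = begin
      c ⁻¹ * w              ≡⟨ cong (c ⁻¹ *_) (sym eq) ⟩
      c ⁻¹ * (c * # d)      ≡⟨ lem (c ⁻¹) c (# d) ⟩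
      (c * c ⁻¹) * # d      ≡⟨ cong (_* # d) (Unit-inverse U) ⟩
      1ℚ * # d              ≡⟨ ℚ.*-identityˡ (# d) ⟩
      # d ∎
      where
      lem : ∀ a b d → a * (b * d) ≡ (b * a) * d
      lem = solve-∀ ringℚ
    go : ∀ z → ¬ (p ∣ ℤ.∣ z ∣) → c * # d ≡ ι z → Integral (c ⁻¹)
    go (+ n)    p∤n eq = fraction n (+ d) p∤n (flip (# n) eq)
    go -[1+ n ] p∤n eq = subst Integral (lem₂ (c ⁻¹)) (Integral-neg
      (fraction (suc n) (+ d) p∤n (trans (lem₁ (c ⁻¹) (# (suc n))) (flip (- # (suc n)) eq))))
      where
      lem₁ : ∀ a b → - a * b ≡ a * - b
      lem₁ = solve-∀ ringℚ
      lem₂ : ∀ a → - - a ≡ a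
      lem₂ = solve-∀ ringℚ

  Unit-* : ∀ {a b} → Unit a → Unit b → Unit (a * b)
  Unit-* {a} {b} (fraction d z p∤d p∤z eq) (fraction d′ z′ p∤d′ p∤z′ eq′) =
    fraction (d ℕ.* d′) (z ℤ.* z′) (p∤* p∤d p∤d′)
      (subst (λ n → ¬ (p ∣ n)) (sym (ℤ.abs-* z z′)) (p∤* p∤z p∤z′))
      (product-eq {a} {b} {d} {d′} {z} {z′} eq eq′)

  Unit-neg : ∀ {a} → Unit a → Unit (- a)
  Unit-neg {a} Ua = subst Unit (lem a) (Unit-* minus-one Ua)
    where
    lem : ∀ a → - 1ℚ * a ≡ - a
    lem = solve-∀ ringℚ
    minus-one : Unit (- 1ℚ)
    minus-one = fraction 1 -[1+ 0 ] p∤1 p∤1 refl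

  -- The new top is, modulo p, the old one times `d′`, so p does not divide it. This makes linear
  -- forms such as `pole` and `offset` invertible.
  Unit-+p* : ∀ {a e} → Unit a → Integral e → Unit (a + # p * e)
  Unit-+p* {a} {e} (fraction d z p∤d p∤z eq) (fraction d′ z′ p∤d′ eq′) =
    fraction (d ℕ.* d′) (z ℤ.* + d′ ℤ.+ + p ℤ.* (z′ ℤ.* + d)) (p∤* p∤d p∤d′) p∤top (begin
      (a + # p * e) * # (d ℕ.* d′)                         ≡⟨ cong ((a + # p * e) *_) (#-* d d′) ⟩
      (a + # p * e) * (# d * # d′)                         ≡⟨ lem a e (# d) (# d′) (# p) ⟩
      (a * # d) * # d′ + # p * ((e * # d′) * # d)          ≡⟨ cong₂ (λ x y → x * # d′ + # p * (y * # d)) eq eq′ ⟩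
      ι z * # d′ + # p * (ι z′ * # d)                      ≡⟨ sym (cong₂ (λ x y → x + # p * y) (ι-* z (+ d′)) (ι-* z′ (+ d))) ⟩
      ι (z ℤ.* + d′) + # p * ι (z′ ℤ.* + d)                ≡⟨ cong (λ x → ι (z ℤ.* + d′) + x) (sym (ι-* (+ p) (z′ ℤ.* + d))) ⟩
      ι (z ℤ.* + d′) + ι (+ p ℤ.* (z′ ℤ.* + d))            ≡⟨ sym (ι-+ (z ℤ.* + d′) (+ p ℤ.* (z′ ℤ.* + d))) ⟩
      ι (z ℤ.* + d′ ℤ.+ + p ℤ.* (z′ ℤ.* + d)) ∎)
    where
    lem : ∀ a e d d′ π → (a + π * e) * (d * d′) ≡ (a * d) * d′ + π * ((e * d′) * d)
    lem = solve-∀ ringℚ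
    p∤top : ¬ (p ∣ ℤ.∣ z ℤ.* + d′ ℤ.+ + p ℤ.* (z′ ℤ.* + d) ∣)
    p∤top p∣top = subst (λ n → ¬ (p ∣ n)) (sym (ℤ.abs-* z (+ d′))) (p∤* p∤z p∤d′)
      (ℤ∣.∣⇒∣ᵤ {+ p} {z ℤ.* + d′} (ℤ∣.∣m+n∣n⇒∣m (ℤ∣.∣ᵤ⇒∣ {+ p} p∣top) (ℤ∣.∣m⇒∣m*n (z′ ℤ.* + d) ℤ∣.∣-refl)))

  -- Congruences between rationals

  infix 4 _≈_mod_
  -- The modulus may be any rational and the quotient is kept as data. So scaling a congruence
  -- scales its modulus, and the final bootstrap can put quotients into exact identities.
  record _≈_mod_ (a b q : ℚ) : Set where
    constructor congruent
    field
      {quotient} : ℚ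
      integral   : Integral quotient
      eq         : a ≡ b + q * quotient

  private
    variable
      a a₁ a₂ a₃ b b₁ b₂ b₃ c q e x y : ℚ

  ≈-reflexive : a ≡ b → a ≈ b mod q
  ≈-reflexive {a} {q = q} refl = congruent (Integral-# 0) (lem a q)
    where
    lem : ∀ a q → a ≡ a + q * # 0
    lem = solve-∀ ringℚ

  ≈-refl : a ≈ a mod q
  ≈-refl = ≈-reflexive refl

  -- The counterpart of `linear₁` for congruences: the coefficients of the combination must now be
  -- integral.
  ≈-linear₁ : Integral c → a ≈ b mod q → x - y ≡ c * (a - b) → x ≈ y mod q
  ≈-linear₁ {c} {a} {b} {q} {x} {y} Ic (congruent {t} It eq) rel =
    congruent (Integral-* Ic It) (linear₂ c eq 1ℚ rel (lem c a b q x y t))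
    where
    lem : ∀ c a b q x y t → x - (y + q * (c * t)) ≡ c * (a - (b + q * t)) + 1ℚ * (x - y - c * (a - b))
    lem = solve-∀ ringℚ

  ≈-linear₂ : ∀ {c₁ c₂} → Integral c₁ → a₁ ≈ b₁ mod q → Integral c₂ → a₂ ≈ b₂ mod q →
              x - y ≡ c₁ * (a₁ - b₁) + c₂ * (a₂ - b₂) → x ≈ y mod q
  ≈-linear₂ {a₁} {b₁} {q} {a₂} {b₂} {x} {y} {c₁} {c₂} I₁ (congruent {t₁} It₁ eq₁) I₂ (congruent {t₂} It₂ eq₂) rel =
    congruent (Integral-+ (Integral-* I₁ It₁) (Integral-* I₂ It₂))
      (linear₃ c₁ eq₁ c₂ eq₂ 1ℚ rel (lem c₁ a₁ b₁ t₁ c₂ a₂ b₂ t₂ q x y))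
    where
    lem : ∀ c₁ a₁ b₁ t₁ c₂ a₂ b₂ t₂ q x y →
        x - (y + q * (c₁ * t₁ + c₂ * t₂))
      ≡ c₁ * (a₁ - (b₁ + q * t₁)) + c₂ * (a₂ - (b₂ + q * t₂)) + 1ℚ * (x - y - (c₁ * (a₁ - b₁) + c₂ * (a₂ - b₂)))
    lem = solve-∀ ringℚ

  ≈-linear₃ : ∀ {c₁ c₂ c₃} → Integral c₁ → a₁ ≈ b₁ mod q → Integral c₂ → a₂ ≈ b₂ mod q → Integral c₃ → a₃ ≈ b₃ mod q →
              x - y ≡ c₁ * (a₁ - b₁) + c₂ * (a₂ - b₂) + c₃ * (a₃ - b₃) → x ≈ y mod q
  ≈-linear₃ {a₁} {b₁} {q} {a₂} {b₂} {a₃} {b₃} {x} {y} {c₁} {c₂} {c₃} I₁ h₁ I₂ h₂ I₃ h₃ rel =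
    ≈-linear₂ {a₁ = c₁ * a₁ + c₂ * a₂} {b₁ = c₁ * b₁ + c₂ * b₂} (Integral-# 1)
      (≈-linear₂ I₁ h₁ I₂ h₂ (lem₁ c₁ a₁ b₁ c₂ a₂ b₂)) I₃ h₃
      (trans rel (lem₂ c₁ a₁ b₁ c₂ a₂ b₂ (c₃ * (a₃ - b₃))))
    where
    lem₁ : ∀ c₁ a₁ b₁ c₂ a₂ b₂ → c₁ * a₁ + c₂ * a₂ - (c₁ * b₁ + c₂ * b₂) ≡ c₁ * (a₁ - b₁) + c₂ * (a₂ - b₂)
    lem₁ = solve-∀ ringℚ
    lem₂ : ∀ c₁ a₁ b₁ c₂ a₂ b₂ z → c₁ * (a₁ - b₁) + c₂ * (a₂ - b₂) + z
         ≡ # 1 * (c₁ * a₁ + c₂ * a₂ - (c₁ * b₁ + c₂ * b₂)) + z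
    lem₂ = solve-∀ ringℚ

  ≈-sym : a ≈ b mod q → b ≈ a mod q
  ≈-sym {a} {b} h = ≈-linear₁ {c = - 1ℚ} (Integral-neg (Integral-# 1)) h (lem a b)
    where
    lem : ∀ a b → b - a ≡ - 1ℚ * (a - b)
    lem = solve-∀ ringℚ

  ≈-trans : a ≈ b mod q → b ≈ c mod q → a ≈ c mod q
  ≈-trans {a} {b} {q} {c} h h′ = ≈-linear₂ (Integral-# 1) h (Integral-# 1) h′ (lem a b c)
    where
    lem : ∀ a b c → a - c ≡ # 1 * (a - b) + # 1 * (b - c)
    lem = solve-∀ ringℚ

  ≈-+ : a₁ ≈ b₁ mod q → a₂ ≈ b₂ mod q → a₁ + a₂ ≈ b₁ + b₂ mod q
  ≈-+ {a₁} {b₁} {q} {a₂} {b₂} h h′ = ≈-linear₂ (Integral-# 1) h (Integral-# 1) h′ (lem a₁ b₁ a₂ b₂)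
    where
    lem : ∀ a b c d → a + c - (b + d) ≡ # 1 * (a - b) + # 1 * (c - d)
    lem = solve-∀ ringℚ

  ≈-*ˡ : Integral x → a ≈ b mod q → x * a ≈ x * b mod q
  ≈-*ˡ {x} {a} {b} I h = ≈-linear₁ I h (lem x a b)
    where
    lem : ∀ x a b → x * a - x * b ≡ x * (a - b)
    lem = solve-∀ ringℚ

  ≈-* : Integral a₁ → Integral b₂ → a₁ ≈ b₁ mod q → a₂ ≈ b₂ mod q → a₁ * a₂ ≈ b₁ * b₂ mod q
  ≈-* {a₁} {b₂} {b₁} {q} {a₂} I I′ h h′ = ≈-linear₂ I′ h I h′ (lem a₁ b₁ a₂ b₂)
    where
    lem : ∀ a b c d → a * c - b * d ≡ d * (a - b) + a * (c - d)
    lem = solve-∀ ringℚ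

  ≈-scale : ∀ x → a ≈ b mod q → x * a ≈ x * b mod (x * q)
  ≈-scale {a} {b} {q} x (congruent {t} It eq) = congruent It (linear₁ x eq (lem x a b q t))
    where
    lem : ∀ x a b q t → x * a - (x * b + x * q * t) ≡ x * (a - (b + q * t))
    lem = solve-∀ ringℚ

  ≈-weaken : ∀ e → Integral e → a ≈ b mod (q * e) → a ≈ b mod q
  ≈-weaken {a} {b} {q} e Ie (congruent {t} It eq) =
    congruent (Integral-* Ie It) (trans eq (cong (λ s → b + s) (ℚ.*-assoc q e t)))

  ≈-Integral : Integral q → Integral b → a ≈ b mod q → Integral a
  ≈-Integral Iq Ib (congruent It eq) = subst Integral (sym eq) (Integral-+ Ib (Integral-* Iq It))

  ≈-Σ : ∀ n {f g : ℕ → ℚ} → (∀ k → k ℕ.< n → f k ≈ g k mod q) → Σ< n f ≈ Σ< n g mod q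
  ≈-Σ zero    h = ≈-refl
  ≈-Σ (suc n) h = ≈-+ (≈-Σ n (λ k k<n → h k (ℕ.m<n⇒m<1+n k<n))) (h n (ℕ.n<1+n n))

-- Harmonic numbers and perturbed inverses

harmonic : ℕ → ℚ
harmonic n = Σ< n (λ j → # (suc j) ⁻¹)

suc-inverse : ∀ j → # (suc j) * # (suc j) ⁻¹ ≡ 1ℚ
suc-inverse j = ⁻¹-inverse (#suc≢0 j)

choose-absorb : ∀ n j → # (suc n) * choose n j ≡ # (suc j) * choose (suc n) (suc j)
choose-absorb n j = sym (begin
  # (suc j) * choose (suc n) (suc j)
    ≡⟨ cong₂ _*_ (#-suc j) (choose-suc n j) ⟩
  (1ℚ + # j) * (choose n j + choose n (suc j))
    ≡⟨ linear₁ 1ℚ (choose-step n j) (lem (# j) (# n) (choose n j) (choose n (suc j))) ⟩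
  (1ℚ + # n) * choose n j
    ≡⟨ cong (_* choose n j) (sym (#-suc n)) ⟩
  # (suc n) * choose n j ∎)
  where
  lem : ∀ j n a b → (1ℚ + j) * (a + b) - (1ℚ + n) * a ≡ 1ℚ * ((1ℚ + j) * b - (n - j) * a)
  lem = solve-∀ ringℚ

-- Pascal's rule splits off Σ (-1)^j C(n,j)/(j+1), and C(n,j)/(j+1) = C(n+1,j+1)/(n+1) turns it into
-- 1/(n+1) times an alternating sum of binomials equal to 1. At n = p this yields the relation that
-- determines A.
alternating-reciprocals : ∀ n → Σ< n (λ j → sgn j * choose n (suc j) * # (suc j) ⁻¹) ≡ harmonic n
alternating-reciprocals zero    = refl
alternating-reciprocals (suc n) = begin
  Σ< (suc n) (λ j → sgn j * choose (suc n) (suc j) * ρ j)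
    ≡⟨ Σ-ext (suc n) (λ j → term j) ⟩
  Σ< (suc n) (λ j → sgn j * choose n (suc j) * ρ j + ρ n * (sgn j * choose (suc n) (suc j)))
    ≡⟨ Σ-+ (suc n) _ _ ⟩
  Σ< n (λ j → sgn j * choose n (suc j) * ρ j) + sgn n * choose n (suc n) * ρ n
    + Σ< (suc n) (λ j → ρ n * (sgn j * choose (suc n) (suc j)))
    ≡⟨ cong₂ _+_ (cong₂ _+_ (alternating-reciprocals n) (cong (λ c → sgn n * c * ρ n) (choose->n (ℕ.n<1+n n))))
                 (trans (Σ-* (suc n) (ρ n) _) (cong (ρ n *_) total)) ⟩
  harmonic n + sgn n * 0ℚ * ρ n + ρ n * 1ℚ
    ≡⟨ lem (harmonic n) (sgn n) (ρ n) ⟩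
  harmonic n + ρ n ∎
  where
  ρ : ℕ → ℚ
  ρ j = # (suc j) ⁻¹
  lem : ∀ h s r → h + s * 0ℚ * r + r * 1ℚ ≡ h + r
  lem = solve-∀ ringℚ
  term : ∀ j → sgn j * choose (suc n) (suc j) * ρ j
             ≡ sgn j * choose n (suc j) * ρ j + ρ n * (sgn j * choose (suc n) (suc j))
  term j = trans (cong (λ c → sgn j * c * ρ j) (choose-suc n j))
    (linear₃ (sgn j * ρ j * ρ n) (choose-absorb n j) (- (sgn j * ρ j * choose n j)) (suc-inverse n)
             (sgn j * ρ n * choose (suc n) (suc j)) (suc-inverse j)
      (lem′ (sgn j) (choose n j) (choose n (suc j)) (choose (suc n) (suc j)) (ρ j) (ρ n) (# (suc n)) (# (suc j))))
    where
    lem′ : ∀ s a b c r t n j → s * (a + b) * r - (s * b * r + t * (s * c))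
         ≡ s * r * t * (n * a - j * c) + - (s * r * a) * (n * t - 1ℚ) + s * t * c * (j * r - 1ℚ)
    lem′ = solve-∀ ringℚ
  -- The complete alternating sum of binomials vanishes, and its term at index 0 is 1.
  total : Σ< (suc n) (λ j → sgn j * choose (suc n) (suc j)) ≡ 1ℚ
  total = linear₃ (- 1ℚ) vanishing 1ℚ (Σ-shift (suc n) (λ i → sgn i * choose (suc n) i * 1ℚ))
                  1ℚ (cong₂ (λ c s → 1ℚ * c * 1ℚ + s) (choose-0 (suc n)) flipped)
            (lem₁ T A (1ℚ * choose (suc n) 0 * 1ℚ + Σ< (suc n) (λ j → - sgn j * choose (suc n) (suc j) * 1ℚ)))
    where
    T = Σ< (suc n) (λ j → sgn j * choose (suc n) (suc j))
    A = alternating (suc n) (λ _ → 1ℚ)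
    vanishing : A ≡ 0ℚ
    vanishing = alternating-vanishes (suc n) 0 (s≤s z≤n) (1ℚ , λ _ → refl)
    flipped : Σ< (suc n) (λ j → - sgn j * choose (suc n) (suc j) * 1ℚ) ≡ - 1ℚ * T
    flipped = trans (Σ-ext (suc n) (λ j → lem₂ (sgn j) (choose (suc n) (suc j)))) (Σ-* (suc n) (- 1ℚ) _)
      where
      lem₂ : ∀ s c → - s * c * 1ℚ ≡ - 1ℚ * (s * c)
      lem₂ = solve-∀ ringℚ
    lem₁ : ∀ T A B → T - 1ℚ ≡ - 1ℚ * (A - 0ℚ) + 1ℚ * (A - B) + 1ℚ * (B - (1ℚ * 1ℚ * 1ℚ + - 1ℚ * T))
    lem₁ = solve-∀ ringℚ

-- The exact first-order expansion of y = 1/u around v. The error term contains y again, so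
-- substituting it into itself raises the order without any series.
inverse-perturbed : ∀ {u y v z} → u * y ≡ 1ℚ → v * z ≡ 1ℚ → y ≡ z - (u - v) * z * y
inverse-perturbed {u} {y} {v} {z} uy vz = linear₂ z uy (- y) vz (lem u y v z)
  where
  lem : ∀ u y v z → y - (z - (u - v) * z * y) ≡ z * (u * y - 1ℚ) + - y * (v * z - 1ℚ)
  lem = solve-∀ ringℚ

inverse-double : ∀ r → # (suc r ℕ.+ suc r) ⁻¹ ≡ ½ * # (suc r) ⁻¹
inverse-double r = inverse-unique {u = # (suc r ℕ.+ suc r)} (suc-inverse (r ℕ.+ suc r))
  (trans (cong (_* (½ * # (suc r) ⁻¹)) (#-double (suc r)))
    (trans (lem (# (suc r)) (# (suc r) ⁻¹)) (suc-inverse r)))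
  where
  lem : ∀ a b → # 2 * a * (½ * b) ≡ a * b
  lem = solve-∀ ringℚ

-- Bernoulli numbers and power sums

lookup-∷ʳ-inject₁ : ∀ {n} (xs : Vec ℚ n) x i → lookup (xs ∷ʳ x) (inject₁ i) ≡ lookup xs i
lookup-∷ʳ-inject₁ (y ∷ xs) x Fin.zero    = refl
lookup-∷ʳ-inject₁ (y ∷ xs) x (Fin.suc i) = lookup-∷ʳ-inject₁ xs x i

lookup-∷ʳ-fromℕ : ∀ {n} (xs : Vec ℚ n) x → lookup (xs ∷ʳ x) (fromℕ n) ≡ x
lookup-∷ʳ-fromℕ []       x = refl
lookup-∷ʳ-fromℕ (y ∷ xs) x = lookup-∷ʳ-fromℕ xs x

bernoulliVec-suc : ∀ n → bernoulliVec (suc n) ≡ bernoulliVec n ∷ʳ bernoulli n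
bernoulliVec-suc zero    = refl
bernoulliVec-suc (suc n) = cong (bernoulliVec (suc n) ∷ʳ_) (sym (last-∷ʳ _ (bernoulliVec (suc n))))

ΣFin-cong : ∀ n {f g : Fin n → ℚ} → (∀ i → f i ≡ g i) → ΣFin n f ≡ ΣFin n g
ΣFin-cong zero    eq = refl
ΣFin-cong (suc n) eq = cong₂ _+_ (ΣFin-cong n (λ i → eq (inject₁ i))) (eq (fromℕ n))

-- Entries do not change as the vector grows, so index k holds `bernoulli k` at every length.
ΣFin-bernoulli : ∀ n (g : ℕ → ℚ) → ΣFin n (λ k → g (toℕ k) * lookup (bernoulliVec n) k) ≡ Σ< n (λ k → g k * bernoulli k)
ΣFin-bernoulli zero    g = refl
ΣFin-bernoulli (suc n) g = trans
  (ΣFin-cong (suc n) (λ k → cong (λ v → g (toℕ k) * lookup v k) (bernoulliVec-suc n)))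
  (cong₂ _+_
    (trans (ΣFin-cong n (λ k → cong₂ (λ i b → g i * b) (toℕ-inject₁ k) (lookup-∷ʳ-inject₁ (bernoulliVec n) (bernoulli n) k)))
           (ΣFin-bernoulli n g))
    (cong₂ (λ i b → g i * b) (toℕ-fromℕ n) (lookup-∷ʳ-fromℕ (bernoulliVec n) (bernoulli n))))

bernoulli-suc : ∀ n → # (suc (suc n)) * bernoulli (suc n) ≡ - Σ< (suc n) (λ k → choose (suc (suc n)) k * bernoulli k)
bernoulli-suc n = begin
  # m * bernoulli (suc n)
    ≡⟨ cong (# m *_) (last-∷ʳ _ (bernoulliVec (suc n))) ⟩
  # m * - ((+ 1 / m) * ΣFin (suc n) (λ k → ℕtoℚ (m C toℕ k) * lookup (bernoulliVec (suc n)) k))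
    ≡⟨ cong (λ s → # m * - ((+ 1 / m) * s)) (ΣFin-bernoulli (suc n) (choose m)) ⟩
  # m * - ((+ 1 / m) * s)
    ≡⟨ linear₁ (- s) (#-reciprocal m) (lem (# m) (+ 1 / m) s) ⟩
  - s ∎
  where
  m = suc (suc n)
  s = Σ< (suc n) (λ k → choose m k * bernoulli k)
  lem : ∀ a b s → a * - (b * s) - - s ≡ - s * (a * b - 1ℚ)
  lem = solve-∀ ringℚ

binomial : ∀ n x → (1ℚ + x) ^ℚ n ≡ Σ< (suc n) (λ j → choose n j * x ^ℚ j)
binomial zero    x = refl
binomial (suc n) x = begin
  (1ℚ + x) * (1ℚ + x) ^ℚ n
    ≡⟨ cong ((1ℚ + x) *_) (binomial n x) ⟩
  (1ℚ + x) * s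
    ≡⟨ lem₁ x s ⟩
  s + 0ℚ + x * s
    ≡⟨ cong₂ (λ u v → s + u + v) (sym (trans (cong (_* x ^ℚ suc n) (choose->n (ℕ.n<1+n n))) (ℚ.*-zeroˡ (x ^ℚ suc n)))) (sym (Σ-* (suc n) x t)) ⟩
  Σ< (suc (suc n)) t + Σ< (suc n) (λ j → x * t j)
    ≡⟨ cong (_+ Σ< (suc n) (λ j → x * t j)) (Σ-shift (suc n) t) ⟩
  t 0 + Σ< (suc n) (t ∘ suc) + Σ< (suc n) (λ j → x * t j)
    ≡⟨ ℚ.+-assoc (t 0) (Σ< (suc n) (t ∘ suc)) (Σ< (suc n) (λ j → x * t j)) ⟩
  t 0 + (Σ< (suc n) (t ∘ suc) + Σ< (suc n) (λ j → x * t j))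
    ≡⟨ cong (λ s → t 0 + s) (sym (Σ-+ (suc n) (t ∘ suc) (λ j → x * t j))) ⟩
  t 0 + Σ< (suc n) (λ j → t (suc j) + x * t j)
    ≡⟨ cong₂ _+_ (cong (_* 1ℚ) (trans (choose-0 n) (sym (choose-0 (suc n))))) (Σ-ext (suc n) pascal) ⟩
  t′ 0 + Σ< (suc n) (t′ ∘ suc)
    ≡⟨ sym (Σ-shift (suc n) t′) ⟩
  Σ< (suc (suc n)) t′ ∎
  where
  t t′ : ℕ → ℚ
  t j = choose n j * x ^ℚ j
  t′ j = choose (suc n) j * x ^ℚ j
  s = Σ< (suc n) t
  lem₁ : ∀ x s → (1ℚ + x) * s ≡ s + 0ℚ + x * s
  lem₁ = solve-∀ ringℚ
  pascal : ∀ j → t (suc j) + x * t j ≡ t′ (suc j)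
  pascal j = trans (lem (choose n (suc j)) x (x ^ℚ j) (choose n j)) (cong (_* x ^ℚ suc j) (sym (choose-suc n j)))
    where
    lem : ∀ a x y b → a * (x * y) + x * (b * y) ≡ (b + a) * (x * y)
    lem = solve-∀ ringℚ

powerSum : ℕ → ℕ → ℚ
powerSum n j = Σ< n (λ k → # k ^ℚ j)

-- Increasing n adds (n+1)^(m+1) - n^(m+1), expanded binomially. The Bernoulli numbers obey the same
-- recurrence with right side 0 for m ≥ 1.
powerSum-recurrence : ∀ m n → Σ< (suc m) (λ j → choose (suc m) j * powerSum n j) ≡ # n ^ℚ suc m
powerSum-recurrence m zero = begin
  Σ< (suc m) (λ j → choose (suc m) j * 0ℚ)   ≡⟨ Σ-ext (suc m) (λ j → ℚ.*-zeroʳ (choose (suc m) j)) ⟩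
  Σ< (suc m) (λ _ → 0ℚ)                     ≡⟨ Σ-0 (suc m) ⟩
  0ℚ                                        ≡⟨ sym (ℚ.*-zeroˡ (# 0 ^ℚ m)) ⟩
  # 0 ^ℚ suc m ∎
powerSum-recurrence m (suc n) = begin
  Σ< (suc m) (λ j → c j * (powerSum n j + # n ^ℚ j))
    ≡⟨ Σ-ext (suc m) (λ j → ℚ.*-distribˡ-+ (c j) (powerSum n j) (# n ^ℚ j)) ⟩
  Σ< (suc m) (λ j → c j * powerSum n j + c j * # n ^ℚ j)
    ≡⟨ Σ-+ (suc m) _ _ ⟩
  Σ< (suc m) (λ j → c j * powerSum n j) + Σ< (suc m) (λ j → c j * # n ^ℚ j)
    ≡⟨ cong (_+ Σ< (suc m) (λ j → c j * # n ^ℚ j)) (powerSum-recurrence m n) ⟩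
  # n ^ℚ suc m + Σ< (suc m) (λ j → c j * # n ^ℚ j)
    ≡⟨ ℚ.+-comm (# n ^ℚ suc m) _ ⟩
  Σ< (suc m) (λ j → c j * # n ^ℚ j) + # n ^ℚ suc m
    ≡⟨ cong (λ y → Σ< (suc m) (λ j → c j * # n ^ℚ j) + y)
         (trans (sym (ℚ.*-identityˡ (# n ^ℚ suc m))) (cong (_* # n ^ℚ suc m) (sym (choose-n (suc m))))) ⟩
  Σ< (suc (suc m)) (λ j → c j * # n ^ℚ j)
    ≡⟨ sym (binomial (suc m) (# n)) ⟩
  (1ℚ + # n) ^ℚ suc m
    ≡⟨ cong (_^ℚ suc m) (sym (#-suc n)) ⟩
  # (suc n) ^ℚ suc m ∎
  where
  c : ℕ → ℚ
  c = choose (suc m)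

Σ-1 : ∀ n → Σ< n (λ _ → 1ℚ) ≡ # n
Σ-1 zero    = refl
Σ-1 (suc n) = trans (cong (_+ 1ℚ) (Σ-1 n)) (trans (ℚ.+-comm (# n) 1ℚ) (sym (#-suc n)))

choose-suc-n : ∀ n → choose (suc n) n ≡ # (suc n)
choose-suc-n n = linear₃ (- 1ℚ) (choose-step (suc n) n) (1ℚ + # n) (choose-n (suc n)) (- (choose (suc n) n + 1ℚ)) (#-suc n)
    (lem (# n) (# (suc n)) (choose (suc n) (suc n)) (choose (suc n) n))
  where
  lem : ∀ n m a c → c - m ≡ - 1ℚ * ((1ℚ + n) * a - (m - n) * c) + (1ℚ + n) * (a - 1ℚ) + - (c + 1ℚ) * (m - (1ℚ + n))
  lem = solve-∀ ringℚ

^-neg : ∀ x n → (- x) ^ℚ n ≡ sgn n * x ^ℚ n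
^-neg x zero    = refl
^-neg x (suc n) = trans (cong (- x *_) (^-neg x n)) (lem x (sgn n) (x ^ℚ n))
  where
  lem : ∀ x s y → - x * (s * y) ≡ - s * (x * y)
  lem = solve-∀ ringℚ

^-* : ∀ x y n → (x * y) ^ℚ n ≡ x ^ℚ n * y ^ℚ n
^-* x y zero    = refl
^-* x y (suc n) = trans (cong (x * y *_) (^-* x y n)) (lem x y (x ^ℚ n) (y ^ℚ n))
  where
  lem : ∀ x y a b → x * y * (a * b) ≡ x * a * (y * b)
  lem = solve-∀ ringℚ

-- Expansions at the prime p = 2N + 1

module Estimates (N : ℕ) (p-prime : Prime (suc (N ℕ.+ N))) (2≤N : 2 ℕ.≤ N) where

  p : ℕ
  p = suc (N ℕ.+ N)

  open Localisation p p-prime public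

  π π² π³ π⁴ : ℚ
  π  = # p
  π² = π * π
  π³ = π * π²
  π⁴ = π * π³

  -- Indices are shifted: j stands for the integer k = j + 1. So j < N + N covers 1 ≤ k < p, and
  -- `ρ j * ρ j * H j` is H_{k-1}/k².
  ρ : ℕ → ℚ
  ρ j = # (suc j) ⁻¹

  H : ℕ → ℚ
  H = harmonic

  Integral-π : Integral π
  Integral-π = Integral-# p

  p∤small : ∀ k → suc k ℕ.< p → ¬ (p ∣ suc k)
  p∤small k k<p p∣k = ℕ.<⇒≱ k<p (∣⇒≤ p∣k)

  Unit-small : ∀ {j} → j ℕ.< N ℕ.+ N → Unit (# (suc j))
  Unit-small {j} j< = Unit-# (p∤small j (s≤s j<))

  4≤2N : 4 ℕ.≤ N ℕ.+ N
  4≤2N = ℕ.+-mono-≤ 2≤N 2≤N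

  Unit-2 : Unit (# 2)
  Unit-2 = Unit-small (ℕ.≤-trans (s≤s (s≤s z≤n)) 4≤2N)

  Integral-½ : Integral ½
  Integral-½ = fraction 2 (+ 1) (p∤small 1 (s≤s (ℕ.≤-trans (s≤s (s≤s z≤n)) 4≤2N))) refl

  Integral-1 : Integral 1ℚ
  Integral-1 = Integral-# 1

  Integral-ρ : ∀ {j} → j ℕ.< N ℕ.+ N → Integral (ρ j)
  Integral-ρ j< = Integral-⁻¹ (Unit-small j<)

  Integral-H : ∀ {n} → n ℕ.≤ N ℕ.+ N → Integral (H n)
  Integral-H {n} n≤ = Integral-Σ n (λ j j<n → Integral-ρ (ℕ.<-≤-trans j<n n≤))

  ρ-double : ∀ r → ρ (suc (r ℕ.+ r)) ≡ ½ * ρ r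
  ρ-double r = trans (cong ρ (sym (ℕ.+-suc r r))) (inverse-double r)

  -- One substitution of `inverse-perturbed` into itself leaves the remainder π² e² z² / w, which is
  -- integral because w is again a unit.
  inverse-expand : ∀ {w x e z} → Unit x → Integral e → x * z ≡ 1ℚ → w ≡ x + π * e →
                   w ⁻¹ ≈ z - π * (e * (z * z)) mod π²
  inverse-expand {w} {x} {e} {z} Ux Ie xz refl =
    congruent (Integral-* (Integral-* Ie Ie) (Integral-* (Integral-* Iz Iz) (Integral-⁻¹ Uw)))
      (linear₁ (1ℚ - π * (e * z)) y≡ (lem π e x z (w ⁻¹)))
    where
    Uw = Unit-+p* Ux Ie
    Iz : Integral z
    Iz = subst Integral (inverse-unique {u = x} (Unit-inverse Ux) xz) (Integral-⁻¹ Ux)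
    y≡ : w ⁻¹ ≡ z - (w - x) * z * w ⁻¹
    y≡ = inverse-perturbed {u = w} {v = x} (Unit-inverse Uw) xz
    lem : ∀ π e x z y → y - (z - π * (e * (z * z)) + π * π * (e * e * (z * z * y)))
        ≡ (1ℚ - π * (e * z)) * (y - (z - (x + π * e - x) * z * y))
    lem = solve-∀ ringℚ

  inverse-expand₁ : ∀ {w x e z} → Unit x → Integral e → x * z ≡ 1ℚ → w ≡ x + π * e → w ⁻¹ ≈ z mod π
  inverse-expand₁ {w} {x} {e} {z} Ux Ie xz eq =
    ≈-trans (≈-weaken π Integral-π (inverse-expand Ux Ie xz eq))
      (congruent (Integral-neg (Integral-* Ie (Integral-* Iz Iz))) (lem z π (e * (z * z))))
    where
    Iz : Integral z
    Iz = subst Integral (inverse-unique {u = x} (Unit-inverse Ux) xz) (Integral-⁻¹ Ux)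
    lem : ∀ z π t → z - π * t ≡ z + π * - t
    lem = solve-∀ ringℚ

  -- Pair j l: the integers j + 1 and l + 1 are swapped by k ↦ p - k.
  record Pair (j l : ℕ) : Set where
    constructor adding-to-p
    field
      sum≡p : suc j ℕ.+ suc l ≡ p

  Pair-<ˡ : ∀ {j l} → Pair j l → j ℕ.< N ℕ.+ N
  Pair-<ˡ {j} {l} (adding-to-p eq) = ℕ.≤-trans (ℕ.m≤m+n (suc j) l)
    (ℕ.≤-reflexive (ℕ.suc-injective (trans (sym (ℕ.+-suc (suc j) l)) eq)))

  Pair-sym : ∀ {j l} → Pair j l → Pair l j
  Pair-sym {j} {l} (adding-to-p eq) = adding-to-p (trans (ℕ.+-comm (suc l) (suc j)) eq)

  Pair-# : ∀ {j l} → Pair j l → # (suc l) ≡ - # (suc j) + π * 1ℚ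
  Pair-# {j} {l} (adding-to-p eq) = linear₂ (- 1ℚ) (cong #_ (sym eq)) (- 1ℚ) (#-+ (suc j) (suc l))
      (lem (# (suc j)) (# (suc l)) π (# (suc j ℕ.+ suc l)))
    where
    lem : ∀ a b π s → b - (- a + π * 1ℚ) ≡ - 1ℚ * (π - s) + - 1ℚ * (s - (a + b))
    lem = solve-∀ ringℚ

  private
    neg-inverse : ∀ j → - # (suc j) * - ρ j ≡ 1ℚ
    neg-inverse j = trans (lem (# (suc j)) (ρ j)) (suc-inverse j)
      where
      lem : ∀ a b → - a * - b ≡ a * b
      lem = solve-∀ ringℚ

  ρ-pair : ∀ {j l} → Pair j l → ρ l ≈ - ρ j - π * (ρ j * ρ j) mod π²
  ρ-pair {j} eq = ≈-trans
    (inverse-expand (Unit-neg (Unit-small (Pair-<ˡ eq))) Integral-1 (neg-inverse j) (Pair-# eq))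
    (≈-reflexive (lem π (ρ j)))
    where
    lem : ∀ π z → - z - π * (1ℚ * (- z * - z)) ≡ - z - π * (z * z)
    lem = solve-∀ ringℚ

  ρ-pair₁ : ∀ {j l} → Pair j l → ρ l ≈ - ρ j mod π
  ρ-pair₁ {j} eq = inverse-expand₁ (Unit-neg (Unit-small (Pair-<ˡ eq))) Integral-1 (neg-inverse j) (Pair-# eq)

  Σ-mirror : ∀ (f : ℕ → ℚ) → Σ< (N ℕ.+ N) f ≡ Σ< (N ℕ.+ N) (λ j → f (N ℕ.+ N ∸ suc j))
  Σ-mirror = Σ-reverse (N ℕ.+ N)

  mirror-Pair : ∀ {j} → j ℕ.< N ℕ.+ N → Pair j (N ℕ.+ N ∸ suc j)
  mirror-Pair {j} j< = adding-to-p (trans (ℕ.+-suc (suc j) _) (cong suc (ℕ.m+[n∸m]≡n j<)))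

  upper : ℕ → ℕ
  upper j = N ℕ.+ (N ∸ suc j)

  upper-Pair : ∀ {j} → j ℕ.< N → Pair j (upper j)
  upper-Pair {j} j<N = adding-to-p (trans (ℕ.+-suc (suc j) _) (cong suc (begin
    suc j ℕ.+ (N ℕ.+ (N ∸ suc j))    ≡⟨ ℕ.+-comm (suc j) _ ⟩
    N ℕ.+ (N ∸ suc j) ℕ.+ suc j      ≡⟨ ℕ.+-assoc N (N ∸ suc j) (suc j) ⟩
    N ℕ.+ (N ∸ suc j ℕ.+ suc j)      ≡⟨ cong (N ℕ.+_) (ℕ.m∸n+n≡m j<N) ⟩
    N ℕ.+ N ∎)))

  Σ-halves : ∀ (f : ℕ → ℚ) → Σ< (N ℕ.+ N) f ≡ Σ< N (λ j → f j + f (upper j))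
  Σ-halves f = begin
    Σ< (N ℕ.+ N) f                                   ≡⟨ Σ-split N N f ⟩
    Σ< N f + Σ< N (λ j → f (N ℕ.+ j))                ≡⟨ cong (λ s → Σ< N f + s) (Σ-reverse N (λ j → f (N ℕ.+ j))) ⟩
    Σ< N f + Σ< N (λ j → f (upper j))                ≡⟨ sym (Σ-+ N f (λ j → f (upper j))) ⟩
    Σ< N (λ j → f j + f (upper j)) ∎

  -- The index of the odd integer p - 2(r + 1): every odd number below p is matched with an even
  -- one.
  oddIndex : ℕ → ℕ
  oddIndex r = (N ∸ suc r) ℕ.+ (N ∸ suc r)

  oddIndex-Pair : ∀ {r} → r ℕ.< N → Pair (suc (r ℕ.+ r)) (oddIndex r)
  oddIndex-Pair {r} r<N = adding-to-p (trans (ℕ.+-suc (suc (suc (r ℕ.+ r))) _) (cong suc (begin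
    suc (suc (r ℕ.+ r)) ℕ.+ (m ℕ.+ m)      ≡⟨ cong (λ x → suc x ℕ.+ (m ℕ.+ m)) (sym (ℕ.+-suc r r)) ⟩
    suc r ℕ.+ suc r ℕ.+ (m ℕ.+ m)          ≡⟨ ℕ.+-assoc (suc r) (suc r) (m ℕ.+ m) ⟩
    suc r ℕ.+ (suc r ℕ.+ (m ℕ.+ m))        ≡⟨ cong (suc r ℕ.+_) (sym (ℕ.+-assoc (suc r) m m)) ⟩
    suc r ℕ.+ (suc r ℕ.+ m ℕ.+ m)          ≡⟨ cong (λ x → suc r ℕ.+ (x ℕ.+ m)) r+m ⟩
    suc r ℕ.+ (N ℕ.+ m)                    ≡⟨ cong (suc r ℕ.+_) (ℕ.+-comm N m) ⟩
    suc r ℕ.+ (m ℕ.+ N)                    ≡⟨ sym (ℕ.+-assoc (suc r) m N) ⟩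
    suc r ℕ.+ m ℕ.+ N                      ≡⟨ cong (ℕ._+ N) r+m ⟩
    N ℕ.+ N ∎)))
    where
    m = N ∸ suc r
    r+m : suc r ℕ.+ m ≡ N
    r+m = ℕ.m+[n∸m]≡n r<N

  Σ-parities : ∀ (f : ℕ → ℚ) → Σ< (N ℕ.+ N) f ≡ Σ< N (λ r → f (suc (r ℕ.+ r)) + f (oddIndex r))
  Σ-parities f = begin
    Σ< (N ℕ.+ N) f
      ≡⟨ Σ-parity N f ⟩
    Σ< N (λ r → f (r ℕ.+ r)) + Σ< N (λ r → f (suc (r ℕ.+ r)))
      ≡⟨ cong (_+ Σ< N (λ r → f (suc (r ℕ.+ r)))) (Σ-reverse N (λ r → f (r ℕ.+ r))) ⟩
    Σ< N (λ r → f (oddIndex r)) + Σ< N (λ r → f (suc (r ℕ.+ r)))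
      ≡⟨ ℚ.+-comm (Σ< N (λ r → f (oddIndex r))) _ ⟩
    Σ< N (λ r → f (suc (r ℕ.+ r))) + Σ< N (λ r → f (oddIndex r))
      ≡⟨ sym (Σ-+ N (λ r → f (suc (r ℕ.+ r))) (λ r → f (oddIndex r))) ⟩
    Σ< N (λ r → f (suc (r ℕ.+ r)) + f (oddIndex r)) ∎

  -- Relations between harmonic sums modulo powers of p

  h₂ h₃ : ℕ → ℚ
  h₂ n = Σ< n (λ j → ρ j * ρ j)
  h₃ n = Σ< n (λ j → ρ j * ρ j * ρ j)

  A E Y : ℚ
  A = Σ< (N ℕ.+ N) (λ j → ρ j * ρ j * H j)
  E = Σ< N (λ r → ρ r * ρ r * H (suc (r ℕ.+ r)))
  Y = Σ< N (λ r → ρ r * ρ r * H r)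

  Integral-h₃ : ∀ {n} → n ℕ.≤ N ℕ.+ N → Integral (h₃ n)
  Integral-h₃ {n} n≤ = Integral-Σ n (λ j j<n → let I = Integral-ρ (ℕ.<-≤-trans j<n n≤) in Integral-* (Integral-* I I) I)

  r<N⇒2r+1<2N : ∀ {r} → r ℕ.< N → suc (r ℕ.+ r) ℕ.< N ℕ.+ N
  r<N⇒2r+1<2N {r} r<N = ℕ.≤-trans (ℕ.≤-reflexive (cong suc (sym (ℕ.+-suc r r)))) (ℕ.+-mono-≤ r<N r<N)

  j<N⇒j<2N : ∀ {j} → j ℕ.< N → j ℕ.< N ℕ.+ N
  j<N⇒j<2N j<N = ℕ.<-≤-trans j<N (ℕ.m≤m+n N N)

  ρ²-pair : ∀ {j l} → Pair j l → ρ l * ρ l ≈ ρ j * ρ j + # 2 * (π * (ρ j * ρ j * ρ j)) mod π²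
  ρ²-pair {j} {l} pair = ≈-trans
    (≈-* Iρl (Integral-minus (Integral-neg Iρ) (Integral-* Integral-π (Integral-* Iρ Iρ))) (ρ-pair pair) (ρ-pair pair))
    (congruent (Integral-* (Integral-* Iρ Iρ) (Integral-* Iρ Iρ)) (lem π (ρ j)))
    where
    Iρ = Integral-ρ (Pair-<ˡ pair)
    Iρl = Integral-ρ (Pair-<ˡ (Pair-sym pair))
    lem : ∀ π r → (- r - π * (r * r)) * (- r - π * (r * r)) ≡ r * r + # 2 * (π * (r * r * r)) + π * π * (r * r * (r * r))
    lem = solve-∀ ringℚ

  ρ²-pair₁ : ∀ {j l} → Pair j l → ρ l * ρ l ≈ ρ j * ρ j mod π
  ρ²-pair₁ {j} {l} pair = ≈-trans
    (≈-* (Integral-ρ (Pair-<ˡ (Pair-sym pair))) (Integral-neg (Integral-ρ (Pair-<ˡ pair))) (ρ-pair₁ pair) (ρ-pair₁ pair))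
    (≈-reflexive (lem (ρ j)))
    where
    lem : ∀ r → - r * - r ≡ r * r
    lem = solve-∀ ringℚ

  h₃-full : h₃ (N ℕ.+ N) ≈ 0ℚ mod π
  h₃-full = ≈-trans (≈-reflexive (Σ-halves (λ j → ρ j * ρ j * ρ j)))
    (≈-trans (≈-Σ N term) (≈-reflexive (Σ-0 N)))
    where
    lem : ∀ r s → r * r * r + s * s * s - 0ℚ ≡ s * (s * s - r * r) + r * r * (s - - r)
    lem = solve-∀ ringℚ
    term : ∀ j → j ℕ.< N → ρ j * ρ j * ρ j + ρ (upper j) * ρ (upper j) * ρ (upper j) ≈ 0ℚ mod π
    term j j<N = ≈-linear₂ (Integral-ρ (Pair-<ˡ (Pair-sym pair))) (ρ²-pair₁ pair)
                           (Integral-* Iρ Iρ) (ρ-pair₁ pair) (lem (ρ j) (ρ (upper j)))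
      where
      pair = upper-Pair j<N
      Iρ = Integral-ρ (Pair-<ˡ pair)

  H-full : H (N ℕ.+ N) ≈ 0ℚ mod π
  H-full = ≈-trans (≈-reflexive (Σ-halves ρ)) (≈-trans (≈-Σ N term) (≈-reflexive (Σ-0 N)))
    where
    lem : ∀ r s → r + s - 0ℚ ≡ # 1 * (s - - r)
    lem = solve-∀ ringℚ
    term : ∀ j → j ℕ.< N → ρ j + ρ (upper j) ≈ 0ℚ mod π
    term j j<N = ≈-linear₁ (Integral-# 1) (ρ-pair₁ (upper-Pair j<N)) (lem (ρ j) (ρ (upper j)))

  -- Starts from H_{p-1} ≡ 0 and removes one term at the top for each term added at the bottom,
  -- using 1/(p-k) ≡ -1/k.
  H-mirror : ∀ k l → k ℕ.+ l ≡ N ℕ.+ N → H l ≈ H k mod π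
  H-mirror zero    l refl = H-full
  H-mirror (suc k) l eq   =
    ≈-linear₂ (Integral-# 1) (H-mirror k (suc l) (trans (ℕ.+-suc k l) eq))
              (Integral-neg (Integral-# 1)) (ρ-pair₁ (adding-to-p (trans (ℕ.+-suc (suc k) l) (cong suc eq))))
              (lem (H l) (ρ l) (H k) (ρ k))
    where
    lem : ∀ a b c d → a - (c + d) ≡ # 1 * (a + b - c) + - # 1 * (b - - d)
    lem = solve-∀ ringℚ

  H-pair : ∀ {j l} → Pair j l → H l ≈ H j + ρ j mod π
  H-pair {j} {l} (adding-to-p pair) = H-mirror (suc j) l (ℕ.suc-injective (trans (sym (ℕ.+-suc (suc j) l)) pair))

  -- Since 1/k + 1/(p-k) = p/(k(p-k)) exactly, one factor p is free, and expansions modulo p² reach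
  -- p³. The cubic term they produce disappears by `h₃-full`.
  2H-full : # 2 * H (N ℕ.+ N) ≈ - (π * h₂ (N ℕ.+ N)) mod π³
  2H-full = ≈-trans (≈-reflexive doubled) (≈-trans (≈-scale π products) (≈-reflexive (lem₀ π (h₂ (N ℕ.+ N)))))
    where
    m : ℕ → ℕ
    m j = N ℕ.+ N ∸ suc j
    lem₀ : ∀ π h → π * - h ≡ - (π * h)
    lem₀ = solve-∀ ringℚ
    lem₁ : ∀ a → # 2 * a ≡ a + a
    lem₁ = solve-∀ ringℚ
    lem₂ : ∀ r s a b π → r + s - π * (r * s) ≡ - s * (a * r - 1ℚ) + - r * (b * s - 1ℚ) + r * s * (b - (- a + π * 1ℚ))
    lem₂ = solve-∀ ringℚ
    doubled : # 2 * H (N ℕ.+ N) ≡ π * Σ< (N ℕ.+ N) (λ j → ρ j * ρ (m j))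
    doubled = begin
      # 2 * H (N ℕ.+ N)                                        ≡⟨ lem₁ (H (N ℕ.+ N)) ⟩
      H (N ℕ.+ N) + H (N ℕ.+ N)                                ≡⟨ cong (λ s → H (N ℕ.+ N) + s) (Σ-mirror ρ) ⟩
      H (N ℕ.+ N) + Σ< (N ℕ.+ N) (λ j → ρ (m j))               ≡⟨ sym (Σ-+ (N ℕ.+ N) ρ (λ j → ρ (m j))) ⟩
      Σ< (N ℕ.+ N) (λ j → ρ j + ρ (m j))
        ≡⟨ Σ-cong (N ℕ.+ N) (λ j j< → linear₃ (- ρ (m j)) (suc-inverse j) (- ρ j) (suc-inverse (m j))
             (ρ j * ρ (m j)) (Pair-# (mirror-Pair j<)) (lem₂ (ρ j) (ρ (m j)) (# (suc j)) (# (suc (m j))) π)) ⟩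
      Σ< (N ℕ.+ N) (λ j → π * (ρ j * ρ (m j)))                 ≡⟨ Σ-* (N ℕ.+ N) π _ ⟩
      π * Σ< (N ℕ.+ N) (λ j → ρ j * ρ (m j)) ∎
    lem₃ : ∀ r s π → r * s - (- 1ℚ * (r * r) + - π * (r * r * r)) ≡ r * (s - (- r - π * (r * r)))
    lem₃ = solve-∀ ringℚ
    lem₄ : ∀ h₂ h₃ π → - 1ℚ * h₂ + - π * h₃ - - h₂ ≡ - # 1 * (π * h₃ - π * 0ℚ)
    lem₄ = solve-∀ ringℚ
    products : Σ< (N ℕ.+ N) (λ j → ρ j * ρ (m j)) ≈ - h₂ (N ℕ.+ N) mod π²
    products = ≈-trans
      (≈-Σ (N ℕ.+ N) (λ j j< → ≈-linear₁ (Integral-ρ j<) (ρ-pair (mirror-Pair j<)) (lem₃ (ρ j) (ρ (m j)) π)))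
      (≈-trans (≈-reflexive (Σ-linear (N ℕ.+ N) (- 1ℚ) (- π) _ _))
        (≈-linear₁ (Integral-neg (Integral-# 1)) (≈-scale π h₃-full) (lem₄ (h₂ (N ℕ.+ N)) (h₃ (N ℕ.+ N)) π)))

  -- Pairs k with p - k for k ≤ N. With `h₂-parities` this makes two linear equations that express
  -- both h₂ sums through h₃.
  h₂-halves : h₂ (N ℕ.+ N) ≈ # 2 * h₂ N + # 2 * π * h₃ N mod π²
  h₂-halves = ≈-trans (≈-reflexive (Σ-halves (λ j → ρ j * ρ j)))
    (≈-trans (≈-Σ N (λ j j<N → ≈-linear₁ (Integral-# 1) (ρ²-pair (upper-Pair j<N)) (lem (ρ j) (ρ (upper j)) π)))
      (≈-reflexive (Σ-linear N (# 2) (# 2 * π) _ _)))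
    where
    lem : ∀ r s π → r * r + s * s - (# 2 * (r * r) + # 2 * π * (r * r * r))
                  ≡ # 1 * (s * s - (r * r + # 2 * (π * (r * r * r))))
    lem = solve-∀ ringℚ

  -- Pairs 2k with p - 2k, so that the sum again runs over k ≤ N but with 1/(2k) in place of 1/k;
  -- this makes the equation independent of `h₂-halves`.
  h₂-parities : # 4 * h₂ (N ℕ.+ N) ≈ # 2 * h₂ N + π * h₃ N mod π²
  h₂-parities = ≈-trans
    (≈-reflexive (trans (cong (# 4 *_) (Σ-parities (λ j → ρ j * ρ j))) (sym (Σ-* N (# 4) _))))
    (≈-trans (≈-Σ N term) (≈-reflexive (Σ-linear N (# 2) π _ _)))
    where
    lem : ∀ r s t π → # 4 * (t * t + s * s) - (# 2 * (r * r) + π * (r * r * r))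
        ≡ # 4 * (s * s - (t * t + # 2 * (π * (t * t * t)))) + ((# 8 * t + # 4 * r) * 1ℚ + # 2 * π * (# 4 * (t * t) + # 2 * t * r + r * r)) * (t - ½ * r)
    lem = solve-∀ ringℚ
    term : ∀ r → r ℕ.< N → # 4 * (ρ (suc (r ℕ.+ r)) * ρ (suc (r ℕ.+ r)) + ρ (oddIndex r) * ρ (oddIndex r))
         ≈ # 2 * (ρ r * ρ r) + π * (ρ r * ρ r * ρ r) mod π²
    term r r<N = ≈-linear₂ (Integral-# 4) (ρ²-pair (oddIndex-Pair r<N))
      (Integral-+ (Integral-* (Integral-+ (Integral-* (Integral-# 8) It) (Integral-* (Integral-# 4) Ir)) Integral-1)
        (Integral-* (Integral-* (Integral-# 2) Integral-π)
          (Integral-+ (Integral-+ (Integral-* (Integral-# 4) (Integral-* It It)) (Integral-* (Integral-* (Integral-# 2) It) Ir)) (Integral-* Ir Ir))))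
      (≈-reflexive (ρ-double r))
      (lem (ρ r) (ρ (oddIndex r)) (ρ (suc (r ℕ.+ r))) π)
      where
      Ir = Integral-ρ (j<N⇒j<2N r<N)
      It = Integral-ρ (r<N⇒2r+1<2N r<N)

  -- The same two pairings applied to A: halves produce Y, parities produce E, so E - Y becomes a
  -- combination of A and h₃.
  A-halves : A ≈ # 2 * Y + 1ℚ * h₃ N mod π
  A-halves = ≈-trans (≈-reflexive (Σ-halves (λ j → ρ j * ρ j * H j)))
    (≈-trans (≈-Σ N term) (≈-reflexive (Σ-linear N (# 2) 1ℚ _ _)))
    where
    lem : ∀ r s h k → r * r * h + s * s * k - (# 2 * (r * r * h) + 1ℚ * (r * r * r))
        ≡ k * (s * s - r * r) + r * r * (k - (h + r))
    lem = solve-∀ ringℚ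
    term : ∀ j → j ℕ.< N → ρ j * ρ j * H j + ρ (upper j) * ρ (upper j) * H (upper j)
         ≈ # 2 * (ρ j * ρ j * H j) + 1ℚ * (ρ j * ρ j * ρ j) mod π
    term j j<N = ≈-linear₂ (Integral-H (ℕ.<⇒≤ (Pair-<ˡ (Pair-sym pair)))) (ρ²-pair₁ pair)
        (Integral-* Ir Ir) (H-pair pair) (lem (ρ j) (ρ (upper j)) (H j) (H (upper j)))
      where
      pair = upper-Pair j<N
      Ir = Integral-ρ (Pair-<ˡ pair)

  A-parities : # 8 * A ≈ # 4 * E + 1ℚ * h₃ N mod π
  A-parities = ≈-trans
    (≈-reflexive (trans (cong (# 8 *_) (Σ-parities (λ j → ρ j * ρ j * H j))) (sym (Σ-* N (# 8) _))))
    (≈-trans (≈-Σ N term) (≈-reflexive (Σ-linear N (# 4) 1ℚ _ _)))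
    where
    lem : ∀ r s t h k → # 8 * (t * t * h + s * s * k) - (# 4 * (r * r * h) + 1ℚ * (r * r * r))
        ≡ # 8 * k * (s * s - t * t) + # 8 * (t * t) * (k - (h + t))
          + (# 16 * (t * h) + # 8 * (r * h) + # 8 * (t * t) + # 4 * (t * r) + # 2 * (r * r)) * (t - ½ * r)
    lem = solve-∀ ringℚ
    term : ∀ r → r ℕ.< N → # 8 * (ρ (suc (r ℕ.+ r)) * ρ (suc (r ℕ.+ r)) * H (suc (r ℕ.+ r)) + ρ (oddIndex r) * ρ (oddIndex r) * H (oddIndex r))
         ≈ # 4 * (ρ r * ρ r * H (suc (r ℕ.+ r))) + 1ℚ * (ρ r * ρ r * ρ r) mod π
    term r r<N = ≈-linear₃ (Integral-* (Integral-# 8) (Integral-H (ℕ.<⇒≤ (Pair-<ˡ (Pair-sym pair))))) (ρ²-pair₁ pair)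
      (Integral-* (Integral-# 8) (Integral-* It It)) (H-pair pair)
      (Integral-+ (Integral-+ (Integral-+ (Integral-+ (Integral-* (Integral-# 16) (Integral-* It Ih)) (Integral-* (Integral-# 8) (Integral-* Ir Ih)))
        (Integral-* (Integral-# 8) (Integral-* It It))) (Integral-* (Integral-# 4) (Integral-* It Ir))) (Integral-* (Integral-# 2) (Integral-* Ir Ir)))
      (≈-reflexive (ρ-double r))
      (lem (ρ r) (ρ (oddIndex r)) (ρ (suc (r ℕ.+ r))) (H (suc (r ℕ.+ r))) (H (oddIndex r)))
      where
      pair = oddIndex-Pair r<N
      Ir = Integral-ρ (j<N⇒j<2N r<N)
      It = Integral-ρ (r<N⇒2r+1<2N r<N)
      Ih = Integral-H (ℕ.<⇒≤ (r<N⇒2r+1<2N r<N))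

  -- The binomial coefficients C(p,k), and the value of A

  β : ℕ → ℚ
  β zero    = 1ℚ
  β (suc j) = β j * (1ℚ - π * ρ j)

  Integral-β : ∀ {j} → j ℕ.≤ N ℕ.+ N → Integral (β j)
  Integral-β {zero}  _  = Integral-1
  Integral-β {suc j} j< = Integral-* (Integral-β (ℕ.<⇒≤ j<)) (Integral-minus Integral-1 (Integral-* Integral-π (Integral-ρ j<)))

  β-expand : ∀ {j} → j ℕ.≤ N ℕ.+ N → β j ≈ 1ℚ - π * H j mod π²
  β-expand {zero}  _  = ≈-reflexive (lem π)
    where
    lem : ∀ π → 1ℚ ≡ 1ℚ - π * 0ℚ
    lem = solve-∀ ringℚ
  β-expand {suc j} j< = ≈-trans
    (≈-* (Integral-β (ℕ.<⇒≤ j<)) (Integral-minus Integral-1 (Integral-* Integral-π Iρ)) (β-expand (ℕ.<⇒≤ j<)) ≈-refl)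
    (congruent (Integral-* (Integral-H (ℕ.<⇒≤ j<)) Iρ) (lem π (H j) (ρ j)))
    where
    Iρ = Integral-ρ j<
    lem : ∀ π h r → (1ℚ - π * h) * (1ℚ - π * r) ≡ 1ℚ - π * (h + r) + π * π * (h * r)
    lem = solve-∀ ringℚ

  coefficient : ℕ → ℚ
  coefficient i = sgn i * choose p i

  -- From the ratio of neighbouring binomials: (-1)^k C(p,k) = -(p/k) Π_{i<k} (1 - p/i). The product
  -- is `β`.
  #*coefficient : ∀ j → # (suc j) * coefficient (suc j) ≡ - (π * β j)
  #*coefficient zero = trans (cong (λ c → # 1 * (sgn 1 * # c)) (nC1≡n p)) (lem π)
    where
    lem : ∀ π → # 1 * (- 1ℚ * π) ≡ - (π * 1ℚ)
    lem = solve-∀ ringℚ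
  #*coefficient (suc j) = begin
    # (suc k) * coefficient (suc k)
      ≡⟨ cong (_* coefficient (suc k)) (#-suc k) ⟩
    (1ℚ + # k) * coefficient (suc k)
      ≡⟨ linear₃ (- sgn k) (choose-step p k) (1ℚ - π * ρ j) (#*coefficient j) (π * coefficient k) (suc-inverse j)
           (lem (# k) (sgn k) (choose p k) (choose p (suc k)) π (ρ j) (β j)) ⟩
    - (π * (β j * (1ℚ - π * ρ j))) ∎
    where
    k = suc j
    lem : ∀ k s c c′ π r b → (1ℚ + k) * (- s * c′) - - (π * (b * (1ℚ - π * r)))
        ≡ - s * ((1ℚ + k) * c′ - (π - k) * c) + (1ℚ - π * r) * (k * (s * c) - - (π * b)) + π * (s * c) * (k * r - 1ℚ)
    lem = solve-∀ ringℚ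

  coefficient-suc : ∀ j → coefficient (suc j) ≡ - (π * (ρ j * β j))
  coefficient-suc j = linear₂ (- coefficient (suc j)) (suc-inverse j) (ρ j) (#*coefficient j)
      (lem (# (suc j)) (coefficient (suc j)) π (ρ j) (β j))
    where
    lem : ∀ k c π r b → c - - (π * (r * b)) ≡ - c * (k * r - 1ℚ) + r * (k * c - - (π * b))
    lem = solve-∀ ringℚ

  coefficient-p : coefficient p ≡ - 1ℚ
  coefficient-p = cong₂ (λ s c → - s * c) (sgn-double N) (choose-n p)

  -- In `alternating-reciprocals` for p the term k = p is 1/p and cancels the last term of H_p. What
  -- remains is H_{p-1} = p Σ β/k², and β is expanded to first order.
  h₂-πA : π * (h₂ (N ℕ.+ N) - π * A) ≈ H (N ℕ.+ N) mod π³
  h₂-πA = ≈-sym (≈-trans (≈-reflexive exact) (≈-scale π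
    (≈-trans (≈-Σ (N ℕ.+ N) (λ j j< → ≈-linear₁ (Integral-* (Integral-ρ j<) (Integral-ρ j<)) (β-expand (ℕ.<⇒≤ j<)) (lem₁ (ρ j) (β j) π (H j))))
      (≈-reflexive (trans (Σ-linear (N ℕ.+ N) 1ℚ (- π) _ _) (lem₂ (h₂ (N ℕ.+ N)) π A))))))
    where
    lem₁ : ∀ r b π h → r * r * b - (1ℚ * (r * r) + - π * (r * r * h)) ≡ r * r * (b - (1ℚ - π * h))
    lem₁ = solve-∀ ringℚ
    lem₂ : ∀ h π a → 1ℚ * h + - π * a ≡ h - π * a
    lem₂ = solve-∀ ringℚ
    f : ℕ → ℚ
    f j = sgn j * choose p (suc j) * ρ j
    f≡ : ∀ j → f j ≡ π * (ρ j * ρ j * β j)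
    f≡ j = linear₁ (- ρ j) (coefficient-suc j) (lem₄ (sgn j) (choose p (suc j)) (ρ j) (β j) π)
      where
      lem₄ : ∀ s c r b π → s * c * r - π * (r * r * b) ≡ - r * (- s * c - - (π * (r * b)))
      lem₄ = solve-∀ ringℚ
    last : f (N ℕ.+ N) ≡ ρ (N ℕ.+ N)
    last = linear₁ (- ρ (N ℕ.+ N)) coefficient-p (lem₅ (sgn (N ℕ.+ N)) (choose p p) (ρ (N ℕ.+ N)))
      where
      lem₅ : ∀ s c r → s * c * r - r ≡ - r * (- s * c - - 1ℚ)
      lem₅ = solve-∀ ringℚ
    exact : H (N ℕ.+ N) ≡ π * Σ< (N ℕ.+ N) (λ j → ρ j * ρ j * β j)
    exact = trans
      (linear₂ (- 1ℚ) (alternating-reciprocals p) 1ℚ last (lem₆ (H (N ℕ.+ N)) (Σ< (N ℕ.+ N) f) (f (N ℕ.+ N)) (ρ (N ℕ.+ N))))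
      (trans (Σ-ext (N ℕ.+ N) f≡) (Σ-* (N ℕ.+ N) π _))
      where
      lem₆ : ∀ h s l r → h - s ≡ - 1ℚ * (s + l - (h + r)) + 1ℚ * (l - r)
      lem₆ = solve-∀ ringℚ

  6h₂ : # 6 * h₂ N ≈ - (# 7 * (π * h₃ N)) mod π²
  6h₂ = ≈-linear₂ (Integral-neg (Integral-# 4)) h₂-halves (Integral-# 1) h₂-parities (lem (h₂ (N ℕ.+ N)) (h₂ N) (h₃ N) π)
    where
    lem : ∀ f h k π → # 6 * h - - (# 7 * (π * k)) ≡ - # 4 * (f - (# 2 * h + # 2 * π * k)) + # 1 * (# 4 * f - (# 2 * h + π * k))
    lem = solve-∀ ringℚ

  3h₂-full : # 3 * h₂ (N ℕ.+ N) ≈ - (π * h₃ N) mod π²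
  3h₂-full = ≈-linear₂ (Integral-# 3) h₂-halves (Integral-# 1) 6h₂ (lem (h₂ (N ℕ.+ N)) (h₂ N) (h₃ N) π)
    where
    lem : ∀ f h k π → # 3 * f - - (π * k) ≡ # 3 * (f - (# 2 * h + # 2 * π * k)) + # 1 * (# 6 * h - - (# 7 * (π * k)))
    lem = solve-∀ ringℚ

  -- Comparing the two expressions for H_{p-1} gives 2A ≡ -h₃ modulo p. The factors π stay in place
  -- on both sides and in the modulus, which avoids cancelling them.
  2A : π * (π * (# 2 * A)) ≈ - (π * (π * h₃ N)) mod π³
  2A = ≈-linear₃ (Integral-neg (Integral-# 2)) h₂-πA (Integral-neg (Integral-# 1)) 2H-full (Integral-# 1) (≈-scale π 3h₂-full)
      (lem (h₂ (N ℕ.+ N)) (h₃ N) A (H (N ℕ.+ N)) π)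
    where
    lem : ∀ f k a h π → π * (π * (# 2 * a)) - - (π * (π * k))
        ≡ - # 2 * (π * (f - π * a) - h) + - # 1 * (# 2 * h - - (π * f)) + # 1 * (π * (# 3 * f) - π * - (π * k))
    lem = solve-∀ ringℚ

  E-Y : # 4 * (E - Y) ≈ # 6 * A + h₃ N mod π
  E-Y = ≈-linear₂ (Integral-neg (Integral-# 1)) A-parities (Integral-# 2) A-halves (lem A E Y (h₃ N))
    where
    lem : ∀ a e y k → # 4 * (e - y) - (# 6 * a + k) ≡ - # 1 * (# 8 * a - (# 4 * e + 1ℚ * k)) + # 2 * (a - (# 2 * y + 1ℚ * k))
    lem = solve-∀ ringℚ

  4[E-Y] : π * (π * (# 4 * (E - Y))) ≈ - (# 2 * (π * (π * h₃ N))) mod π³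
  4[E-Y] = ≈-linear₂ (Integral-# 1) (≈-scale π (≈-scale π E-Y)) (Integral-# 3) 2A (lem A E Y (h₃ N) π)
    where
    lem : ∀ a e y k π → π * (π * (# 4 * (e - y))) - - (# 2 * (π * (π * k)))
        ≡ # 1 * (π * (π * (# 4 * (e - y))) - π * (π * (# 6 * a + k))) + # 3 * (π * (π * (# 2 * a)) - - (π * (π * k)))
    lem = solve-∀ ringℚ

  private
    ¼ : ℚ
    ¼ = ½ * ½

    Integral-¼ : Integral ¼
    Integral-¼ = Integral-* Integral-½ Integral-½

  -- The sum of the interpolation weights

  nodeWeight-middle : ℚ
  nodeWeight-middle = Σ< (N ℕ.+ N) (λ j → - (ρ j * β j * node N (suc j) ⁻¹))

  -- The end nodes p and -p have coefficients 1 and -1, so each contributes 1/p; all other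
  -- coefficients are divisible by p.
  π*nodeWeight : π * nodeWeight N ≡ # 2 + π * (π * nodeWeight-middle)
  π*nodeWeight = begin
    π * (Σ< (suc (N ℕ.+ N)) g + g p)
      ≡⟨ cong (λ s → π * (s + g p)) (Σ-shift (N ℕ.+ N) g) ⟩
    π * (g 0 + Σ< (N ℕ.+ N) (g ∘ suc) + g p)
      ≡⟨ lem₁ π (g 0) (Σ< (N ℕ.+ N) (g ∘ suc)) (g p) ⟩
    π * g 0 + π * g p + π * Σ< (N ℕ.+ N) (g ∘ suc)
      ≡⟨ cong₂ _+_ (cong₂ _+_ first last) (cong (π *_) (trans (Σ-ext (N ℕ.+ N) middle) (Σ-* (N ℕ.+ N) π _))) ⟩
    1ℚ + 1ℚ + π * (π * nodeWeight-middle) ∎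
    where
    g : ℕ → ℚ
    g i = coefficient i * node N i ⁻¹
    lem₁ : ∀ π a b c → π * (a + b + c) ≡ π * a + π * c + π * b
    lem₁ = solve-∀ ringℚ
    inverse : ∀ i → node N i * node N i ⁻¹ ≡ 1ℚ
    inverse i = ⁻¹-inverse (node≢0 N i)
    first : π * g 0 ≡ 1ℚ
    first = linear₂ (π * node N 0 ⁻¹) (choose-0 p) 1ℚ (inverse 0) (lem (choose p 0) π (node N 0 ⁻¹))
      where
      lem : ∀ c π y → π * (1ℚ * c * y) - 1ℚ ≡ π * y * (c - 1ℚ) + 1ℚ * ((π - # 2 * # 0) * y - 1ℚ)
      lem = solve-∀ ringℚ
    last : π * g p ≡ 1ℚ
    last = linear₂ (π * node N p ⁻¹) coefficient-p 1ℚ (inverse p) (lem (coefficient p) π (node N p ⁻¹))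
      where
      lem : ∀ c π y → π * (c * y) - 1ℚ ≡ π * y * (c - - 1ℚ) + 1ℚ * ((π - # 2 * π) * y - 1ℚ)
      lem = solve-∀ ringℚ
    middle : ∀ j → g (suc j) ≡ π * - (ρ j * β j * node N (suc j) ⁻¹)
    middle j = trans (cong (_* node N (suc j) ⁻¹) (coefficient-suc j)) (lem π (ρ j) (β j) (node N (suc j) ⁻¹))
      where
      lem : ∀ π r b y → - (π * (r * b)) * y ≡ π * - (r * b * y)
      lem = solve-∀ ringℚ

  node-inverse : ∀ {j} → j ℕ.< N ℕ.+ N →
                 node N (suc j) ⁻¹ ≈ - (½ * ρ j) - π * (1ℚ * (- (½ * ρ j) * - (½ * ρ j))) mod π²
  node-inverse {j} j< = inverse-expand (Unit-neg (Unit-* Unit-2 (Unit-small j<))) Integral-1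
      (trans (lem₁ (# (suc j)) (ρ j)) (suc-inverse j)) (lem₂ π (# (suc j)))
    where
    lem₁ : ∀ k r → - (# 2 * k) * - (½ * r) ≡ k * r
    lem₁ = solve-∀ ringℚ
    lem₂ : ∀ π k → π - # 2 * k ≡ - (# 2 * k) + π * 1ℚ
    lem₂ = solve-∀ ringℚ

  nodeWeight-middle-expand : nodeWeight-middle ≈ ½ * (h₂ (N ℕ.+ N) - π * A) mod π²
  nodeWeight-middle-expand = ≈-trans (≈-Σ (N ℕ.+ N) term)
    (≈-trans (≈-reflexive (trans (Σ-+ (N ℕ.+ N) _ _) (cong₂ _+_ (Σ-linear (N ℕ.+ N) ½ (- (½ * π)) _ _) (Σ-* (N ℕ.+ N) (¼ * π) _))))
      (≈-linear₁ Integral-¼ (≈-scale π h₃-full) (lem (h₂ (N ℕ.+ N)) (h₃ (N ℕ.+ N)) A π)))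
    where
    lem : ∀ h k a π → ½ * h + - (½ * π) * a + ½ * ½ * π * k - ½ * (h - π * a) ≡ ½ * ½ * (π * k - π * 0ℚ)
    lem = solve-∀ ringℚ
    term : ∀ j → j ℕ.< N ℕ.+ N → - (ρ j * β j * node N (suc j) ⁻¹)
         ≈ ½ * (ρ j * ρ j) + - (½ * π) * (ρ j * ρ j * H j) + ¼ * π * (ρ j * ρ j * ρ j) mod π²
    term j j< = ≈-trans
      (≈-linear₂ (Integral-neg (Integral-* Ir Iy)) (β-expand (ℕ.<⇒≤ j<))
                 (Integral-neg (Integral-* Ir (Integral-minus Integral-1 (Integral-* Integral-π Ih)))) (node-inverse j<)
                 (lem₁ (ρ j) (β j) (1ℚ - π * H j) (node N (suc j) ⁻¹) (- (½ * ρ j) - π * (1ℚ * (- (½ * ρ j) * - (½ * ρ j))))))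
      (congruent (Integral-neg (Integral-* Integral-¼ (Integral-* (Integral-* (Integral-* Ir Ir) Ir) Ih))) (lem₂ π (ρ j) (H j)))
      where
      Ir = Integral-ρ j<
      Ih = Integral-H (ℕ.<⇒≤ j<)
      Iy : Integral (node N (suc j) ⁻¹)
      Iy = ≈-Integral (Integral-* Integral-π Integral-π)
             (Integral-minus (Integral-neg I½r) (Integral-* Integral-π (Integral-* Integral-1 (Integral-* (Integral-neg I½r) (Integral-neg I½r)))))
             (node-inverse j<)
        where
        I½r = Integral-* Integral-½ Ir
      lem₁ : ∀ r b b′ y y′ → - (r * b * y) - - (r * b′ * y′) ≡ - (r * y) * (b - b′) + - (r * b′) * (y - y′)
      lem₁ = solve-∀ ringℚ
      lem₂ : ∀ π r h → - (r * (1ℚ - π * h) * (- (½ * r) - π * (1ℚ * (- (½ * r) * - (½ * r)))))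
           ≡ ½ * (r * r) + - (½ * π) * (r * r * h) + ½ * ½ * π * (r * r * r) + π * π * - (½ * ½ * (r * r * r * h))
      lem₂ = solve-∀ ringℚ

  -- A drops out: up to powers of p, the middle part is half of H_{p-1} by `h₂-πA`, which `2H-full`
  -- and `3h₂-full` convert into h₃. The denominators met are 2, 2 and 3, hence 12.
  12π*nodeWeight : # 12 * (π * nodeWeight N) ≈ # 24 + π * (π * (π * h₃ N)) mod π⁴
  12π*nodeWeight = ≈-trans
    (≈-linear₂ {c₂ = # 6} (Integral-# 12) (≈-trans (≈-reflexive π*nodeWeight) (≈-+ (≈-refl {a = # 2}) (≈-scale π (≈-scale π nodeWeight-middle-expand))))
               (Integral-# 6) (≈-scale π h₂-πA) (lem₁ (π * nodeWeight N) π (h₂ (N ℕ.+ N)) A (H (N ℕ.+ N))))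
    (≈-linear₂ {c₂ = - # 1} (Integral-# 3) (≈-scale π 2H-full) (Integral-neg (Integral-# 1)) (≈-scale π (≈-scale π 3h₂-full))
               (lem₂ π (h₂ (N ℕ.+ N)) (h₃ N) (H (N ℕ.+ N))))
    where
    lem₁ : ∀ w π f a h → # 12 * w - (# 24 + # 6 * (π * h))
         ≡ # 12 * (w - (# 2 + π * (π * (½ * (f - π * a))))) + # 6 * (π * (π * (f - π * a)) - π * h)
    lem₁ = solve-∀ ringℚ
    lem₂ : ∀ π f k h → # 24 + # 6 * (π * h) - (# 24 + π * (π * (π * k)))
         ≡ # 3 * (π * (# 2 * h) - π * - (π * f)) + - # 1 * (π * (π * (# 3 * f)) - π * (π * - (π * k)))
    lem₂ = solve-∀ ringℚ

  -- The sum of the denominators at the nodes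

  evenNode : ℕ → ℚ
  evenNode r = π - # 4 * # r

  node-double : ∀ r → node N (r ℕ.+ r) ≡ evenNode r
  node-double r = linear₁ (- # 2) (#-double r) (lem π (# (r ℕ.+ r)) (# r))
    where
    lem : ∀ π k r → π - # 2 * k - (π - # 4 * r) ≡ - # 2 * (k - # 2 * r)
    lem = solve-∀ ringℚ

  value : ℕ → ℚ
  value r = denominator N (evenNode r * evenNode r)

  -- The terms i and p - i agree, and exactly one of the two indices is even. The even ones have
  -- nodes p - 4r, spaced by 4, so `denominator-step` relates neighbouring terms.
  nodeSum-even : nodeSum N ≡ # 2 * Σ< (suc N) (λ r → choose p (r ℕ.+ r) * value r)
  nodeSum-even = begin
    Σ< (suc p) f
      ≡⟨ cong (λ n → Σ< n f) (cong suc (sym (ℕ.+-suc N N))) ⟩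
    Σ< (suc N ℕ.+ suc N) f
      ≡⟨ Σ-parity (suc N) f ⟩
    Σ< (suc N) (λ r → f (r ℕ.+ r)) + Σ< (suc N) (λ r → f (suc (r ℕ.+ r)))
      ≡⟨ cong₂ _+_ (Σ-ext (suc N) even) (trans (Σ-reverse (suc N) (λ r → f (suc (r ℕ.+ r)))) (Σ-cong (suc N) odd-reversed)) ⟩
    s + s
      ≡⟨ lem s ⟩
    # 2 * s ∎
    where
    f : ℕ → ℚ
    f i = choose p i * denominator N (node N i * node N i)
    s = Σ< (suc N) (λ r → choose p (r ℕ.+ r) * value r)
    lem : ∀ s → s + s ≡ # 2 * s
    lem = solve-∀ ringℚ
    even : ∀ r → f (r ℕ.+ r) ≡ choose p (r ℕ.+ r) * value r
    even r = cong (λ x → choose p (r ℕ.+ r) * denominator N (x * x)) (node-double r)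
    odd-reversed : ∀ r → r ℕ.< suc N → f (suc ((N ∸ r) ℕ.+ (N ∸ r))) ≡ choose p (r ℕ.+ r) * value r
    odd-reversed r (s≤s r≤N) = cong₂ _*_ (sym choose-sym) (cong (denominator N) squares)
      where
      m = N ∸ r
      i = suc (m ℕ.+ m)
      r+m : r ℕ.+ m ≡ N
      r+m = ℕ.m+[n∸m]≡n r≤N
      sum : r ℕ.+ r ℕ.+ i ≡ p
      sum = begin
        r ℕ.+ r ℕ.+ suc (m ℕ.+ m)       ≡⟨ ℕ.+-suc (r ℕ.+ r) (m ℕ.+ m) ⟩
        suc (r ℕ.+ r ℕ.+ (m ℕ.+ m))     ≡⟨ cong suc (ℕ.+-assoc r r (m ℕ.+ m)) ⟩
        suc (r ℕ.+ (r ℕ.+ (m ℕ.+ m)))   ≡⟨ cong (λ x → suc (r ℕ.+ x)) (sym (ℕ.+-assoc r m m)) ⟩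
        suc (r ℕ.+ (r ℕ.+ m ℕ.+ m))     ≡⟨ cong (λ x → suc (r ℕ.+ (x ℕ.+ m))) r+m ⟩
        suc (r ℕ.+ (N ℕ.+ m))           ≡⟨ cong (λ x → suc (r ℕ.+ x)) (ℕ.+-comm N m) ⟩
        suc (r ℕ.+ (m ℕ.+ N))           ≡⟨ cong suc (sym (ℕ.+-assoc r m N)) ⟩
        suc (r ℕ.+ m ℕ.+ N)             ≡⟨ cong (λ x → suc (x ℕ.+ N)) r+m ⟩
        p ∎
      choose-sym : choose p (r ℕ.+ r) ≡ choose p i
      choose-sym = cong #_ (trans
        (nCk≡nC[n∸k] {r ℕ.+ r} {p} (ℕ.≤-trans (ℕ.m≤m+n (r ℕ.+ r) i) (ℕ.≤-reflexive sum)))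
        (cong (p C_) (trans (cong (_∸ (r ℕ.+ r)) (sym sum)) (ℕ.m+n∸m≡n (r ℕ.+ r) i))))
      opposite : node N i ≡ - evenNode r
      opposite = linear₃ (# 2) (cong #_ (sym sum)) (# 2) (#-+ (r ℕ.+ r) i) (# 2) (#-double r)
          (lem₁ π (# i) (# (r ℕ.+ r)) (# r) (# (r ℕ.+ r ℕ.+ i)))
        where
        lem₁ : ∀ π i k r t → π - # 2 * i - - (π - # 4 * r) ≡ # 2 * (π - t) + # 2 * (t - (k + i)) + # 2 * (k - # 2 * r)
        lem₁ = solve-∀ ringℚ
      squares : node N i * node N i ≡ evenNode r * evenNode r
      squares = trans (cong (λ x → x * x) opposite) (lem₂ (evenNode r))
        where
        lem₂ : ∀ x → - x * - x ≡ x * x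
        lem₂ = solve-∀ ringℚ

  -- The coefficient -(4N + 4 + x) of `denominator-step` at x = p - 4(r+1), rewritten with 4N = 2p -
  -- 2. The other coefficient 4N - x exceeds it by 4p, so the ratio of the two is 1 modulo p.
  pole : ℕ → ℚ
  pole r = # 2 * # (suc (r ℕ.+ r)) + π * - # 3

  evenNode-suc : ∀ r → evenNode (suc r) ≡ evenNode r - # 4
  evenNode-suc r = linear₁ (- # 4) (#-suc r) (lem π (# r) (# (suc r)))
    where
    lem : ∀ π r s → π - # 4 * s - (π - # 4 * r - # 4) ≡ - # 4 * (s - (1ℚ + r))
    lem = solve-∀ ringℚ

  value-step : ∀ r → pole r * (evenNode (suc r) * value (suc r)) ≡ (pole r + # 4 * π) * (evenNode r * value r)
  value-step r = subst (λ w → pole r * (w * denominator N (w * w)) ≡ (pole r + # 4 * π) * (evenNode r * value r))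
    (sym (evenNode-suc r))
    (linear₃ (- 1ℚ) step (- # 2 * (a + b)) (#p N) (# 2 * (a - b))
       (trans (#-suc (r ℕ.+ r)) (cong (λ u → 1ℚ + u) (#-double r)))
       (lem π (# N) (# r) (# (suc (r ℕ.+ r))) a b))
    where
    x = evenNode r - # 4
    a = x * denominator N (x * x)
    b = evenNode r * value r
    lem₀ : ∀ y → y - # 4 + # 4 ≡ y
    lem₀ = solve-∀ ringℚ
    step : (# 4 * # N - x) * b ≡ - (# 4 * # N + # 4 + x) * a
    step = subst (λ w → (# 4 * # N - x) * (w * denominator N (w * w)) ≡ - (# 4 * # N + # 4 + x) * a)
      (lem₀ (evenNode r)) (denominator-step N x)
    lem : ∀ π n r k a b → (# 2 * k + π * - # 3) * a - (# 2 * k + π * - # 3 + # 4 * π) * b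
        ≡ - 1ℚ * ((# 4 * n - (π - # 4 * r - # 4)) * b - - (# 4 * n + # 4 + (π - # 4 * r - # 4)) * a)
          + - # 2 * (a + b) * (π - (# 2 * n + 1ℚ)) + # 2 * (a - b) * (k - (1ℚ + # 2 * r))
    lem = solve-∀ ringℚ

  Unit-oddnumber : ∀ {r} → r ℕ.< N → Unit (# (suc (r ℕ.+ r)))
  Unit-oddnumber r<N = Unit-small (ℕ.<-trans (ℕ.n<1+n _) (r<N⇒2r+1<2N r<N))

  Unit-2*odd : ∀ {r} → r ℕ.< N → Unit (# 2 * # (suc (r ℕ.+ r)))
  Unit-2*odd r<N = Unit-* Unit-2 (Unit-oddnumber r<N)

  Unit-pole : ∀ {r} → r ℕ.< N → Unit (pole r)
  Unit-pole r<N = Unit-+p* (Unit-2*odd r<N) (Integral-neg (Integral-# 3))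

  -- The factor by which x times `denominator` changes as x goes from p to p - 4r.
  growth : ℕ → ℚ
  growth zero    = 1ℚ
  growth (suc r) = growth r * (1ℚ + # 4 * π * pole r ⁻¹)

  Integral-growth : ∀ {r} → r ℕ.≤ N → Integral (growth r)
  Integral-growth {zero}  _   = Integral-1
  Integral-growth {suc r} r<N = Integral-* (Integral-growth (ℕ.<⇒≤ r<N))
    (Integral-+ Integral-1 (Integral-* (Integral-* (Integral-# 4) Integral-π) (Integral-⁻¹ (Unit-pole r<N))))

  value-growth : ∀ r → r ℕ.≤ N → evenNode r * value r ≡ evenNode 0 * value 0 * growth r
  value-growth zero    _   = sym (ℚ.*-identityʳ _)
  value-growth (suc r) r<N = *-cancelˡ (Unit⇒≢0 (Unit-pole r<N)) (trans (value-step r)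
    (linear₂ (pole r + # 4 * π) (value-growth r (ℕ.<⇒≤ r<N)) (- (# 4 * π * c * growth r)) (Unit-inverse (Unit-pole r<N))
      (lem (pole r) (pole r ⁻¹) π (evenNode r * value r) c (growth r))))
    where
    c = evenNode 0 * value 0
    lem : ∀ q y π b c g → (q + # 4 * π) * b - q * (c * (g * (1ℚ + # 4 * π * y)))
        ≡ (q + # 4 * π) * (b - c * g) + - (# 4 * π * c * g) * (q * y - 1ℚ)
    lem = solve-∀ ringℚ

  oddHarmonic : ℕ → ℚ
  oddHarmonic r = Σ< r (λ j → ρ (j ℕ.+ j))

  Integral-oddHarmonic : ∀ {r} → r ℕ.≤ N → Integral (oddHarmonic r)
  Integral-oddHarmonic {r} r≤N = Integral-Σ r (λ j j<r → Integral-⁻¹ (Unit-oddnumber (ℕ.<-≤-trans j<r r≤N)))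

  -- The even numbers up to 2r + 1 contribute half of H_r.
  oddHarmonic-suc : ∀ r → oddHarmonic (suc r) ≡ H (suc (r ℕ.+ r)) - ½ * H r
  oddHarmonic-suc zero    = refl
  oddHarmonic-suc (suc r) = begin
    oddHarmonic (suc r) + ρ (suc r ℕ.+ suc r)
      ≡⟨ linear₂ 1ℚ (oddHarmonic-suc r) (- 1ℚ) (ρ-double r)
           (lem (oddHarmonic (suc r)) (H (suc (r ℕ.+ r))) (H r) (ρ r) (ρ (suc (r ℕ.+ r))) (ρ (suc r ℕ.+ suc r))) ⟩
    H (suc (suc (r ℕ.+ r))) + ρ (suc r ℕ.+ suc r) - ½ * H (suc r)
      ≡⟨ cong (λ k → H (suc k) + ρ (suc r ℕ.+ suc r) - ½ * H (suc r)) (sym (ℕ.+-suc r r)) ⟩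
    H (suc r ℕ.+ suc r) + ρ (suc r ℕ.+ suc r) - ½ * H (suc r) ∎
    where
    lem : ∀ o h k r t u → o + u - (h + t + u - ½ * (k + r)) ≡ 1ℚ * (o - (h - ½ * k)) + - 1ℚ * (t - ½ * r)
    lem = solve-∀ ringℚ

  -- Each factor is 1 + 2p/(2j+1) modulo p², and products of first-order terms fall into p².
  growth-expand : ∀ {r} → r ℕ.≤ N → growth r ≈ 1ℚ + # 2 * (π * oddHarmonic r) mod π²
  growth-expand {zero}  _   = ≈-reflexive (lem π)
    where
    lem : ∀ π → 1ℚ ≡ 1ℚ + # 2 * (π * 0ℚ)
    lem = solve-∀ ringℚ
  growth-expand {suc r} r<N = ≈-trans
    (≈-linear₂ {c₂ = # 4 * g} (Integral-+ Integral-1 (Integral-* (Integral-* (Integral-# 4) Integral-π) (Integral-⁻¹ (Unit-pole r<N))))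
               (growth-expand (ℕ.<⇒≤ r<N)) (Integral-* (Integral-# 4) Ig) (≈-scale π pole-inverse)
               (lem₂ (growth r) g (pole r ⁻¹) (ρ (r ℕ.+ r)) π))
    (congruent (Integral-* (Integral-# 4) (Integral-* Io Iρ)) (lem₃ π (oddHarmonic r) (ρ (r ℕ.+ r))))
    where
    g = 1ℚ + # 2 * (π * oddHarmonic r)
    Io = Integral-oddHarmonic (ℕ.<⇒≤ r<N)
    Iρ = Integral-⁻¹ (Unit-oddnumber r<N)
    Ig : Integral g
    Ig = Integral-+ Integral-1 (Integral-* (Integral-# 2) (Integral-* Integral-π Io))
    lem₁ : ∀ k r → # 2 * k * (½ * r) ≡ k * r
    lem₁ = solve-∀ ringℚ
    pole-inverse : pole r ⁻¹ ≈ ½ * ρ (r ℕ.+ r) mod π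
    pole-inverse = inverse-expand₁ (Unit-2*odd r<N) (Integral-neg (Integral-# 3))
      (trans (lem₁ (# (suc (r ℕ.+ r))) (ρ (r ℕ.+ r))) (suc-inverse (r ℕ.+ r))) refl
    lem₂ : ∀ G g y ρ π → G * (1ℚ + # 4 * π * y) - g * (1ℚ + # 2 * (π * ρ))
         ≡ (1ℚ + # 4 * π * y) * (G - g) + # 4 * g * (π * y - π * (½ * ρ))
    lem₂ = solve-∀ ringℚ
    lem₃ : ∀ π o ρ → (1ℚ + # 2 * (π * o)) * (1ℚ + # 2 * (π * ρ)) ≡ 1ℚ + # 2 * (π * (o + ρ)) + π * π * (# 4 * (o * ρ))
    lem₃ = solve-∀ ringℚ

  1/16 : ℚ
  1/16 = ½ * (½ * (½ * ½))

  -- In the notation of the overview, `ratio N` is Q(p), the contribution of an end node.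
  ratio : ℕ → ℚ
  ratio zero    = 1ℚ
  ratio (suc n) = ratio n * (1ℚ - 1/16 * (π * (π * (ρ n * ρ n))))

  ratio-exact : ∀ n → denominator n (π * π) ≡ denominator n 0ℚ * ratio n
  ratio-exact zero    = refl
  ratio-exact (suc n) = linear₂ (factor n (π * π)) (ratio-exact n)
      (# 2 * (1ℚ + # n) * (π * π) * (1ℚ + (1ℚ + # n) * ρ n) * denominator n 0ℚ * ratio n)
      (trans (cong (_* ρ n) (sym (#-suc n))) (suc-inverse n))
      (lem (# n) (ρ n) π (denominator n (π * π)) (denominator n 0ℚ) (ratio n))
    where
    lem : ∀ v r π d d₀ q →
        # 2 * (1ℚ + v) * (# 16 * ((1ℚ + v) * (1ℚ + v)) - π * π) * d
        - # 2 * (1ℚ + v) * (# 16 * ((1ℚ + v) * (1ℚ + v)) - 0ℚ) * d₀ * (q * (1ℚ - 1/16 * (π * (π * (r * r)))))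
      ≡ # 2 * (1ℚ + v) * (# 16 * ((1ℚ + v) * (1ℚ + v)) - π * π) * (d - d₀ * q)
        + # 2 * (1ℚ + v) * (π * π) * (1ℚ + (1ℚ + v) * r) * d₀ * q * ((1ℚ + v) * r - 1ℚ)
    lem = solve-∀ ringℚ

  Integral-1/16 : Integral 1/16
  Integral-1/16 = Integral-* Integral-½ (Integral-* Integral-½ (Integral-* Integral-½ Integral-½))

  Integral-h₂ : ∀ {n} → n ℕ.≤ N ℕ.+ N → Integral (h₂ n)
  Integral-h₂ {n} n≤ = Integral-Σ n (λ j j<n → let I = Integral-ρ (ℕ.<-≤-trans j<n n≤) in Integral-* I I)

  ratio-expand : ∀ {n} → n ℕ.≤ N → ratio n ≈ 1ℚ - 1/16 * (π * (π * h₂ n)) mod π⁴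
  ratio-expand {zero}  _   = ≈-reflexive (lem π)
    where
    lem : ∀ π → 1ℚ ≡ 1ℚ - 1/16 * (π * (π * 0ℚ))
    lem = solve-∀ ringℚ
  ratio-expand {suc n} n<N = ≈-trans
    (≈-linear₁ {c = 1ℚ - 1/16 * (π * (π * (ρ n * ρ n)))}
      (Integral-minus Integral-1 (Integral-* Integral-1/16 (Integral-* Integral-π (Integral-* Integral-π (Integral-* Iρ Iρ)))))
      (ratio-expand (ℕ.<⇒≤ n<N)) (lem₁ (ratio n) (1ℚ - 1/16 * (π * (π * h₂ n))) (1ℚ - 1/16 * (π * (π * (ρ n * ρ n))))))
    (congruent (Integral-* (Integral-* Integral-1/16 Integral-1/16) (Integral-* (Integral-h₂ (ℕ.<⇒≤ (j<N⇒j<2N n<N))) (Integral-* Iρ Iρ)))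
      (lem₂ π (h₂ n) (ρ n)))
    where
    Iρ = Integral-ρ (j<N⇒j<2N n<N)
    lem₁ : ∀ q q′ t → q * t - q′ * t ≡ t * (q - q′)
    lem₁ = solve-∀ ringℚ
    lem₂ : ∀ π h r → (1ℚ - 1/16 * (π * (π * h))) * (1ℚ - 1/16 * (π * (π * (r * r))))
         ≡ 1ℚ - 1/16 * (π * (π * (h + r * r)))
           + π * (π * (π * π)) * (1/16 * 1/16 * (h * (r * r)))
    lem₂ = solve-∀ ringℚ

  value-0 : value 0 ≡ denominator N 0ℚ * ratio N
  value-0 = trans (cong (λ x → denominator N (x * x)) (lem π)) (ratio-exact N)
    where
    lem : ∀ π → π - # 4 * # 0 ≡ π
    lem = solve-∀ ringℚ

  -- The negative of `evenNode (suc r)`, in the shape of a unit plus a multiple of p.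
  offset : ℕ → ℚ
  offset r = # 4 * # (suc r) + π * - 1ℚ

  Unit-4* : ∀ {r} → r ℕ.< N → Unit (# 4 * # (suc r))
  Unit-4* r<N = Unit-* (Unit-* {# 2} {# 2} Unit-2 Unit-2) (Unit-small (j<N⇒j<2N r<N))

  Unit-offset : ∀ {r} → r ℕ.< N → Unit (offset r)
  Unit-offset r<N = Unit-+p* (Unit-4* r<N) (Integral-neg Integral-1)

  -- choose p (2r+2) * value (r+1) is divisible by p²: one factor from each.
  core : ℕ → ℚ
  core r = ½ * ρ r * β (suc (r ℕ.+ r)) * ratio N * (growth (suc r) * offset r ⁻¹)

  term-exact : ∀ {r} → r ℕ.< N →
    choose p (suc r ℕ.+ suc r) * value (suc r) ≡ denominator N 0ℚ * (π * (π * core r))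
  term-exact {r} r<N = begin
    choose p (suc r ℕ.+ suc r) * value (suc r)
      ≡⟨ cong₂ _*_ choose≡ value≡ ⟩
    - (π * (½ * ρ r * b)) * (- (π * (D * ratio N)) * (g * y))
      ≡⟨ lem₃ π (ρ r) b D (ratio N) (g * y) ⟩
    D * (π * (π * core r)) ∎
    where
    D = denominator N 0ℚ
    b = β (suc (r ℕ.+ r))
    g = growth (suc r)
    y = offset r ⁻¹
    lem₁ : ∀ c → c ≡ 1ℚ * c
    lem₁ = solve-∀ ringℚ
    choose≡ : choose p (suc r ℕ.+ suc r) ≡ - (π * (½ * ρ r * b))
    choose≡ = begin
      choose p (suc r ℕ.+ suc r)
        ≡⟨ lem₁ (choose p (suc r ℕ.+ suc r)) ⟩
      1ℚ * choose p (suc r ℕ.+ suc r)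
        ≡⟨ cong (_* choose p (suc r ℕ.+ suc r)) (sym (sgn-double (suc r))) ⟩
      coefficient (suc r ℕ.+ suc r)
        ≡⟨ cong (λ k → coefficient (suc k)) (ℕ.+-suc r r) ⟩
      coefficient (suc (suc (r ℕ.+ r)))
        ≡⟨ coefficient-suc (suc (r ℕ.+ r)) ⟩
      - (π * (ρ (suc (r ℕ.+ r)) * b))
        ≡⟨ cong (λ t → - (π * (t * b))) (ρ-double r) ⟩
      - (π * (½ * ρ r * b)) ∎
    lem₂ : ∀ v y π k g D q d₀ → v - - (π * (D * q)) * (g * y)
         ≡ - v * ((# 4 * k + π * - 1ℚ) * y - 1ℚ)
           + - y * ((π - # 4 * k) * v - (π - # 4 * # 0) * d₀ * g)
           + - (π * g * y) * (d₀ - D * q)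
    lem₂ = solve-∀ ringℚ
    value≡ : value (suc r) ≡ - (π * (D * ratio N)) * (g * y)
    -- Divides `value-growth` by the node, which is minus `offset`. The factor `evenNode 0` is p and
    -- supplies the second p of the term.
    value≡ = linear₃ (- value (suc r)) (Unit-inverse (Unit-offset r<N)) (- y) (value-growth (suc r) r<N)
      (- (π * g * y)) value-0 (lem₂ (value (suc r)) y π (# (suc r)) g D (ratio N) (value 0))
    lem₃ : ∀ π r b D q z → - (π * (½ * r * b)) * (- (π * (D * q)) * z) ≡ D * (π * (π * (½ * r * b * q * z)))
    lem₃ = solve-∀ ringℚ

  offset-inverse : ∀ {r} → r ℕ.< N → offset r ⁻¹ ≈ ½ * ½ * ρ r - π * (- 1ℚ * (½ * ½ * ρ r * (½ * ½ * ρ r))) mod π²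
  offset-inverse {r} r<N = inverse-expand (Unit-4* r<N) (Integral-neg Integral-1)
      (trans (lem (# (suc r)) (ρ r)) (suc-inverse r)) refl
    where
    lem : ∀ k r → # 4 * k * (½ * ½ * r) ≡ k * r
    lem = solve-∀ ringℚ

  ratio-1 : ratio N ≈ 1ℚ mod π²
  ratio-1 = ≈-trans (≈-weaken (π * π) (Integral-* Integral-π Integral-π) (subst (λ q → ratio N ≈ 1ℚ - 1/16 * (π * (π * h₂ N)) mod q) (lem₁ π) (ratio-expand ℕ.≤-refl)))
    (congruent (Integral-neg (Integral-* Integral-1/16 (Integral-h₂ (ℕ.m≤m+n N N)))) (lem₂ π (h₂ N)))
    where
    lem₁ : ∀ π → π * (π * (π * π)) ≡ π * π * (π * π)
    lem₁ = solve-∀ ringℚ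
    lem₂ : ∀ π h → 1ℚ - 1/16 * (π * (π * h)) ≡ 1ℚ + π * π * - (1/16 * h)
    lem₂ = solve-∀ ringℚ

  -- The first-order parts of `β` and `growth` combine to 2 oddHarmonic(r+1) - H(2r+1) = H(2r+1) -
  -- H(r), which is why E and Y enter only through E - Y. The 32 clears 1/2 from ρ at the doubled
  -- index and twice 1/4 from the expanded inverse of `offset`.
  core-expand : ∀ {r} → r ℕ.< N → # 32 * core r ≈
    # 4 * (ρ r * ρ r) + # 4 * π * (ρ r * ρ r * H (suc (r ℕ.+ r)))
    + (- (# 4 * π) * (ρ r * ρ r * H r) + π * (ρ r * ρ r * ρ r)) mod π²
  core-expand {r} r<N = ≈-trans
    (≈-*ˡ (Integral-# 32)
      (≈-* (Integral-* (Integral-* I½r Iβ) Iq) (Integral-* Ig′ Iw′)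
        (≈-* (Integral-* I½r Iβ) Integral-1 (≈-*ˡ I½r (β-expand (ℕ.<⇒≤ (r<N⇒2r+1<2N r<N)))) ratio-1)
        (≈-* (Integral-growth r<N) Iw′ (growth-expand r<N) (offset-inverse r<N))))
    (congruent (Integral-* (Integral-* Ir Ir) (Integral-+ (Integral-+
        (Integral-neg (Integral-* (Integral-# 8) (Integral-* Ih Io))) (Integral-neg (Integral-* Ih Ir)))
        (Integral-* (Integral-# 2) (Integral-* Io (Integral-minus Ir (Integral-* Integral-π (Integral-* Ih Ir)))))))
      (linear₁ (# 8 * π * (ρ r * ρ r)) (oddHarmonic-suc r) (lem π (ρ r) (H (suc (r ℕ.+ r))) (H r) (oddHarmonic (suc r)))))
    where
    Ir = Integral-ρ (j<N⇒j<2N r<N)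
    I½r = Integral-* Integral-½ Ir
    Iβ = Integral-β (ℕ.<⇒≤ (r<N⇒2r+1<2N r<N))
    Ih = Integral-H (ℕ.<⇒≤ (r<N⇒2r+1<2N r<N))
    Io = Integral-oddHarmonic r<N
    Iq : Integral (ratio N)
    Iq = ≈-Integral (Integral-* Integral-π Integral-π) Integral-1 ratio-1
    I¼r : Integral (½ * ½ * ρ r)
    I¼r = Integral-* (Integral-* Integral-½ Integral-½) Ir
    Ig′ = Integral-+ Integral-1 (Integral-* (Integral-# 2) (Integral-* Integral-π Io))
    Iw′ = Integral-minus I¼r (Integral-* Integral-π (Integral-* (Integral-neg Integral-1) (Integral-* I¼r I¼r)))
    lem : ∀ π r h k o →
        # 32 * (½ * r * (1ℚ - π * h) * 1ℚ * ((1ℚ + # 2 * (π * o)) * (½ * ½ * r - π * (- 1ℚ * (½ * ½ * r * (½ * ½ * r))))))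
        - (# 4 * (r * r) + # 4 * π * (r * r * h) + (- (# 4 * π) * (r * r * k) + π * (r * r * r))
           + π * π * (r * r * (- (# 8 * (h * o)) + - (h * r) + # 2 * (o * (r - π * (h * r))))))
      ≡ # 8 * π * (r * r) * (o - (h - ½ * k))
    lem = solve-∀ ringℚ

  -- Half of Σ C(p,i) Q(p-2i) over 0 ≤ i ≤ p.
  normalisedSum : ℚ
  normalisedSum = ratio N + π * (π * Σ< N core)

  nodeSum-normalised : nodeSum N ≡ # 2 * (denominator N 0ℚ * normalisedSum)
  nodeSum-normalised = trans nodeSum-even (cong (# 2 *_) (begin
    Σ< (suc N) f
      ≡⟨ Σ-shift N f ⟩
    choose p 0 * value 0 + Σ< N (f ∘ suc)
      ≡⟨ cong₂ _+_ (cong₂ _*_ (choose-0 p) value-0) (Σ-cong N (λ r r<N → term-exact r<N)) ⟩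
    1ℚ * (D * ratio N) + Σ< N (λ r → D * (π * (π * core r)))
      ≡⟨ cong (λ s → 1ℚ * (D * ratio N) + s) (trans (Σ-* N D _) (cong (D *_) (trans (Σ-* N π _) (cong (π *_) (Σ-* N π core))))) ⟩
    1ℚ * (D * ratio N) + D * (π * (π * Σ< N core))
      ≡⟨ lem D (ratio N) (π * (π * Σ< N core)) ⟩
    D * normalisedSum ∎))
    where
    D = denominator N 0ℚ
    f : ℕ → ℚ
    f r = choose p (r ℕ.+ r) * value r
    lem : ∀ D q s → 1ℚ * (D * q) + D * s ≡ D * (q + s)
    lem = solve-∀ ringℚ

  Σcore-expand : # 32 * Σ< N core ≈ # 4 * h₂ N + # 4 * π * E + (- (# 4 * π) * Y + π * h₃ N) mod π²
  Σcore-expand = ≈-trans (≈-reflexive (sym (Σ-* N (# 32) core)))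
    (≈-trans (≈-Σ N (λ r r<N → core-expand r<N))
      (≈-reflexive (trans (Σ-+ N _ _) (cong₂ _+_ (Σ-linear N (# 4) (# 4 * π) _ _) (Σ-linear N (- (# 4 * π)) π _ _)))))

  -- 32 (normalisedSum - 1) ≈ 2π² h₂ + 4π³ (E - Y) + π³ h₃, where E - Y and h₂ reduce to h₃.
  96normalisedSum : # 96 * normalisedSum ≈ # 96 - # 10 * (π * (π * (π * h₃ N))) mod π⁴
  96normalisedSum = ≈-trans
    (≈-linear₂ {c₂ = # 3} (Integral-# 96) (ratio-expand ℕ.≤-refl) (Integral-# 3) (≈-scale π (≈-scale π Σcore-expand))
      (lem₁ (ratio N) (Σ< N core) π (h₂ N) E Y (h₃ N)))
    (≈-linear₂ {c₁ = # 1} {c₂ = # 3} (Integral-# 1) (≈-scale π (≈-scale π 6h₂)) (Integral-# 3) (≈-scale π 4[E-Y])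
      (lem₂ π (h₂ N) E Y (h₃ N)))
    where
    lem₁ : ∀ q s π h e y k →
        # 96 * (q + π * (π * s)) - (# 96 + # 6 * (π * (π * h)) + # 12 * (π * (π * (π * (e - y)))) + # 3 * (π * (π * (π * k))))
      ≡ # 96 * (q - (1ℚ - 1/16 * (π * (π * h))))
        + # 3 * (π * (π * (# 32 * s)) - π * (π * (# 4 * h + # 4 * π * e + (- (# 4 * π) * y + π * k))))
    lem₁ = solve-∀ ringℚ
    lem₂ : ∀ π h e y k →
        # 96 + # 6 * (π * (π * h)) + # 12 * (π * (π * (π * (e - y)))) + # 3 * (π * (π * (π * k))) - (# 96 - # 10 * (π * (π * (π * k))))
      ≡ # 1 * (π * (π * (# 6 * h)) - π * (π * - (# 7 * (π * k)))) + # 3 * (π * (π * (π * (# 4 * (e - y)))) - π * - (# 2 * (π * (π * k))))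
    lem₂ = solve-∀ ringℚ

  -- Power sums, Bernoulli numbers and Fermat's theorem

  BernoulliCongruent : ℕ → Set
  BernoulliCongruent m = Integral (bernoulli m) × powerSum p m ≈ π * bernoulli m mod π²

  -- The two recurrences differ by p^(m+1), which p² divides for m ≥ 1, and their leading
  -- coefficient m + 1 < p is a unit. All j ≤ m are carried along because the recurrence uses every
  -- earlier index.
  bernoulli-congruent-upto : ∀ m → suc m ℕ.≤ N ℕ.+ N → ∀ j → j ℕ.≤ m → BernoulliCongruent j
  -- The term 0^0 = 1 is counted, so the power sum with exponent 0 is exactly p.
  bernoulli-congruent-upto zero _ zero z≤n = Integral-1 , ≈-reflexive (trans (Σ-1 p) (sym (ℚ.*-identityʳ π)))
  bernoulli-congruent-upto (suc n) n< j j≤ with ℕ.m≤n⇒m<n∨m≡n j≤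
  ... | inj₁ (s≤s j≤n) = bernoulli-congruent-upto n (ℕ.<⇒≤ n<) j j≤n
  ... | inj₂ refl = Integral-B , congruence
    where
    M = suc n
    c : ℕ → ℚ
    c = choose (suc M)
    S = Σ< M (λ k → c k * bernoulli k)
    S′ = Σ< M (λ k → c k * powerSum p k)
    previous : ∀ k → k ℕ.< M → BernoulliCongruent k
    previous k (s≤s k≤n) = bernoulli-congruent-upto n (ℕ.<⇒≤ n<) k k≤n
    Iρ = Integral-ρ n<
    Integral-S : Integral S
    Integral-S = Integral-Σ M (λ k k< → Integral-* (Integral-# (suc M C k)) (proj₁ (previous k k<)))
    Integral-B : Integral (bernoulli M)
    Integral-B = subst Integral (sym (linear₂ (- bernoulli M) (suc-inverse M) (ρ M) (bernoulli-suc n) (lem (bernoulli M) (ρ M) (# (suc M)) S)))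
                   (Integral-neg (Integral-* Iρ Integral-S))
      where
      lem : ∀ b r m s → b - - (r * s) ≡ - b * (m * r - 1ℚ) + r * (m * b - - s)
      lem = solve-∀ ringℚ
    S′-congruent : S′ ≈ π * S mod π²
    S′-congruent = ≈-trans (≈-Σ M (λ k k< → ≈-*ˡ (Integral-# (suc M C k)) (proj₂ (previous k k<))))
      (≈-reflexive (trans (Σ-ext M (λ k → lem (c k) π (bernoulli k))) (Σ-* M π _)))
      where
      lem : ∀ c π b → c * (π * b) ≡ π * (c * b)
      lem = solve-∀ ringℚ
    P = powerSum p M
    multiplied : # (suc M) * P ≈ - S′ mod π²
    multiplied = congruent (Integral-^ Integral-π n)
      (linear₂ 1ℚ (powerSum-recurrence M p) (- P) (choose-suc-n M) (lem (# (suc M)) P S′ (c M) π (π ^ℚ n)))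
      where
      lem : ∀ m P s c π y → m * P - (- s + π * π * y) ≡ 1ℚ * (s + c * P - π * (π * y)) + - P * (c - m)
      lem = solve-∀ ringℚ
    congruence : P ≈ π * bernoulli M mod π²
    congruence = ≈-linear₃ {c₁ = ρ M} {c₂ = - ρ M} Iρ multiplied (Integral-neg Iρ) S′-congruent Integral-1 (≈-reflexive exact)
        (lem₂ P (bernoulli M) (ρ M) (# (suc M)) S S′ π)
      where
      exact : P - π * bernoulli M ≡ ρ M * (# (suc M) * P + π * S)
      exact = linear₂ (- (P - π * bernoulli M)) (suc-inverse M) (- (π * ρ M)) (bernoulli-suc n)
          (lem₁ P (bernoulli M) (ρ M) (# (suc M)) S π)
        where
        lem₁ : ∀ P b r m s π → P - π * b - r * (m * P + π * s) ≡ - (P - π * b) * (m * r - 1ℚ) + - (π * r) * (m * b - - s)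
        lem₁ = solve-∀ ringℚ
      lem₂ : ∀ P b r m s s′ π → P - π * b
           ≡ r * (m * P - - s′) + - r * (s′ - π * s) + 1ℚ * (P - π * b - r * (m * P + π * s))
      lem₂ = solve-∀ ringℚ

  choose-p-divisible : ∀ {j} → j ℕ.< N ℕ.+ N → choose p (suc j) ≈ 0ℚ mod π
  choose-p-divisible {j} j< = congruent
    (Integral-neg (Integral-* (Integral-sgn (suc j)) (Integral-* (Integral-ρ j<) (Integral-β (ℕ.<⇒≤ j<)))))
    (linear₂ (sgn (suc j)) (coefficient-suc j) (- choose p (suc j)) (sgn² (suc j))
      (lem (choose p (suc j)) (sgn (suc j)) π (ρ j * β j)))
    where
    lem : ∀ c s π t → c - (0ℚ + π * - (s * t)) ≡ s * (s * c - - (π * t)) + - c * (s * s - 1ℚ)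
    lem = solve-∀ ringℚ

  fermat : ∀ k → # k ^ℚ p ≈ # k mod π
  fermat zero    = ≈-reflexive (ℚ.*-zeroˡ (# 0 ^ℚ (N ℕ.+ N)))
  fermat (suc k) = ≈-trans (≈-reflexive expanded)
    (≈-trans (≈-linear₂ {c₁ = # 1} {c₂ = # 1} (Integral-# 1) middle≈0 (Integral-# 1) (fermat k) (lem₁ middle (x ^ℚ p) x))
      (≈-reflexive (sym (#-suc k))))
    where
    x = # k
    t : ℕ → ℚ
    t j = choose p j * x ^ℚ j
    middle = Σ< (N ℕ.+ N) (t ∘ suc)
    middle≈0 : middle ≈ 0ℚ mod π
    middle≈0 = ≈-trans (≈-Σ (N ℕ.+ N) (λ j j< → ≈-linear₁ (Integral-^ (Integral-# k) (suc j)) (choose-p-divisible j<) (lem₂ (choose p (suc j)) (x ^ℚ suc j))))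
      (≈-reflexive (Σ-0 (N ℕ.+ N)))
      where
      lem₂ : ∀ c y → c * y - 0ℚ ≡ y * (c - 0ℚ)
      lem₂ = solve-∀ ringℚ
    lem₁ : ∀ m y x → 1ℚ + m + y - (1ℚ + x) ≡ # 1 * (m - 0ℚ) + # 1 * (y - x)
    lem₁ = solve-∀ ringℚ
    expanded : # (suc k) ^ℚ p ≡ 1ℚ + middle + x ^ℚ p
    expanded = begin
      # (suc k) ^ℚ p
        ≡⟨ cong (_^ℚ p) (#-suc k) ⟩
      (1ℚ + x) ^ℚ p
        ≡⟨ binomial p x ⟩
      Σ< p t + t p
        ≡⟨ cong₂ _+_ (Σ-shift (N ℕ.+ N) t) (trans (cong (_* x ^ℚ p) (choose-n p)) (ℚ.*-identityˡ (x ^ℚ p))) ⟩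
      t 0 + middle + x ^ℚ p
        ≡⟨ cong (λ c → c * 1ℚ + middle + x ^ℚ p) (choose-0 p) ⟩
      1ℚ + middle + x ^ℚ p ∎

  fermat-unit : ∀ {j} → j ℕ.< N ℕ.+ N → # (suc j) ^ℚ (N ℕ.+ N) ≈ 1ℚ mod π
  fermat-unit {j} j< = ≈-linear₂ {c₂ = 1ℚ} (Integral-ρ j<) (fermat (suc j)) Integral-1 (≈-reflexive exact)
      (lem₂ (# (suc j)) (ρ j) (# (suc j) ^ℚ (N ℕ.+ N)))
    where
    x = # (suc j)
    y = x ^ℚ (N ℕ.+ N)
    exact : y - 1ℚ ≡ ρ j * (x * y - x)
    exact = linear₁ (1ℚ - y) (suc-inverse j) (lem₁ x (ρ j) y)
      where
      lem₁ : ∀ x r y → y - 1ℚ - r * (x * y - x) ≡ (1ℚ - y) * (x * r - 1ℚ)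
      lem₁ = solve-∀ ringℚ
    lem₂ : ∀ x r y → y - 1ℚ ≡ r * (x * y - x) + 1ℚ * (y - 1ℚ - r * (x * y - x))
    lem₂ = solve-∀ ringℚ

  power-shift : ∀ {x} → Integral x → ∀ n →
                (x - π) ^ℚ suc n ≈ x ^ℚ suc n - # (suc n) * (π * x ^ℚ n) mod π²
  power-shift {x} Ix zero    = ≈-reflexive (lem x π)
    where
    lem : ∀ x π → (x - π) * 1ℚ ≡ x * 1ℚ - # 1 * (π * 1ℚ)
    lem = solve-∀ ringℚ
  power-shift {x} Ix (suc n) = ≈-trans (≈-*ˡ (Integral-minus Ix Integral-π) (power-shift Ix n))
    (congruent (Integral-* (Integral-# (suc n)) (Integral-^ Ix n))
      (linear₁ (π * (x * x ^ℚ n)) (#-suc (suc n)) (lem x π (x ^ℚ n) (# (suc n)) (# (suc (suc n))))))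
    where
    lem : ∀ x π y m m′ → (x - π) * (x * y - m * (π * y)) - (x * (x * y) - m′ * (π * (x * y)) + π * π * (m * y))
        ≡ π * (x * y) * (m′ - (1ℚ + m))
    lem = solve-∀ ringℚ

  -- The sum h₃ in terms of B_{p-3}

  module _ (e : ℕ) (e+3 : suc (suc (suc e)) ≡ N ℕ.+ N) where
    private
      m = suc e

    sgn-m : sgn m ≡ 1ℚ
    sgn-m = trans (lem (sgn m)) (trans (cong sgn e+3) (sgn-double N))
      where
      lem : ∀ s → s ≡ - - s
      lem = solve-∀ ringℚ

    power-pair : ∀ {j l} → Pair j l → # (suc l) ^ℚ m ≈ # (suc j) ^ℚ m - # m * (π * # (suc j) ^ℚ e) mod π²
    power-pair {j} {l} pair = ≈-trans (≈-reflexive (begin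
      # (suc l) ^ℚ m                    ≡⟨ cong (_^ℚ m) (trans (Pair-# pair) (lem (# (suc j)) π)) ⟩
      (- (# (suc j) - π)) ^ℚ m          ≡⟨ ^-neg (# (suc j) - π) m ⟩
      sgn m * (# (suc j) - π) ^ℚ m      ≡⟨ cong (_* (# (suc j) - π) ^ℚ m) sgn-m ⟩
      1ℚ * (# (suc j) - π) ^ℚ m         ≡⟨ ℚ.*-identityˡ _ ⟩
      (# (suc j) - π) ^ℚ m ∎)) (power-shift (Integral-# (suc j)) e)
      where
      lem : ∀ x π → - x + π * 1ℚ ≡ - (x - π)
      lem = solve-∀ ringℚ

    -- Here e = p - 4 and m = p - 3. By Fermat, modulo p, `t` is 1/8 and `a′` is h₃; `a` is an
    -- unknown to be eliminated.
    a a′ t : ℚ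
    a  = Σ< N (λ j → # (suc j) ^ℚ m)
    a′ = Σ< N (λ j → # (suc j) ^ℚ e)
    t  = # 2 ^ℚ e

    F : ℚ
    F = Σ< (N ℕ.+ N) (λ j → # (suc j) ^ℚ m)

    -- As m is even, (p-k)^m ≡ k^m - m p k^(m-1) modulo p². The two pairings used for h₂ thus give
    -- two equations for F.
    F-halves : F ≈ # 2 * a + - (# m * π) * a′ mod π²
    F-halves = ≈-trans (≈-reflexive (Σ-halves (λ j → # (suc j) ^ℚ m)))
      (≈-trans (≈-Σ N (λ j j<N → ≈-linear₁ (Integral-# 1) (power-pair (upper-Pair j<N))
          (lem (# (suc j) ^ℚ m) (# (suc (upper j)) ^ℚ m) (# m) π (# (suc j) ^ℚ e))))
        (≈-reflexive (Σ-linear N (# 2) (- (# m * π)) _ _)))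
      where
      lem : ∀ x y m π z → x + y - (# 2 * x + - (m * π) * z) ≡ # 1 * (y - (x - m * (π * z)))
      lem = solve-∀ ringℚ

    F-parities : F ≈ # 4 * t * a + - (# m * π * t) * a′ mod π²
    F-parities = ≈-trans (≈-reflexive (Σ-parities (λ j → # (suc j) ^ℚ m)))
      (≈-trans (≈-Σ N (λ r r<N → ≈-trans
          (≈-linear₁ (Integral-# 1) (power-pair (oddIndex-Pair r<N))
            (lem₁ (# (suc (suc (r ℕ.+ r))) ^ℚ m) (# (suc (oddIndex r)) ^ℚ m) (# m) π (# (suc (suc (r ℕ.+ r))) ^ℚ e)))
          (≈-reflexive (trans (cong₂ (λ u v → # 2 * u + - (# m * π) * v) (double r m) (double r e))
            (lem₂ t (# (suc r) ^ℚ m) (# (suc r) ^ℚ e) (# m) π)))))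
        (≈-reflexive (Σ-linear N (# 4 * t) (- (# m * π * t)) _ _)))
      where
      double : ∀ r n → # (suc (suc (r ℕ.+ r))) ^ℚ n ≡ # 2 ^ℚ n * # (suc r) ^ℚ n
      double r n = trans (cong (_^ℚ n) (trans (cong #_ (cong suc (sym (ℕ.+-suc r r)))) (#-double (suc r)))) (^-* (# 2) (# (suc r)) n)
      lem₁ : ∀ x y m π z → x + y - (# 2 * x + - (m * π) * z) ≡ # 1 * (y - (x - m * (π * z)))
      lem₁ = solve-∀ ringℚ
      lem₂ : ∀ t x z m π → # 2 * (# 2 * t * x) + - (m * π) * (t * z) ≡ # 4 * t * x + - (m * π * t) * z
      lem₂ = solve-∀ ringℚ

    powerSum-F : powerSum p m ≡ F
    powerSum-F = trans (Σ-shift (N ℕ.+ N) (λ k → # k ^ℚ m))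
      (trans (cong (_+ F) (ℚ.*-zeroˡ (# 0 ^ℚ e))) (ℚ.+-identityˡ F))

    power-e : ∀ {j} → j ℕ.< N ℕ.+ N → # (suc j) ^ℚ e ≈ ρ j * ρ j * ρ j mod π
    power-e {j} j< = ≈-linear₂ {c₂ = 1ℚ} (Integral-* (Integral-* Iρ Iρ) Iρ) fermat′ Integral-1 (≈-reflexive exact)
        (lem₂ x (ρ j) (x ^ℚ e))
      where
      x = # (suc j)
      Iρ = Integral-ρ j<
      fermat′ : x * (x * (x * x ^ℚ e)) ≈ 1ℚ mod π
      fermat′ = subst (λ n → x ^ℚ n ≈ 1ℚ mod π) (sym e+3) (fermat-unit j<)
      exact : x ^ℚ e ≡ ρ j * ρ j * ρ j * (x * (x * (x * x ^ℚ e)))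
      exact = linear₁ (- (x ^ℚ e) * (1ℚ + x * ρ j + x * ρ j * (x * ρ j))) (suc-inverse j) (lem₁ x (ρ j) (x ^ℚ e))
        where
        lem₁ : ∀ x r y → y - r * r * r * (x * (x * (x * y))) ≡ - y * (1ℚ + x * r + x * r * (x * r)) * (x * r - 1ℚ)
        lem₁ = solve-∀ ringℚ
      lem₂ : ∀ x r y → y - r * r * r ≡ r * r * r * (x * (x * (x * y)) - 1ℚ) + 1ℚ * (y - r * r * r * (x * (x * (x * y))))
      lem₂ = solve-∀ ringℚ

    a′-h₃ : a′ ≈ h₃ N mod π
    a′-h₃ = ≈-Σ N (λ j j<N → power-e (j<N⇒j<2N j<N))

    8t : # 8 * t ≈ 1ℚ mod π
    8t = ≈-trans (≈-reflexive (lem t)) (subst (λ n → # 2 ^ℚ n ≈ 1ℚ mod π) (sym e+3) (fermat-unit (ℕ.≤-trans (s≤s (s≤s z≤n)) 4≤2N)))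
      where
      lem : ∀ t → # 8 * t ≡ # 2 * (# 2 * (# 2 * t))
      lem = solve-∀ ringℚ

    #m : # m ≡ π - # 3
    #m = linear₂ (- 1ℚ) (#-+ 3 m) 1ℚ (cong (λ k → # (suc k)) e+3) (lem (# m) (# (3 ℕ.+ m)) π)
      where
      lem : ∀ m s π → m - (π - # 3) ≡ - 1ℚ * (s - (# 3 + m)) + 1ℚ * (s - π)
      lem = solve-∀ ringℚ

    Integral-a′ : Integral a′
    Integral-a′ = Integral-Σ N (λ j _ → Integral-^ (Integral-# (suc j)) e)

    m+1≤2N : suc m ℕ.≤ N ℕ.+ N
    m+1≤2N = ℕ.≤-trans (ℕ.n≤1+n (suc m)) (ℕ.≤-reflexive e+3)

    B : ℚ
    B = bernoulli m

    Integral-B : Integral B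
    Integral-B = proj₁ (bernoulli-congruent-upto m m+1≤2N m ℕ.≤-refl)

    F-πB : F ≈ π * B mod π²
    F-πB = ≈-trans (≈-reflexive (sym powerSum-F)) (proj₂ (bernoulli-congruent-upto m m+1≤2N m ℕ.≤-refl))

    Integral-t : Integral t
    Integral-t = Integral-^ (Integral-# 2) e

    -- Eliminating a from the two expansions of F gives (2t - 1) F ≈ - t m π a′.
    eliminated : (# 16 * t - # 8) * F ≈ - (# 8 * t * (# m * (π * a′))) mod π²
    eliminated = ≈-linear₂ {c₁ = # 16 * t} {c₂ = - # 8} (Integral-* (Integral-# 16) Integral-t) F-halves (Integral-neg (Integral-# 8)) F-parities
        (lem F a a′ t (# m) π)
      where
      lem : ∀ F a a′ t m π → (# 16 * t - # 8) * F - - (# 8 * t * (m * (π * a′)))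
          ≡ # 16 * t * (F - (# 2 * a + - (m * π) * a′)) + - # 8 * (F - (# 4 * t * a + - (m * π * t) * a′))
      lem = solve-∀ ringℚ

    -- Inserting 8t ≡ 1 and m ≡ -3 turns 16t - 8 into -6 and -8tm into 3. Knowing these modulo p is
    -- enough, since F ≡ pB and the other side both carry a factor p.
    3πa′ : # 3 * (π * a′) ≈ - (# 6 * (π * B)) mod π²
    3πa′ = ≈-trans right (≈-trans (≈-sym eliminated) left)
      where
      left : (# 16 * t - # 8) * F ≈ - (# 6 * (π * B)) mod π²
      left = ≈-linear₂ {c₁ = # 16 * t - # 8} {c₂ = # 2 * B} (Integral-minus (Integral-* (Integral-# 16) Integral-t) (Integral-# 8)) F-πB
          (Integral-* (Integral-# 2) Integral-B) (≈-scale π 8t) (lem F B t π)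
        where
        lem : ∀ F B t π → (# 16 * t - # 8) * F - - (# 6 * (π * B)) ≡ (# 16 * t - # 8) * (F - π * B) + # 2 * B * (π * (# 8 * t) - π * 1ℚ)
        lem = solve-∀ ringℚ
      m≈-3 : # 3 * (π * a′) ≈ - (# m * (π * a′)) mod π²
      m≈-3 = congruent Integral-a′ (linear₁ (π * a′) #m (lem (# m) π a′))
        where
        lem : ∀ m π a → # 3 * (π * a) - (- (m * (π * a)) + π * π * a) ≡ π * a * (m - (π - # 3))
        lem = solve-∀ ringℚ
      right : # 3 * (π * a′) ≈ - (# 8 * t * (# m * (π * a′))) mod π²
      right = ≈-linear₂ {c₁ = 1ℚ} {c₂ = # m * a′} Integral-1 m≈-3 (Integral-* (Integral-# m) Integral-a′) (≈-scale π 8t)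
          (lem (# m) π a′ t)
        where
        lem : ∀ m π a t → # 3 * (π * a) - - (# 8 * t * (m * (π * a)))
            ≡ 1ℚ * (# 3 * (π * a) - - (m * (π * a))) + m * a * (π * (# 8 * t) - π * 1ℚ)
        lem = solve-∀ ringℚ

    πh₃ : π * h₃ N ≈ - (# 2 * (π * B)) mod π²
    πh₃ = ≈-linear₃ {c₁ = - 1ℚ} {c₂ = ρ 2} {c₃ = 1ℚ} (Integral-neg Integral-1) (≈-scale π a′-h₃)
        (Integral-ρ (ℕ.≤-trans (s≤s (s≤s (s≤s z≤n))) 4≤2N)) 3πa′ Integral-1 (≈-reflexive third)
        (lem₁ (h₃ N) a′ B π (ρ 2))
      where
      third : π * a′ + # 2 * (π * B) ≡ ρ 2 * (# 3 * (π * a′) + # 6 * (π * B))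
      third = linear₁ (- (π * a′ + # 2 * (π * B))) (suc-inverse 2) (lem₂ (π * a′) (π * B) (ρ 2))
        where
        lem₂ : ∀ x y r → x + # 2 * y - r * (# 3 * x + # 6 * y) ≡ - (x + # 2 * y) * (# 3 * r - 1ℚ)
        lem₂ = solve-∀ ringℚ
      lem₁ : ∀ h a b π r → π * h - - (# 2 * (π * b))
           ≡ - 1ℚ * (π * a - π * h) + r * (# 3 * (π * a) - - (# 6 * (π * b)))
             + 1ℚ * (π * a + # 2 * (π * b) - r * (# 3 * (π * a) + # 6 * (π * b)))
      lem₁ = solve-∀ ringℚ

-- Assembling the congruence modulo p^5

denominator-0≢0 : ∀ n → denominator n 0ℚ ≢ 0ℚ
denominator-0≢0 zero    = λ ()
denominator-0≢0 (suc n) = *-nonzero (subst (_≢ 0ℚ) (sym factor≡) (*-nonzero (#suc≢0 31) (*-nonzero (*-nonzero nz nz) nz))) (denominator-0≢0 n)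
  where
  nz = #suc≢0 n
  lem : ∀ u → # 2 * u * (# 16 * (u * u) - 0ℚ) ≡ # 32 * (u * u * u)
  lem = solve-∀ ringℚ
  factor≡ : factor n 0ℚ ≡ # 32 * (# (suc n) * # (suc n) * # (suc n))
  factor≡ = trans (lem (1ℚ + # n)) (cong (λ u → # 32 * (u * u * u)) (sym (#-suc n)))

minus-one-power : ∀ n → (-[1+ 0 ] / 1) ^ℚ n ≡ sgn n
minus-one-power zero    = refl
minus-one-power (suc n) = trans (cong ((-[1+ 0 ] / 1) *_) (minus-one-power n)) (lem (sgn n))
  where
  lem : ∀ s → - 1ℚ * s ≡ - s
  lem = solve-∀ ringℚ

module Assembly (n : ℕ) (p-prime : Prime (suc (suc n ℕ.+ suc n))) (2≤N : 2 ℕ.≤ suc n)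
                (e : ℕ) (e+3 : suc (suc (suc e)) ≡ suc n ℕ.+ suc n) where
  private
    N = suc n
  open Estimates N p-prime 2≤N
  private
    k = h₃ N
    W = nodeWeight N
    T = normalisedSum
    𝐁 = B e e+3
    S S′ : ℚ
    S  = Σ< (suc N) summand
    S′ = sgn N * S
    π⁵ : ℚ
    π⁵ = π * π⁴

  S*W : S * W ≡ sgn N * (# 2 * T)
  S*W = *-cancelˡ (denominator-0≢0 N) (begin
    D * (S * W)                    ≡⟨ sym (ℚ.*-assoc D S W) ⟩
    D * S * W                      ≡⟨ cong (_* W) (sym (deformed-0 N)) ⟩
    deformed N 0ℚ * W              ≡⟨ interpolation n ⟩
    sgn N * nodeSum N              ≡⟨ cong (sgn N *_) nodeSum-normalised ⟩
    sgn N * (# 2 * (D * T))        ≡⟨ lem (sgn N) D T ⟩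
    D * (sgn N * (# 2 * T)) ∎)
    where
    D = denominator N 0ℚ
    lem : ∀ s D T → s * (# 2 * (D * T)) ≡ D * (s * (# 2 * T))
    lem = solve-∀ ringℚ

  S′*W : S′ * (# 12 * (π * W)) * # 4 ≡ π * (# 96 * T)
  S′*W = linear₂ (# 48 * π * sgn N) S*W (# 96 * π * T) (sgn² N) (lem (sgn N) S π W T)
    where
    lem : ∀ s S π W T → s * S * (# 12 * (π * W)) * # 4 - π * (# 96 * T)
        ≡ # 48 * π * s * (S * W - s * (# 2 * T)) + # 96 * π * T * (s * s - 1ℚ)
    lem = solve-∀ ringℚ

  p∤2 : ¬ (p ∣ 2)
  p∤2 = p∤small 1 (s≤s (ℕ.≤-trans (s≤s (s≤s z≤n)) 4≤2N))

  p∤3 : ¬ (p ∣ 3)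
  p∤3 = p∤small 2 (s≤s (ℕ.≤-trans (s≤s (s≤s (s≤s z≤n))) 4≤2N))

  p∤16 : ¬ (p ∣ 16)
  p∤16 = p∤* {4} {4} (p∤* {2} {2} p∤2 p∤2) (p∤* {2} {2} p∤2 p∤2)

  p∤96 : ¬ (p ∣ 96)
  p∤96 = p∤* {16} {6} p∤16 (p∤* {2} {3} p∤2 p∤3)

  p∤256^ : ∀ m → ¬ (p ∣ 256 ^ m)
  p∤256^ zero    = p∤1
  p∤256^ (suc m) = p∤* {256} (p∤* {16} {16} p∤16 p∤16) (p∤256^ m)

  -- The denominators are powers of 256, prime to the odd p. The bootstrap below starts from this
  -- fact.
  Integral-S′ : Integral S′
  Integral-S′ = Integral-* (Integral-sgn N) (Integral-Σ (suc N) (λ m _ →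
    Integral-* (Integral-* (Integral-# (6 ℕ.* m ℕ.+ 1)) (Integral-# (((2 ℕ.* m) C m) ^ 3)))
      (fraction (256 ^ m) (+ 1) (p∤256^ m) (trans (ℚ.*-comm (invPow 256 m) (# (256 ^ m))) (invPow-inverse 255 m)))))

  divide-by-96 : ∀ {x y q} → # 96 * x ≈ # 96 * y mod q → x ≈ y mod q
  divide-by-96 {x} {y} h = ≈-linear₂ {c₂ = 1ℚ} (Integral-⁻¹ (Unit-# p∤96)) h Integral-1 (≈-reflexive exact) (lem₂ x y (# 96 ⁻¹))
    where
    exact : x - y ≡ # 96 ⁻¹ * (# 96 * x - # 96 * y)
    exact = linear₁ (- (x - y)) (suc-inverse 95) (lem₁ x y (# 96 ⁻¹))
      where
      lem₁ : ∀ x y r → x - y - r * (# 96 * x - # 96 * y) ≡ - (x - y) * (# 96 * r - 1ℚ)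
      lem₁ = solve-∀ ringℚ
    lem₂ : ∀ x y r → x - y ≡ r * (# 96 * x - # 96 * y) + 1ℚ * (x - y - r * (# 96 * x - # 96 * y))
    lem₂ = solve-∀ ringℚ

  private
    Ik = Integral-h₃ (ℕ.m≤m+n N N)
    c₁ = _≈_mod_.quotient 12π*nodeWeight
    I₁ = _≈_mod_.integral 12π*nodeWeight
    c₂ = _≈_mod_.quotient 96normalisedSum
    I₂ = _≈_mod_.integral 96normalisedSum

  -- The expanded weights multiply S′, so S′ occurs on both sides; on the right it has a factor p³,
  -- and each congruence for S′ therefore yields a sharper one.
  balance : # 96 * S′ ≡ # 96 * π - # 10 * (π⁴ * k) + π⁵ * c₂ - # 4 * (S′ * (π³ * k + π⁴ * c₁))
  balance = linear₃ 1ℚ S′*W (- # 4 * S′) (_≈_mod_.eq 12π*nodeWeight) π (_≈_mod_.eq 96normalisedSum)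
      (lem S′ π (# 12 * (π * W)) (# 96 * T) k c₁ c₂)
    where
    lem : ∀ S π w t k c₁ c₂ →
        # 96 * S - (# 96 * π - # 10 * (π * (π * (π * π)) * k) + π * (π * (π * (π * π))) * c₂
                    - # 4 * (S * (π * (π * π) * k + π * (π * (π * π)) * c₁)))
      ≡ 1ℚ * (S * w * # 4 - π * t)
        + - # 4 * S * (w - (# 24 + π * (π * (π * k)) + π * (π * (π * π)) * c₁))
        + π * (t - (# 96 - # 10 * (π * (π * (π * k))) + π * (π * (π * π)) * c₂))
    lem = solve-∀ ringℚ

  -- The congruence is bootstrapped: modulo p, then p⁴, then p⁵.
  S′-mod-π : S′ ≈ 0ℚ mod π
  S′-mod-π = divide-by-96 (congruent
      (Integral-minus (Integral-+ (Integral-minus (Integral-# 96) (Integral-* (Integral-# 10) (Integral-* Iπ³ Ik))) (Integral-* Iπ⁴ I₂))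
        (Integral-* (Integral-# 4) (Integral-* Integral-S′ (Integral-+ (Integral-* Iπ² Ik) (Integral-* Iπ³ I₁)))))
      (trans balance (lem S′ π k c₁ c₂)))
    where
    Iπ² = Integral-* Integral-π Integral-π
    Iπ³ = Integral-* Integral-π Iπ²
    Iπ⁴ = Integral-* Integral-π Iπ³
    lem : ∀ S π k c₁ c₂ →
        # 96 * π - # 10 * (π * (π * (π * π)) * k) + π * (π * (π * (π * π))) * c₂
        - # 4 * (S * (π * (π * π) * k + π * (π * (π * π)) * c₁))
      ≡ # 96 * 0ℚ + π * (# 96 - # 10 * (π * (π * π) * k) + π * (π * (π * π)) * c₂
          - # 4 * (S * (π * π * k + π * (π * π) * c₁)))
    lem = solve-∀ ringℚ

  S′-mod-π⁴ : S′ ≈ π mod π⁴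
  S′-mod-π⁴ = divide-by-96 (congruent
      (Integral-minus (Integral-+ (Integral-neg (Integral-* (Integral-# 10) Ik)) (Integral-* Integral-π I₂))
        (Integral-* (Integral-# 4) (Integral-* Is (Integral-+ Ik (Integral-* Integral-π I₁)))))
      (linear₂ 1ℚ balance (- # 4 * (π³ * k + π⁴ * c₁)) (_≈_mod_.eq S′-mod-π) (lem S′ s π k c₁ c₂)))
    where
    s = _≈_mod_.quotient S′-mod-π
    Is = _≈_mod_.integral S′-mod-π
    lem : ∀ S s π k c₁ c₂ →
        # 96 * S - (# 96 * π + π * (π * (π * π)) * (- (# 10 * k) + π * c₂ - # 4 * (s * (k + π * c₁))))
      ≡ 1ℚ * (# 96 * S - (# 96 * π - # 10 * (π * (π * (π * π)) * k) + π * (π * (π * (π * π))) * c₂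
                    - # 4 * (S * (π * (π * π) * k + π * (π * (π * π)) * c₁))))
        + - # 4 * (π * (π * π) * k + π * (π * (π * π)) * c₁) * (S - (0ℚ + π * s))
    lem = solve-∀ ringℚ

  -- With S′ ≡ p the term 4 S′ p³ h₃ becomes 4 p⁴ h₃, and 10 + 4 = 14.
  96S′ : # 96 * S′ ≈ # 96 * π - # 14 * (π * (π * (π * (π * k)))) mod π⁵
  96S′ = congruent
      (Integral-minus (Integral-minus I₂ (Integral-* (Integral-# 4) I₁))
        (Integral-* (Integral-# 4) (Integral-* Is (Integral-+ (Integral-* Iπ² Ik) (Integral-* Iπ³ I₁)))))
      (linear₂ 1ℚ balance (- # 4 * (π³ * k + π⁴ * c₁)) (_≈_mod_.eq S′-mod-π⁴) (lem S′ s π k c₁ c₂))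
    where
    s = _≈_mod_.quotient S′-mod-π⁴
    Is = _≈_mod_.integral S′-mod-π⁴
    Iπ² = Integral-* Integral-π Integral-π
    Iπ³ = Integral-* Integral-π Iπ²
    lem : ∀ S s π k c₁ c₂ →
        # 96 * S - (# 96 * π - # 14 * (π * (π * (π * (π * k))))
                    + π * (π * (π * (π * π))) * (c₂ - # 4 * c₁ - # 4 * (s * (π * π * k + π * (π * π) * c₁))))
      ≡ 1ℚ * (# 96 * S - (# 96 * π - # 10 * (π * (π * (π * π)) * k) + π * (π * (π * (π * π))) * c₂
                    - # 4 * (S * (π * (π * π) * k + π * (π * (π * π)) * c₁))))
        + - # 4 * (π * (π * π) * k + π * (π * (π * π)) * c₁) * (S - (π + π * (π * (π * π)) * s))
    lem = solve-∀ ringℚ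

  -- Substituting h₃ ≡ -2B turns -14/96 into 28/96 = 7/24.
  S′-congruent : S′ ≈ π + (+ 7 / 24) * (π * (π * (π * (π * 𝐁)))) mod π⁵
  S′-congruent = divide-by-96 (≈-linear₂ {c₁ = 1ℚ} {c₂ = - # 14} Integral-1 96S′ (Integral-neg (Integral-# 14))
      (≈-scale π (≈-scale π (≈-scale π (πh₃ e e+3)))) (lem S′ π k 𝐁))
    where
    lem : ∀ S π k b → # 96 * S - # 96 * (π + (+ 7 / 24) * (π * (π * (π * (π * b)))))
        ≡ 1ℚ * (# 96 * S - (# 96 * π - # 14 * (π * (π * (π * (π * k))))))
          + - # 14 * (π * (π * (π * (π * k))) - π * (π * (π * - (# 2 * (π * b)))))
    lem = solve-∀ ringℚ

  S-congruent : Σ ℚ λ c → Integral c ×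
    (S - (π * sgn N + sgn N * ((+ 7 / 24) * (π ^ℚ 4 * bernoulli (suc e)))) ≡ π ^ℚ 5 * c)
  S-congruent = sgn N * c , Integral-* (Integral-sgn N) (_≈_mod_.integral S′-congruent) ,
    linear₂ (sgn N) (_≈_mod_.eq S′-congruent) (- S) (sgn² N) (lem (sgn N) S π 𝐁 c)
    where
    c = _≈_mod_.quotient S′-congruent
    lem : ∀ s S π b c →
        S - (π * s + s * ((+ 7 / 24) * (π * (π * (π * (π * 1ℚ))) * b))) - π * (π * (π * (π * (π * 1ℚ)))) * (s * c)
      ≡ s * (s * S - (π + (+ 7 / 24) * (π * (π * (π * (π * b)))) + π * (π * (π * (π * π))) * c)) + - S * (s * s - 1ℚ)
    lem = solve-∀ ringℚ

#-^ : ∀ p m → # (p ^ m) ≡ # p ^ℚ m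
#-^ p zero    = refl
#-^ p (suc m) = trans (#-* p (p ^ m)) (cong (# p *_) (#-^ p m))

integral⇒≡mod : ∀ p (p-prime : Prime p) m a b {c} → Localisation.Integral p p-prime c →
                a - b ≡ # p ^ℚ m * c → a ≡ b [mod p ^ m ]
integral⇒≡mod zero    p-prime = ⊥-elim (¬prime[0] p-prime)
integral⇒≡mod (suc k) p-prime m a b {c} I eq =
  Localisation.Integral⇒Coprime-↧ₙ (suc k) p-prime (subst (Localisation.Integral (suc k) p-prime) (sym quotient≡) I)
  where
  i = invPow (suc k) m
  quotient≡ : (a - b) * i ≡ c
  quotient≡ = linear₃ i eq (- (c * i)) (#-^ (suc k) m) c (invPow-inverse k m)
      (lem (a - b) i (# (suc k) ^ℚ m) (# (suc k ^ m)) c)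
    where
    lem : ∀ x i q q′ c → x * i - c ≡ i * (x - q * c) + - (c * i) * (q′ - q) + c * (q′ * i - 1ℚ)
    lem = solve-∀ ringℚ

-- Here p is a variable, so that matching on `refl` can replace it by 2N + 1, the form `Assembly`
-- requires.
congruence : ∀ p (p-prime : Prime p) n e → let N = suc n in
  p ≡ suc (N ℕ.+ N) → 2 ℕ.≤ N → suc (suc (suc e)) ≡ N ℕ.+ N →
  Σ ℚ λ c → Localisation.Integral p p-prime c ×
    (Σ< (suc N) summand - (# p * sgn N + sgn N * ((+ 7 / 24) * (# p ^ℚ 4 * bernoulli (suc e)))) ≡ # p ^ℚ 5 * c)
congruence _ p-prime n e refl 2≤N e+3 = Assembly.S-congruent n p-prime 2≤N e e+3

parity : ∀ n → Σ ℕ λ N → (n ≡ N ℕ.+ N) ⊎ (n ≡ suc (N ℕ.+ N))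
parity zero    = 0 , inj₁ refl
parity (suc n) with parity n
... | N , inj₁ eq = N , inj₂ (cong suc eq)
... | N , inj₂ eq = suc N , inj₁ (cong suc (trans eq (sym (ℕ.+-suc N N))))

double : ∀ N → N ℕ.+ N ≡ N ℕ.* 2
double N = trans (cong (N ℕ.+_) (sym (ℕ.+-identityʳ N))) (ℕ.*-comm 2 N)

prime>3 : ∀ p → Prime p → 3 < p → Σ ℕ λ n → let N = suc (suc n) in p ≡ suc (N ℕ.+ N)
prime>3 p p-prime 3<p with parity p
... | N , inj₁ p≡ = ⊥-elim (not-two (prime⇒irreducible p-prime (divides N (trans p≡ (double N)))))
  where
  not-two : 2 ≡ 1 ⊎ 2 ≡ p → ⊥
  not-two (inj₂ 2≡p) = ℕ.<⇒≱ 3<p (ℕ.≤-trans (ℕ.≤-reflexive (sym 2≡p)) (s≤s (s≤s z≤n)))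
... | zero , inj₂ p≡ = ⊥-elim (ℕ.<⇒≱ 3<p (ℕ.≤-trans (ℕ.≤-reflexive p≡) (s≤s z≤n)))
... | suc zero , inj₂ p≡ = ⊥-elim (ℕ.<⇒≱ 3<p (ℕ.≤-reflexive p≡))
... | suc (suc n) , inj₂ p≡ = n , p≡

theorem1p1 : (p : ℕ) → Prime p → 3 < p →
    Σ< (suc ((p ∸ 1) ℕ./ 2))
    (λ n → (ℕtoℚ (6 ℕ.* n ℕ.+ 1) ℚ.* ℕtoℚ (((2 ℕ.* n) C n) ^ 3)) ℚ.* (invPow 256 n))
    ≡ (ℕtoℚ p ℚ.* ((-[1+ 0 ] ℚ./ 1) ^ℚ ((p ∸ 1) ℕ./ 2))
    ℚ.+ ((-[1+ 0 ] ℚ./ 1) ^ℚ ((p ∸ 1) ℕ./ 2)) ℚ.* ((+ 7 ℚ./ 24) ℚ.* (ℕtoℚ (p ^ 4) ℚ.* bernoulli (p ∸ 3))))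
    [mod p ^ 5 ]
theorem1p1 p p-prime 3<p =
  integral⇒≡mod p p-prime 5 (Σ< (suc ((p ∸ 1) ℕ./ 2)) summand) R (proj₁ (proj₂ result))
    (trans (cong₂ _-_ (cong (λ M → Σ< (suc M) summand) half) right) (proj₂ (proj₂ result)))
  where
  n = proj₁ (prime>3 p p-prime 3<p)
  p≡ = proj₂ (prime>3 p p-prime 3<p)
  N = suc (suc n)
  -- With N = n + 2 the prime is 2n + 5, so e is p - 4 and the Bernoulli index p - 3 is e + 1.
  e = suc (n ℕ.+ n)
  e+3 : suc (suc (suc e)) ≡ N ℕ.+ N
  e+3 = cong (λ k → suc (suc k)) (sym (trans (ℕ.+-suc n (suc n)) (cong suc (ℕ.+-suc n n))))
  result = congruence p p-prime (suc n) e p≡ (s≤s (s≤s z≤n)) e+3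
  half : (p ∸ 1) ℕ./ 2 ≡ N
  half = trans (cong (λ q → (q ∸ 1) ℕ./ 2) p≡) (trans (cong (ℕ._/ 2) (double N)) (ℕ.m*n/n≡m N 2))
  p∸3 : p ∸ 3 ≡ suc e
  p∸3 = trans (cong (_∸ 3) p≡) (cong (λ k → suc k ∸ 3) (sym e+3))
  sign : (-[1+ 0 ] ℚ./ 1) ^ℚ ((p ∸ 1) ℕ./ 2) ≡ sgn N
  sign = trans (cong ((-[1+ 0 ] ℚ./ 1) ^ℚ_) half) (minus-one-power N)
  R = ℕtoℚ p ℚ.* ((-[1+ 0 ] ℚ./ 1) ^ℚ ((p ∸ 1) ℕ./ 2))
      ℚ.+ ((-[1+ 0 ] ℚ./ 1) ^ℚ ((p ∸ 1) ℕ./ 2)) ℚ.* ((+ 7 ℚ./ 24) ℚ.* (ℕtoℚ (p ^ 4) ℚ.* bernoulli (p ∸ 3)))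
  right : R ≡ # p * sgn N + sgn N * ((+ 7 / 24) * (# p ^ℚ 4 * bernoulli (suc e)))
  right = cong₂ (λ s b → # p * s + s * ((+ 7 / 24) * b)) sign (cong₂ (λ q m → q * bernoulli m) (#-^ p 4) p∸3)
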